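{- The generating function of permutations with respect to the triple $(\mathsf{des},\mathsf{lmax},\mathsf{lmin})$, or equivalently $(\mathsf{ides},\mathsf{lmax},\mathsf{lmin})$, is $$\sum_{n=1}^{\infty}\sum_{\pi\in\mathfrak{S}_n}\frac{u^{\mathsf{des}(\pi)}z^{\mathsf{lmax}(\pi)}q^{\mathsf{lmin}(\pi)}t^n}{(1-u)^n}=\sum_{n=0}^{\infty}\frac{qzt\,u^n}{1-(n-q+1)t}\prod_{i=0}^{n}\frac{1-(i-q+1)t}{1-(i+z)t}.$$ In fact, for every $n\ge 1$, $(\mathsf{des},\mathsf{lmax},\mathsf{lmin},\mathsf{rmax})$ and $(\mathsf{ides},\mathsf{lmax},\mathsf{lmin},\mathsf{rmax})$ have the same distribution on $\mathfrak{S}_n$.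
   Context: $\mathfrak{S}_n$ is the set of permutations $\pi=\pi_1\pi_2\cdots\pi_n$ of $[n]=\{1,\dots,n\}$. $\mathsf{des}(\pi)=|\{i\in[n-1]:\pi_i>\pi_{i+1}\}|$; $\mathsf{ides}(\pi)=\mathsf{des}(\pi^{ -1})$; $\mathsf{lmax}(\pi)=|\{\pi_i:\pi_i>\pi_j\text{ for all }j<i\}|$; $\mathsf{lmin}(\pi)=|\{\pi_i:\pi_i<\pi_j\text{ for all }j<i\}|$; $\mathsf{rmax}(\pi)=|\{\pi_i:\pi_i>\pi_j\text{ for all }j>i\}|$. Two tuples of statistics have the same distribution on a finite set if each tuple of values is attained by the same number of elements. The identity is one of formal power series in $u$ (with coefficients that are rational in $t$, expanded as power series in $t$). -}

module Defs where

open import Algebra.Bundles using (CommutativeRing; Semiring)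
import Algebra.Definitions.RawSemiring as RawSemiringDefinitions
import Algebra.Properties.Semiring.Exp as Exponentiation
import Algebra.Properties.Semiring.Mult as Multiplication
import Algebra.Properties.Semiring.Sum as SemiringSum
open import Data.Fin as Fin using (Fin; zero; suc; toℕ; inject₁; punchIn)
import Data.Fin.Properties as Fin
open import Data.Fin.Permutation as Perm using (Permutation′; _⟨$⟩ʳ_; insert; remove)
open import Data.List using (List; [_]; allFin; cartesianProductWith; filter; foldr; length; map)
import Data.List.Membership.Setoid as Membership
open import Data.List.Membership.Propositional.Properties using (∈-allFin)
import Data.List.Membership.Setoid.Properties as Membership
open import Data.List.Relation.Unary.All using ([])
open import Data.List.Relation.Unary.AllPairs using ([]; _∷_)
open import Data.List.Relation.Unary.Any using (here)
open import Data.List.Relation.Unary.Unique.Setoid using (Unique)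
import Data.List.Relation.Unary.Unique.Setoid.Properties as Unique
open import Data.List.Relation.Unary.Unique.Propositional.Properties using (allFin⁺)
open import Data.Nat as ℕ using (ℕ; zero; suc; _∸_)
open import Data.Product using (∃-syntax; _×_; _,_)
open import Data.Vec.Functional using (Vector) renaming (_∷_ to _∷ᵛ_)
open import Level using (Level; 0ℓ)
open import Relation.Binary using (Setoid; DecidableEquality)
open import Relation.Binary.PropositionalEquality as ≡ using (_≡_)
open import Relation.Nullary.Decidable using (_→-dec_)
open import Relation.Unary using (Pred; Decidable)

private
  variable
    a c ℓ p : Level
    n : ℕ

-- π₁π₂⋯πₙ is read off as π ⟨$⟩ʳ 0, …, π ⟨$⟩ʳ (n-1): positions and values
-- are shifted down by one, which preserves all comparisons.

permutationSetoid : ℕ → Setoid 0ℓ 0ℓ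
permutationSetoid n = record
  { Carrier       = Permutation′ n
  ; _≈_           = Perm._≈_
  ; isEquivalence = record
    { refl  = λ _ → ≡.refl
    ; sym   = λ e i → ≡.sym (e i)
    ; trans = λ e f i → ≡.trans (e i) (f i)
    }
  }

-- Every permutation occurs in this list exactly once up to pointwise
-- equality, see ∈-𝔖 and 𝔖-unique.
𝔖 : ∀ n → List (Permutation′ n)
𝔖 zero    = [ Perm.id ]
𝔖 (suc n) = cartesianProductWith (insert zero) (allFin (suc n)) (𝔖 n)

private
  insert₀-cong : ∀ {j k : Fin (suc n)} {π ρ : Permutation′ n} → j ≡ k → π Perm.≈ ρ →
                 insert zero j π Perm.≈ insert zero k ρ
  insert₀-cong         ≡.refl e zero    = ≡.refl
  insert₀-cong {j = j} ≡.refl e (suc i) = ≡.cong (punchIn j) (e i)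

  insert₀-injective : ∀ {j k : Fin (suc n)} {π ρ : Permutation′ n} →
                      insert zero j π Perm.≈ insert zero k ρ → j ≡ k × π Perm.≈ ρ
  insert₀-injective {j = j} e with ≡.refl ← e zero =
    ≡.refl , λ i → Fin.punchIn-injective j _ _ (e (suc i))

∈-𝔖 : (π : Permutation′ n) → Membership._∈_ (permutationSetoid n) π (𝔖 n)
∈-𝔖 {zero}  π = here λ ()
∈-𝔖 {suc n} π = Membership.∈-resp-≈ (permutationSetoid (suc n))
  {x = insert zero (π ⟨$⟩ʳ zero) (remove zero π)} {y = π}
  (Perm.insert-remove zero π)
  (Membership.∈-cartesianProductWith⁺
    (≡.setoid _) (permutationSetoid n) (permutationSetoid (suc n))
    (λ {x} {y} {u} {v} → insert₀-cong {π = u} {ρ = v})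
    (∈-allFin (π ⟨$⟩ʳ zero)) (∈-𝔖 (remove zero π)))

𝔖-unique : ∀ n → Unique (permutationSetoid n) (𝔖 n)
𝔖-unique zero    = [] ∷ []
𝔖-unique (suc n) = Unique.cartesianProductWith⁺
  (≡.setoid _) (permutationSetoid n) (permutationSetoid (suc n))
  (insert zero) (λ {w} {x} {y} {z} → insert₀-injective {π = y} {ρ = z})
  (allFin⁺ (suc n)) (𝔖-unique n)

count : {P : Pred (Fin n) p} → Decidable P → ℕ
count {n = n} P? = length (filter P? (allFin n))

des : Permutation′ n → ℕ
des {zero}  π = 0
des {suc m} π = count {m} λ i → π ⟨$⟩ʳ suc i Fin.<? π ⟨$⟩ʳ inject₁ i

ides : Permutation′ n → ℕ
ides π = des (Perm.flip π)

-- The entries of a permutation are distinct, so counting the positions i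
-- below is the same as counting the values π ⟨$⟩ʳ i.

lmax : Permutation′ n → ℕ
lmax π = count λ i → Fin.all? λ j → (j Fin.<? i) →-dec (π ⟨$⟩ʳ j Fin.<? π ⟨$⟩ʳ i)

lmin : Permutation′ n → ℕ
lmin π = count λ i → Fin.all? λ j → (j Fin.<? i) →-dec (π ⟨$⟩ʳ i Fin.<? π ⟨$⟩ʳ j)

rmax : Permutation′ n → ℕ
rmax π = count λ i → Fin.all? λ j → (i Fin.<? j) →-dec (π ⟨$⟩ʳ j Fin.<? π ⟨$⟩ʳ i)

#_attaining_via_ : {A : Set a} → (Permutation′ n → A) → A → DecidableEquality A → ℕ
# f attaining x via _≟_ = length (filter (λ π → f π ≟ x) (𝔖 _))

SameDistribution : {A : Set a} → DecidableEquality A → (f g : Permutation′ n → A) → Set a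
SameDistribution _≟_ f g = ∀ x → # f attaining x via _≟_ ≡ # g attaining x via _≟_

module PowerSeries (R : CommutativeRing c ℓ) where
  private
    open module R = CommutativeRing R using (Carrier; _≈_; 0#; 1#)
    open SemiringSum R.semiring

  -- A series is the sequence of its coefficients.
  Series : Set c
  Series = ℕ → Carrier

  infix 4 _≋_
  _≋_ : Series → Series → Set ℓ
  f ≋ g = ∀ n → f n ≈ g n

  constant : Carrier → Series
  constant x zero    = x
  constant x (suc _) = 0#

  X : Series
  X 1 = 1#
  X _ = 0#

  infixl 6 _+_
  _+_ : Series → Series → Series
  (f + g) n = f n R.+ g n

  infixl 7 _*_
  _*_ : Series → Series → Series
  (f * g) n = ∑[ i ≤ n ] (f (toℕ i) R.* g (n ∸ toℕ i))

  -_ : Series → Series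
  (- f) n = R.- f n

  private
    open import Relation.Binary.Reasoning.Setoid R.setoid
    open import Algebra.Properties.CommutativeSemigroup
      R.+-commutativeSemigroup using (interchange)

    tail : Series → Series
    tail f n = f (suc n)

    scale : Carrier → Series → Series
    scale x f n = x R.* f n

    -- (f * g) (suc n) unfolds to f 0 R.* g (suc n) R.+ (tail f * g) n,
    -- which drives the inductions below.

    *-cong : ∀ {f f′ g g′} → f ≋ f′ → g ≋ g′ → f * g ≋ f′ * g′
    *-cong e e′ n = sum-cong-≋ {suc n} λ i → R.*-cong (e (toℕ i)) (e′ (n ∸ toℕ i))

    distribʳ : ∀ h f g → (f + g) * h ≋ f * h + g * h
    distribʳ h f g n = R.trans
      (sum-cong-≋ {suc n} λ i → R.distribʳ (h (n ∸ toℕ i)) (f (toℕ i)) (g (toℕ i)))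
      (∑-distrib-+ {suc n} (λ i → f (toℕ i) R.* h (n ∸ toℕ i)) λ i → g (toℕ i) R.* h (n ∸ toℕ i))

    scale-* : ∀ x f g → scale x f * g ≋ scale x (f * g)
    scale-* x f g n = R.trans
      (sum-cong-≋ {suc n} λ i → R.*-assoc x (f (toℕ i)) (g (n ∸ toℕ i)))
      (R.sym (*-distribˡ-sum {suc n} x λ i → f (toℕ i) R.* g (n ∸ toℕ i)))

    *-unfoldʳ : ∀ f g n → (f * g) (suc n) ≈ (f * tail g) n R.+ f (suc n) R.* g 0
    *-unfoldʳ f g zero    = begin
      f 0 R.* g 1 R.+ (f 1 R.* g 0 R.+ 0#)  ≈⟨ R.+-assoc _ _ _ ⟨
      f 0 R.* g 1 R.+ f 1 R.* g 0 R.+ 0#    ≈⟨ R.+-identityʳ _ ⟩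
      f 0 R.* g 1 R.+ f 1 R.* g 0           ≈⟨ R.+-congʳ (R.+-identityʳ _) ⟨
      f 0 R.* g 1 R.+ 0# R.+ f 1 R.* g 0    ∎
    *-unfoldʳ f g (suc n) = R.trans
      (R.+-congˡ (*-unfoldʳ (tail f) g n)) (R.sym (R.+-assoc _ _ _))

    *-comm : ∀ f g → f * g ≋ g * f
    *-comm f g zero    = R.+-congʳ (R.*-comm _ _)
    *-comm f g (suc n) = begin
      f 0 R.* g (suc n) R.+ (tail f * g) n  ≈⟨ R.+-cong (R.*-comm _ _) (*-comm (tail f) g n) ⟩
      g (suc n) R.* f 0 R.+ (g * tail f) n  ≈⟨ R.+-comm _ _ ⟩
      (g * tail f) n R.+ g (suc n) R.* f 0  ≈⟨ *-unfoldʳ g f n ⟨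
      (g * f) (suc n)                       ∎

    *-assoc : ∀ f g h → (f * g) * h ≋ f * (g * h)
    *-assoc f g h zero    = R.+-congʳ (begin
      (f 0 R.* g 0 R.+ 0#) R.* h 0    ≈⟨ R.*-congʳ (R.+-identityʳ _) ⟩
      f 0 R.* g 0 R.* h 0             ≈⟨ R.*-assoc _ _ _ ⟩
      f 0 R.* (g 0 R.* h 0)           ≈⟨ R.*-congˡ (R.+-identityʳ _) ⟨
      f 0 R.* (g 0 R.* h 0 R.+ 0#)    ∎)
    *-assoc f g h (suc n) = begin
      (f * g) 0 R.* h (suc n) R.+ ((scale (f 0) (tail g) + tail f * g) * h) n
        ≈⟨ R.+-cong
             (R.trans (R.*-congʳ (R.+-identityʳ _)) (R.*-assoc _ _ _))
             (R.trans (distribʳ h (scale (f 0) (tail g)) (tail f * g) n)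
               (R.+-cong (scale-* (f 0) (tail g) h n) (*-assoc (tail f) g h n))) ⟩
      f 0 R.* (g 0 R.* h (suc n)) R.+ (f 0 R.* (tail g * h) n R.+ (tail f * (g * h)) n)
        ≈⟨ R.+-assoc _ _ _ ⟨
      f 0 R.* (g 0 R.* h (suc n)) R.+ f 0 R.* (tail g * h) n R.+ (tail f * (g * h)) n
        ≈⟨ R.+-congʳ (R.distribˡ _ _ _) ⟨
      (f * (g * h)) (suc n) ∎

    0-* : ∀ g → (λ _ → 0#) * g ≋ (λ _ → 0#)
    0-* g n = R.trans (sum-cong-≋ {suc n} λ i → R.zeroˡ (g (n ∸ toℕ i))) (sum-replicate-zero (suc n))

    *-identityˡ : ∀ f → constant 1# * f ≋ f
    *-identityˡ f zero    = R.trans (R.+-identityʳ _) (R.*-identityˡ _)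
    *-identityˡ f (suc n) = R.trans (R.+-cong (R.*-identityˡ _) (0-* f n)) (R.+-identityʳ _)

  commutativeRing : CommutativeRing c ℓ
  commutativeRing = record
    { Carrier = Series
    ; _≈_ = _≋_
    ; _+_ = _+_
    ; _*_ = _*_
    ; -_ = -_
    ; 0# = λ _ → 0#
    ; 1# = constant 1#
    ; isCommutativeRing = record
      { isRing = record
        { +-isAbelianGroup = record
          { isGroup = record
            { isMonoid = record
              { isSemigroup = record
                { isMagma = record
                  { isEquivalence = record
                    { refl  = λ _ → R.refl
                    ; sym   = λ e n → R.sym (e n)
                    ; trans = λ e e′ n → R.trans (e n) (e′ n)
                    }
                  ; ∙-cong = λ e e′ n → R.+-cong (e n) (e′ n)
                  }
                ; assoc = λ f g h n → R.+-assoc (f n) (g n) (h n)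
                }
              ; identity = (λ f n → R.+-identityˡ (f n)) , (λ f n → R.+-identityʳ (f n))
              }
            ; inverse = (λ f n → R.-‿inverseˡ (f n)) , (λ f n → R.-‿inverseʳ (f n))
            ; ⁻¹-cong = λ e n → R.-‿cong (e n)
            }
          ; comm = λ f g n → R.+-comm (f n) (g n)
          }
        ; *-cong = *-cong
        ; *-assoc = *-assoc
        ; *-identity = *-identityˡ , λ f n → R.trans (*-comm f (constant 1#) n) (*-identityˡ f n)
        ; distrib =
            (λ f g h n → R.trans (*-comm f (g + h) n) (R.trans (distribʳ f g h n)
              (R.+-cong (*-comm g f n) (*-comm h f n))))
          , distribʳ
        }
      ; *-comm = *-comm
      }
    }

  -- The multiplicative inverse of a series g with g 0 ≈ 1# (see
  -- *-reciprocal); no meaning is attached to it for other g.  The vector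
  -- reciprocals g n lists the coefficients of 1/g of index n, n-1, …, 0.
  reciprocals : Series → ∀ n → Vector Carrier (suc n)
  reciprocals g zero    = λ _ → 1#
  reciprocals g (suc n) =
    (R.- (∑[ i ≤ n ] (g (suc (toℕ i)) R.* reciprocals g n i))) ∷ᵛ reciprocals g n

  reciprocal : Series → Series
  reciprocal g n = reciprocals g n zero

  infixl 7 _/_
  _/_ : Series → Series → Series
  f / g = f * reciprocal g

  private
    reciprocals-lookup : ∀ g n i → reciprocals g n i ≡ reciprocal g (n ∸ toℕ i)
    reciprocals-lookup g zero    zero    = ≡.refl
    reciprocals-lookup g (suc n) zero    = ≡.refl
    reciprocals-lookup g (suc n) (suc i) = reciprocals-lookup g n i

  *-reciprocal : ∀ g → g 0 ≈ 1# → g * reciprocal g ≋ constant 1#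
  *-reciprocal g e zero    = R.trans (R.+-identityʳ _) (R.trans (R.*-identityʳ _) e)
  *-reciprocal g e (suc n) = begin
    g 0 R.* (R.- s) R.+ (tail g * reciprocal g) n
      ≈⟨ R.+-cong
           (R.trans (R.*-congʳ e) (R.*-identityˡ _))
           (sum-cong-≋ {suc n} λ i →
             R.*-congˡ {g (suc (toℕ i))} (R.reflexive (≡.sym (reciprocals-lookup g n i)))) ⟩
    R.- s R.+ s
      ≈⟨ R.-‿inverseˡ s ⟩
    0# ∎
    where s = ∑[ i ≤ n ] (g (suc (toℕ i)) R.* reciprocals g n i)

-- z and q are arbitrary elements of an arbitrary commutative ring R; the
-- case of two indeterminates is R = ℤ[z,q].
module GeneratingFunction (R : CommutativeRing c ℓ) (z q : CommutativeRing.Carrier R) where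

  module R = CommutativeRing R
  module R⟦t⟧ = PowerSeries R
  module R⟦t⟧⟦u⟧ = PowerSeries R⟦t⟧.commutativeRing

  -- f k m is the coefficient of uᵏtᵐ in f : R⟦t⟧⟦u⟧.Series.

  -- Convergence of Σ_{n≥0} F n to s: every coefficient of the partial sums
  -- is eventually equal to that of s.
  infix 4 _SumsTo_
  _SumsTo_ : (ℕ → R⟦t⟧⟦u⟧.Series) → R⟦t⟧⟦u⟧.Series → Set ℓ
  F SumsTo s = ∀ k m → ∃[ N ] ∀ n → N ℕ.≤ n → (∑[ i < n ] F (toℕ i)) k m R.≈ s k m
    where open SemiringSum (CommutativeRing.semiring R⟦t⟧⟦u⟧.commutativeRing)

  lhsTerm : (stat : ∀ {n} → Permutation′ n → ℕ) → ℕ → R⟦t⟧⟦u⟧.Series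
  lhsTerm stat n =
    foldr _+_ 0# (map (λ π → u ^ stat π * z′ ^ lmax π * q′ ^ lmin π * t ^ n / (1# - u) ^ n) (𝔖 n))
    where
    open CommutativeRing R⟦t⟧⟦u⟧.commutativeRing using (_+_; _*_; _-_; 0#; 1#; semiring)
    open Exponentiation semiring using (_^_)
    open R⟦t⟧⟦u⟧ using (_/_)
    u  = R⟦t⟧⟦u⟧.X
    t  = R⟦t⟧⟦u⟧.constant R⟦t⟧.X
    z′ = R⟦t⟧⟦u⟧.constant (R⟦t⟧.constant z)
    q′ = R⟦t⟧⟦u⟧.constant (R⟦t⟧.constant q)

  -- All denominators here and in lhsTerm have constant coefficient 1#, so
  -- *-reciprocal applies: those below are of the form 1# - a * t, expanded
  -- in powers of t.
  rhsCoefficient : ℕ → R⟦t⟧.Series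
  rhsCoefficient n =
    (q′ * z′ * t / (1# - (fromℕ n - q′ + 1#) * t))
      * product {suc n} (λ i →
          (1# - (fromℕ (toℕ i) - q′ + 1#) * t) / (1# - (fromℕ (toℕ i) + z′) * t))
    where
    open CommutativeRing R⟦t⟧.commutativeRing
      using (_+_; _*_; _-_; 1#; semiring)
    open RawSemiringDefinitions (Semiring.rawSemiring semiring) using (product)
    open Multiplication semiring using () renaming (_×_ to _·_)
    open R⟦t⟧ using (_/_)
    fromℕ = λ k → k · 1#
    t  = R⟦t⟧.X
    z′ = R⟦t⟧.constant z
    q′ = R⟦t⟧.constant q

  rhsTerm : ℕ → R⟦t⟧⟦u⟧.Series
  rhsTerm n = R⟦t⟧⟦u⟧.constant (rhsCoefficient n) * u ^ n
    where
    open CommutativeRing R⟦t⟧⟦u⟧.commutativeRing using (_*_; semiring)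
    open Exponentiation semiring using (_^_)
    u = R⟦t⟧⟦u⟧.X

{-# OPTIONS --safe #-}
module Submission where

-- Put k bars into π, at least one at every descent.  Recording for every
-- value the block that contains it turns the barred permutations into the
-- words b over {0, …, k}, and lmin, lmax, rmax into the numbers of strict
-- left-to-right minima, weak right-to-left minima and strict right-to-left
-- maxima of b.  If the first block is required to be nonempty, that is, if b
-- contains 0, then π has [uᵏ] u^(des π)/(1-u)ⁿ barrings.  So everything is
-- read off Dₖ, the series in t of the words over {0, …, k} containing 0, with
-- weight y^lmin x^lmax w^rmax.
--
-- Reflection in the antidiagonal exchanges des with ides and lmin with rmax,
-- hence the equidistribution says that Dₖ is symmetric in y and w.  Cut a word
-- at its first 0.  If N is the largest letter of the part after it, the part
-- before it counts for y in full but for w only through letters > N; let F_N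
-- be its series, and E_N(w) = ∏_{1≤j≤N} (1 + wt/(1-jt)).  Summation over the
-- second part gives Dₖ = xywt (E₀F₀ + Σ_N c_N E_N F_N) with c_N free of y and
-- w, and cutting the words counted by F_N at their first minimum gives a
-- recursion for E_N F_N in which y and w play the same role.
--
-- At y = 1, Dₖ is the difference between all words over k + 1 and over k
-- letters, which is a product; by symmetry so is Dₖ at w = 1, and this product
-- is the coefficient of uᵏ on the right hand side.

open import Defs
open import Algebra.Bundles using (CommutativeRing; Semiring)
import Algebra.Definitions.RawSemiring as RawSemiringDefinitions
import Algebra.Properties.CommutativeMonoid.Sum as Summation
import Algebra.Properties.CommutativeSemigroup as CommutativeSemigroupProperties
import Algebra.Properties.Group as GroupProperties
import Algebra.Properties.Monoid.Sum as MonoidSum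
import Algebra.Properties.Ring as RingProperties
import Algebra.Properties.Semiring.Exp as Exponentiation
import Algebra.Properties.Semiring.Mult as Multiplication
import Algebra.Properties.Semiring.Sum as SemiringSum
import Algebra.Solver.Ring.NaturalCoefficients.Default as SemiringSolver
open import Data.Bool using (Bool; true; false; if_then_else_)
open import Data.Fin as Fin using (Fin; zero; suc; toℕ; inject₁; punchIn; opposite; fromℕ<)
import Data.Fin.Properties as Fin
open import Data.Fin.Permutation as Perm using (Permutation′; _⟨$⟩ʳ_; _⟨$⟩ˡ_; _∘ₚ_; insert; remove)
import Data.Integer as ℤ
import Data.Integer.Properties as ℤ
open import Data.List using (List; []; _∷_; _++_; _∷ʳ_; length; filter; tabulate; allFin; foldr; map; cartesianProductWith)
import Data.List.Membership.Setoid as Membership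
import Data.List.Properties as List
open import Data.List.Relation.Unary.All as All using (All; []; _∷_)
open import Data.List.Relation.Unary.AllPairs using ([]; _∷_)
open import Data.List.Relation.Unary.Any using (here; there)
open import Data.List.Relation.Unary.Unique.Setoid using (Unique)
open import Data.Nat as ℕ using (ℕ; zero; suc; z≤n; s≤s; _≤_; _<_; _≥_; _<ᵇ_; _≟_)
import Data.Nat.Properties as ℕ
open import Data.Product using (_×_; _,_; proj₁; proj₂; ∃-syntax)
open import Data.Product.Properties using (≡-dec)
open import Data.Sum using (inj₁; inj₂)
open import Data.Unit using (⊤; tt)
open import Function using (_∘_; _⇔_; mk⇔; Equivalence)
open import Level using (Level) renaming (_⊔_ to _⊔ˡ_)
open import Relation.Binary.PropositionalEquality as ≡ using (_≡_)
import Relation.Binary.Reasoning.Setoid as SetoidReasoning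
open import Relation.Nullary using (Dec; yes; no; does; contradiction; ¬_)
open import Relation.Nullary.Decidable using (does-⇔; dec-true; dec-false; _→-dec_; _×-dec_)
open import Relation.Unary using (Pred; Decidable)

open Summation ℕ.+-0-commutativeMonoid using (sum; sum-cong-≗; sum-permute)
open Equivalence using (to; from)

-- The strict and weak inequalities come from the increasing blocks. Two values of one block stand
-- in increasing order, so a value is a left-to-right minimum of π if all smaller values lie in
-- strictly later blocks, and a left-to-right maximum if no larger value lies in an earlier block;
-- for a right-to-left maximum the larger values must lie in strictly earlier blocks. The obstacle
-- to the symmetry is that y is earned by the whole part before the first 0, but w only by the
-- letters above N there, so for N ≥ 1 the series F_N alone is not symmetric. E_N makes up for this.
-- Read from the right, a word over the letters 1, ..., N is a chain of new maxima, each new maximum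
-- j being followed by letters that are at most j; hence E_N is the series of these words with a w
-- for each strict right-to-left maximum. Multiplying by E_N gives back to w the letters that N
-- hides, and the symmetry goes through by induction on the alphabet, for all N at once.

private variable
  n : ℕ

-- Sums over ranges and telescoping identities

module RangeSum {c ℓ} (S : CommutativeRing c ℓ) where
  open CommutativeRing S hiding (zero)
  open SetoidReasoning setoid
  open CommutativeSemigroupProperties +-commutativeSemigroup using (interchange)

  ∑ : ℕ → ℕ → (ℕ → Carrier) → Carrier
  ∑ lo zero    f = 0#
  ∑ lo (suc r) f = f lo + ∑ (suc lo) r f

  ∑-cong-< : ∀ lo r {f g} → (∀ a → lo ≤ a → a < r ℕ.+ lo → f a ≈ g a) → ∑ lo r f ≈ ∑ lo r g
  ∑-cong-< lo zero    h = refl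
  ∑-cong-< lo (suc r) h = +-cong (h lo ℕ.≤-refl (s≤s (ℕ.m≤n+m lo r)))
    (∑-cong-< (suc lo) r λ a l u → h a (ℕ.<⇒≤ l) (≡.subst (a <_) (ℕ.+-suc r lo) u))

  ∑-cong : ∀ lo r {f g} → (∀ a → f a ≈ g a) → ∑ lo r f ≈ ∑ lo r g
  ∑-cong lo r h = ∑-cong-< lo r λ a _ _ → h a

  ∑-+ : ∀ lo r f g → ∑ lo r (λ a → f a + g a) ≈ ∑ lo r f + ∑ lo r g
  ∑-+ lo zero    f g = sym (+-identityˡ 0#)
  ∑-+ lo (suc r) f g = trans (+-congˡ (∑-+ (suc lo) r f g)) (interchange _ _ _ _)

  ∑-0 : ∀ lo r → ∑ lo r (λ _ → 0#) ≈ 0#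
  ∑-0 lo zero    = refl
  ∑-0 lo (suc r) = trans (+-identityˡ _) (∑-0 (suc lo) r)

  ∑-*ˡ : ∀ lo r x f → ∑ lo r (λ a → x * f a) ≈ x * ∑ lo r f
  ∑-*ˡ lo zero    x f = sym (zeroʳ x)
  ∑-*ˡ lo (suc r) x f = trans (+-congˡ (∑-*ˡ (suc lo) r x f)) (sym (distribˡ _ _ _))

  ∑-*ʳ : ∀ lo r x f → ∑ lo r (λ a → f a * x) ≈ ∑ lo r f * x
  ∑-*ʳ lo r x f = trans (∑-cong lo r λ a → *-comm _ _) (trans (∑-*ˡ lo r x f) (*-comm _ _))

  ∑-comm : ∀ lo r lo′ r′ (f : ℕ → ℕ → Carrier) →
    ∑ lo r (λ a → ∑ lo′ r′ (f a)) ≈ ∑ lo′ r′ (λ b → ∑ lo r λ a → f a b)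
  ∑-comm lo zero    lo′ r′ f = sym (∑-0 lo′ r′)
  ∑-comm lo (suc r) lo′ r′ f =
    trans (+-congˡ (∑-comm (suc lo) r lo′ r′ f)) (sym (∑-+ lo′ r′ _ _))

  ∑-shift : ∀ k lo r f → ∑ (lo ℕ.+ k) r f ≡ ∑ lo r (λ a → f (a ℕ.+ k))
  ∑-shift k lo zero    f = ≡.refl
  ∑-shift k lo (suc r) f = ≡.cong (f (lo ℕ.+ k) +_) (∑-shift k (suc lo) r f)

  ∑-suc : ∀ lo r f → ∑ (suc lo) r f ≡ ∑ lo r (f ∘ suc)
  ∑-suc lo zero    f = ≡.refl
  ∑-suc lo (suc r) f = ≡.cong (f (suc lo) +_) (∑-suc (suc lo) r f)

  ∑-split : ∀ lo d e f → ∑ lo (d ℕ.+ e) f ≈ ∑ lo d f + ∑ (d ℕ.+ lo) e f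
  ∑-split lo zero    e f = sym (+-identityˡ _)
  ∑-split lo (suc d) e f = trans
    (+-congˡ (trans (∑-split (suc lo) d e f)
      (+-congˡ (reflexive (≡.cong (λ k → ∑ k e f) (ℕ.+-suc d lo))))))
    (sym (+-assoc _ _ _))

  ∑-last : ∀ lo r f → ∑ lo (suc r) f ≈ ∑ lo r f + f (r ℕ.+ lo)
  ∑-last lo r f = trans (reflexive (≡.cong (λ k → ∑ lo k f) (ℕ.+-comm 1 r)))
    (trans (∑-split lo r 1 f) (+-congˡ (+-identityʳ _)))

  fromℕ : ℕ → Carrier
  fromℕ zero    = 0#
  fromℕ (suc n) = 1# + fromℕ n

  ∑-const : ∀ lo r x → ∑ lo r (λ _ → x) ≈ fromℕ r * x
  ∑-const lo zero    x = sym (zeroˡ x)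
  ∑-const lo (suc r) x = trans (+-cong (sym (*-identityˡ x)) (∑-const (suc lo) r x))
    (sym (distribʳ _ _ _))

module _ {c ℓ} (S : CommutativeRing c ℓ) where
  open CommutativeRing S hiding (zero)
  open CommutativeSemigroupProperties *-commutativeSemigroup using (x∙yz≈y∙xz)

  *-affine : ∀ s t {g f a b} → g ≈ f + t * a → b ≈ s * a → s * g ≈ s * f + t * b
  *-affine s t g≈ b≈ = trans (*-congˡ g≈) (trans (distribˡ _ _ _)
    (+-congˡ (trans (x∙yz≈y∙xz _ _ _) (*-congˡ (sym b≈)))))

module Telescoping {c ℓ} (S : CommutativeRing c ℓ) (t : CommutativeRing.Carrier S) where
  open CommutativeRing S hiding (zero)
  open SetoidReasoning setoid
  open RangeSum S
  open SemiringSolver commutativeSemiring using (solve; _:=_; _:+_; _:*_; con)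
  open GroupProperties +-group using () renaming (∙-cancelʳ to +-cancelʳ)

  -- Says that J is 1/(1 - a t), in a form without subtraction, so that identities built on it can
  -- be left to the semiring solver.
  _IsInverseOf1-_ : Carrier → Carrier → Set ℓ
  J IsInverseOf1- a = J ≈ 1# + a * (t * J)

  module _ (w : Carrier) (I : ℕ → Carrier) where
    factor : ℕ → Carrier
    factor j = 1# + w * (t * I j)

    E : ℕ → Carrier
    E zero    = 1#
    E (suc d) = factor (suc d) * E d

    -- The hypothesis is a triangular system, solved from the top, and `E` is its integrating
    -- factor: eliminating T (i + 1) multiplies the coefficient of the remaining tail Q by
    -- `factor w I (suc i)`.
    E-∑ : ∀ hi {φ T : ℕ → Carrier} →
      (∀ j e → e ℕ.+ suc j ≡ hi → T (suc j) ≈ I (suc j) * (φ (suc j) + w * (t * ∑ (suc j) e (T ∘ suc)))) →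
      ∀ i e → e ℕ.+ i ≡ hi →
      E i * ∑ i e (T ∘ suc) ≈ ∑ i e (λ j → I (suc j) * (E j * φ (suc j)))
    E-∑ hi h i zero    p = zeroʳ _
    E-∑ hi {φ} {T} h i (suc e) p = begin
      E i * (T (suc i) + Q)
        ≈⟨ *-congˡ (+-congʳ (h i e p′)) ⟩
      E i * (I (suc i) * (φ (suc i) + w * (t * Q)) + Q)
        ≈⟨ solve 6 (λ E I φ w t Q →
             E :* (I :* (φ :+ w :* (t :* Q)) :+ Q) :=
             I :* (E :* φ) :+ (con 1 :+ w :* (t :* I)) :* E :* Q) refl
             (E i) (I (suc i)) (φ (suc i)) w t Q ⟩
      I (suc i) * (E i * φ (suc i)) + E (suc i) * Q
        ≈⟨ +-congˡ (E-∑ hi {φ} {T} h (suc i) e p′) ⟩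
      I (suc i) * (E i * φ (suc i)) + ∑ (suc i) e (λ j → I (suc j) * (E j * φ (suc j)))
        ∎
      where Q = ∑ (suc i) e (T ∘ suc)
            p′ = ≡.trans (ℕ.+-suc e i) p

  -- I T equals T + a t I T by the first hypothesis and I (φ + t U) + a t I T by the second; the
  -- common term cancels.
  resolvent : ∀ {I a T φ U} → I IsInverseOf1- a → T ≈ φ + t * (a * T + U) → T ≈ I * (φ + t * U)
  resolvent {I} {a} {T} {φ} {U} inv eq = +-cancelʳ (a * (t * (I * T))) _ _ (begin
    T + a * (t * (I * T))
      ≈⟨ solve 4 (λ I a t T → T :+ a :* (t :* (I :* T)) := (con 1 :+ a :* (t :* I)) :* T) refl I a t T ⟩
    (1# + a * (t * I)) * T
      ≈⟨ *-congʳ inv ⟨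
    I * T
      ≈⟨ *-congˡ eq ⟩
    I * (φ + t * (a * T + U))
      ≈⟨ solve 6 (λ I a t T φ U → I :* (φ :+ t :* (a :* T :+ U)) :=
           I :* (φ :+ t :* U) :+ a :* (t :* (I :* T))) refl I a t T φ U ⟩
    I * (φ + t * U) + a * (t * (I * T)) ∎)

  -- The factor c_N in the formula for Dₖ.
  residue : Carrier → (ℕ → Carrier) → ℕ → Carrier
  residue x J zero    = x * (t * J 0)
  residue x J (suc N) = (1# + x * (t * J (suc N))) * residue x J N

  module _ (x w : Carrier) (J : ℕ → Carrier) where
    -- If J j is 1/(1 - (j + x) t), this is the series of the words with largest letter N, with an x
    -- for every weak right-to-left minimum and a w for every strict right-to-left maximum; see
    -- `B-eq`.
    X : ℕ → Carrier
    X zero    = x * (w * (t * J 0))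
    X (suc N) = (1# + (w + x) * (t * J (suc N))) * X N

    -- The multiple of ∑ i e (T ∘ suc) is the boundary term under which the
    -- induction from the upper end of the range closes.
    X-∑ : ∀ hi {φ T : ℕ → Carrier} →
      (∀ j e → e ℕ.+ suc j ≡ hi → T (suc j) ≈ J (suc j) * (φ (suc j) + w * (t * ∑ (suc j) e (T ∘ suc)))) →
      ∀ i e → e ℕ.+ i ≡ hi →
      ∑ i e (λ N → X N * φ (suc N)) + x * (t * ∑ i e (λ N → X N * T (suc N)))
        + w * (t * (X i * ∑ i e (T ∘ suc)))
        ≈ ∑ i e (λ N → X (suc N) * φ (suc N))
    X-∑ hi h i zero p = solve 4 (λ x t w X →
      con 0 :+ x :* (t :* con 0) :+ w :* (t :* (X :* con 0)) := con 0) refl x t w (X i)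
    X-∑ hi {φ} {T} h i (suc e) p = begin
      X i * φ′ + A + x * (t * (X i * T (suc i) + B)) + w * (t * (X i * (T (suc i) + Q)))
        ≈⟨ +-cong (+-congˡ (*-congˡ (*-congˡ (+-congʳ (*-congˡ h′))))) (*-congˡ (*-congˡ (*-congˡ (+-congʳ h′)))) ⟩
      X i * φ′ + A + x * (t * (X i * T′ + B)) + w * (t * (X i * (T′ + Q)))
        ≈⟨ solve 9 (λ X φ A B x t w Q J →
             X :* φ :+ A :+ x :* (t :* (X :* (J :* (φ :+ w :* (t :* Q))) :+ B))
               :+ w :* (t :* (X :* (J :* (φ :+ w :* (t :* Q)) :+ Q))) :=
             (con 1 :+ (w :+ x) :* (t :* J)) :* X :* φ
               :+ (A :+ x :* (t :* B) :+ w :* (t :* ((con 1 :+ (w :+ x) :* (t :* J)) :* X :* Q)))) refl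
             (X i) φ′ A B x t w Q (J (suc i)) ⟩
      X (suc i) * φ′ + (A + x * (t * B) + w * (t * (X (suc i) * Q)))
        ≈⟨ +-congˡ (X-∑ hi {φ} {T} h (suc i) e p′) ⟩
      X (suc i) * φ′ + ∑ (suc i) e (λ N → X (suc N) * φ (suc N)) ∎
      where
      φ′ = φ (suc i)
      A = ∑ (suc i) e (λ N → X N * φ (suc N))
      B = ∑ (suc i) e (λ N → X N * T (suc N))
      Q = ∑ (suc i) e (T ∘ suc)
      p′ = ≡.trans (ℕ.+-suc e i) p
      T′ = J (suc i) * (φ′ + w * (t * Q))
      h′ = h i e p′

    -- Eliminates T: expanded at the lowest index, the term with w T 0 yields X 0 φ 0 and exactly
    -- the boundary term that `X-∑` asks for at i = 0.
    X-telescope : ∀ r {φ T : ℕ → Carrier} →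
      (∀ j e → e ℕ.+ j ≡ r → T j ≈ J j * (φ j + w * (t * ∑ j e (T ∘ suc)))) →
      ∑ 0 r (λ N → X N * φ (suc N)) + x * (t * (w * T 0 + ∑ 0 r (λ N → X N * T (suc N))))
        ≈ X 0 * φ 0 + ∑ 0 r (λ N → X (suc N) * φ (suc N))
    X-telescope r {φ} {T} h = begin
      A + x * (t * (w * T 0 + B))
        ≈⟨ +-congˡ (*-congˡ (*-congˡ (+-congʳ (*-congˡ (h 0 r (ℕ.+-identityʳ r)))))) ⟩
      A + x * (t * (w * (J 0 * (φ 0 + w * (t * Q))) + B))
        ≈⟨ solve 8 (λ A B x t w J φ Q →
             A :+ x :* (t :* (w :* (J :* (φ :+ w :* (t :* Q))) :+ B)) :=
             x :* (w :* (t :* J)) :* φ :+ (A :+ x :* (t :* B) :+ w :* (t :* (x :* (w :* (t :* J)) :* Q)))) refl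
             A B x t w (J 0) (φ 0) Q ⟩
      X 0 * φ 0 + (A + x * (t * B) + w * (t * (X 0 * Q)))
        ≈⟨ +-congˡ (X-∑ r {φ} {T} (λ j → h (suc j)) 0 r (ℕ.+-identityʳ r)) ⟩
      X 0 * φ 0 + ∑ 0 r (λ N → X (suc N) * φ (suc N)) ∎
      where
      A = ∑ 0 r (λ N → X N * φ (suc N))
      B = ∑ 0 r (λ N → X N * T (suc N))
      Q = ∑ 0 r (T ∘ suc)

    -- Since J = I (1 + x t J), the factor 1 + (w + x) t J splits into (1 + x t J)(1 + w t I). This
    -- separates w from x.
    X-factors : ∀ {I} → (∀ N → I N IsInverseOf1- fromℕ N) → (∀ N → J N IsInverseOf1- (fromℕ N + x)) →
      ∀ N → X N ≈ w * (residue x J N * E w I N)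
    X-factors {I} invI invJ zero = solve 4 (λ x w t J → x :* (w :* (t :* J)) := w :* (x :* (t :* J) :* con 1)) refl x w t (J 0)
    X-factors {I} invI invJ (suc N) = begin
      (1# + (w + x) * (t * J′)) * X N
        ≈⟨ solve 5 (λ w x t J X → (con 1 :+ (w :+ x) :* (t :* J)) :* X :=
             (con 1 :+ x :* (t :* J) :+ w :* (t :* J)) :* X) refl w x t J′ (X N) ⟩
      (1# + x * (t * J′) + w * (t * J′)) * X N
        ≈⟨ *-cong (+-congˡ (*-congˡ (*-congˡ J≈I))) (X-factors invI invJ N) ⟩
      (1# + x * (t * J′) + w * (t * (I′ * (1# + t * (x * J′))))) * (w * (residue x J N * E w I N))
        ≈⟨ solve 7 (λ x t J w I c E →
             (con 1 :+ x :* (t :* J) :+ w :* (t :* (I :* (con 1 :+ t :* (x :* J))))) :* (w :* (c :* E)) :=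
             w :* ((con 1 :+ x :* (t :* J)) :* c :* ((con 1 :+ w :* (t :* I)) :* E))) refl
             x t J′ w I′ (residue x J N) (E w I N) ⟩
      w * (residue x J (suc N) * E w I (suc N)) ∎
      where
      J′ = J (suc N)
      I′ = I (suc N)
      J≈I : J′ ≈ I′ * (1# + t * (x * J′))
      J≈I = resolvent (invI (suc N)) (trans (invJ (suc N)) (+-congˡ
        (solve 4 (λ a x t J → (a :+ x) :* (t :* J) := t :* (a :* J :+ x :* J)) refl (fromℕ (suc N)) x t J′)))

-- Series of words

module SeriesCoefficients {c ℓ} (R : CommutativeRing c ℓ) where
  private
    module R = CommutativeRing R
    S = PowerSeries.commutativeRing R
    module S = CommutativeRing S
    module ΣR = RangeSum R
    module ΣS = RangeSum S
  open PowerSeries R using (Series; X; constant)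

  X*-zero : ∀ f → (X S.* f) 0 R.≈ R.0#
  X*-zero f = R.trans (R.+-identityʳ _) (R.zeroˡ _)

  X*-suc : ∀ f n → (X S.* f) (suc n) R.≈ f n
  X*-suc f n = R.trans (R.+-cong (R.zeroˡ _)
    (S.trans (S.*-congʳ {f} {λ k → X (suc k)} {constant R.1#} λ { zero → R.refl ; (suc _) → R.refl })
      (S.*-identityˡ f) n)) (R.+-identityˡ _)

  +X*-zero : ∀ f g → (f S.+ X S.* g) 0 R.≈ f 0
  +X*-zero f g = R.trans (R.+-congˡ (X*-zero g)) (R.+-identityʳ _)

  +X*-suc : ∀ f g n → (f S.+ X S.* g) (suc n) R.≈ f (suc n) R.+ g n
  +X*-suc f g n = R.+-congˡ (X*-suc g n)

  ∑-coefficient : ∀ lo r (f : ℕ → Series) n → ΣS.∑ lo r f n ≡ ΣR.∑ lo r (λ a → f a n)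
  ∑-coefficient lo zero    f n = ≡.refl
  ∑-coefficient lo (suc r) f n = ≡.cong (f lo n R.+_) (∑-coefficient (suc lo) r f n)

  constant-*-coefficient : ∀ x f n → (constant x S.* f) n R.≈ x R.* f n
  constant-*-coefficient x f zero    = R.+-identityʳ _
  constant-*-coefficient x f (suc n) =
    R.trans (R.+-congˡ (S.zeroˡ f n)) (R.+-identityʳ _)

module WordSeries {c ℓ} (R : CommutativeRing c ℓ) where
  private
    module R = CommutativeRing R
    S = PowerSeries.commutativeRing R
    module S = CommutativeRing S
    module ΣR = RangeSum R
  open PowerSeries R using (Series; X; _≋_)
  open RangeSum S
  open SeriesCoefficients R
  open SetoidReasoning R.setoid
  open CommutativeSemigroupProperties R.+-commutativeSemigroup using (interchange; x∙yz≈y∙xz)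

  -- ∑ Φ b tᵏ over the words b with letters in [lo, lo + r), where k is the
  -- length of b.
  wordSeries : ℕ → ℕ → (List ℕ → Series) → Series
  wordSeries lo r Φ zero    = Φ [] 0
  wordSeries lo r Φ (suc n) = Φ [] (suc n) R.+ ΣR.∑ lo r λ a → wordSeries lo r (λ b → Φ (a ∷ b)) n

  wordSeries-cong-All : ∀ lo r {Φ Ψ} → (∀ b → All (lo ≤_) b → Φ b ≋ Ψ b) → wordSeries lo r Φ ≋ wordSeries lo r Ψ
  wordSeries-cong-All lo r h zero    = h [] [] 0
  wordSeries-cong-All lo r h (suc n) = R.+-cong (h [] [] (suc n))
    (ΣR.∑-cong-< lo r λ a l _ → wordSeries-cong-All lo r (λ b p → h (a ∷ b) (l ∷ p)) n)

  wordSeries-cong : ∀ lo r {Φ Ψ} → (∀ b → Φ b ≋ Ψ b) → wordSeries lo r Φ ≋ wordSeries lo r Ψ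
  wordSeries-cong lo r h = wordSeries-cong-All lo r λ b _ → h b

  wordSeries-∷ : ∀ lo r Φ → wordSeries lo r Φ ≋ Φ [] S.+ X S.* ∑ lo r (λ a → wordSeries lo r (λ b → Φ (a ∷ b)))
  wordSeries-∷ lo r Φ zero    = R.sym (+X*-zero (Φ []) (∑ lo r λ a → wordSeries lo r λ b → Φ (a ∷ b)))
  wordSeries-∷ lo r Φ (suc n) = R.trans (R.+-congˡ (R.reflexive (≡.sym (∑-coefficient lo r _ n))))
    (R.sym (+X*-suc (Φ []) (∑ lo r λ a → wordSeries lo r λ b → Φ (a ∷ b)) n))

  wordSeries-+ : ∀ lo r Φ Ψ → wordSeries lo r (λ b → Φ b S.+ Ψ b) ≋ wordSeries lo r Φ S.+ wordSeries lo r Ψ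
  wordSeries-+ lo r Φ Ψ zero    = R.refl
  wordSeries-+ lo r Φ Ψ (suc n) = R.trans
    (R.+-congˡ (R.trans (ΣR.∑-cong lo r λ a → wordSeries-+ lo r (Φ ∘ (a ∷_)) (Ψ ∘ (a ∷_)) n) (ΣR.∑-+ lo r _ _)))
    (interchange _ _ _ _)

  wordSeries-0 : ∀ lo r → wordSeries lo r (λ _ → S.0#) ≋ S.0#
  wordSeries-0 lo r zero    = R.refl
  wordSeries-0 lo r (suc n) = R.trans (R.+-identityˡ _)
    (R.trans (ΣR.∑-cong lo r λ _ → wordSeries-0 lo r n) (ΣR.∑-0 lo r))

  -- A coefficient of the product on the right mixes all lower coefficients of the word series. It
  -- is therefore first brought into the form of `expand`, where the shift by `X` exposes the
  -- induction.
  wordSeries-*ˡ : ∀ lo r s Φ → wordSeries lo r (λ b → s S.* Φ b) ≋ s S.* wordSeries lo r Φ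
  wordSeries-*ˡ lo r s Φ n = R.trans (step n Φ) (R.sym (expand Φ n))
    where
    G : (List ℕ → Series) → ℕ → Series
    G Φ a = wordSeries lo r λ b → Φ (a ∷ b)
    expand : ∀ Φ → s S.* wordSeries lo r Φ ≋ s S.* Φ [] S.+ X S.* ∑ lo r (λ a → s S.* G Φ a)
    expand Φ = *-affine S s X {wordSeries lo r Φ} {Φ []} {∑ lo r (G Φ)} {∑ lo r (λ a → s S.* G Φ a)}
      (wordSeries-∷ lo r Φ) (∑-*ˡ lo r s (G Φ))
    step : ∀ n Φ → wordSeries lo r (λ b → s S.* Φ b) n R.≈
                   (s S.* Φ [] S.+ X S.* ∑ lo r (λ a → s S.* G Φ a)) n
    step zero    Φ = R.sym (+X*-zero (s S.* Φ []) (∑ lo r λ a → s S.* G Φ a))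
    step (suc n) Φ = begin
      (s S.* Φ []) (suc n) R.+ ΣR.∑ lo r (λ a → wordSeries lo r (λ b → s S.* Φ (a ∷ b)) n)
        ≈⟨ R.+-congˡ (ΣR.∑-cong lo r λ a → wordSeries-*ˡ′ a n) ⟩
      (s S.* Φ []) (suc n) R.+ ΣR.∑ lo r (λ a → (s S.* G Φ a) n)
        ≡⟨ ≡.cong ((s S.* Φ []) (suc n) R.+_) (∑-coefficient lo r (λ a → s S.* G Φ a) n) ⟨
      (s S.* Φ []) (suc n) R.+ ∑ lo r (λ a → s S.* G Φ a) n
        ≈⟨ +X*-suc (s S.* Φ []) (∑ lo r λ a → s S.* G Φ a) n ⟨
      (s S.* Φ [] S.+ X S.* ∑ lo r (λ a → s S.* G Φ a)) (suc n) ∎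
      where
      wordSeries-*ˡ′ : ∀ a n → wordSeries lo r (λ b → s S.* Φ (a ∷ b)) n R.≈ (s S.* G Φ a) n
      wordSeries-*ˡ′ a n = R.trans (step n (Φ ∘ (a ∷_))) (R.sym (expand (Φ ∘ (a ∷_)) n))

  wordSeries-∑ : ∀ lo r lo′ r′ (Φ : ℕ → List ℕ → Series) →
    wordSeries lo r (λ b → ∑ lo′ r′ (λ a → Φ a b)) ≋ ∑ lo′ r′ (λ a → wordSeries lo r (Φ a))
  wordSeries-∑ lo r lo′ zero     Φ = wordSeries-0 lo r
  wordSeries-∑ lo r lo′ (suc r′) Φ n = R.trans (wordSeries-+ lo r (Φ lo′) _ n) (R.+-congˡ (wordSeries-∑ lo r (suc lo′) r′ Φ n))

  wordSeries-∷ʳ : ∀ lo r Φ → wordSeries lo r Φ ≋ Φ [] S.+ X S.* ∑ lo r (λ a → wordSeries lo r (λ b → Φ (b ∷ʳ a)))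
  wordSeries-∷ʳ lo r Φ zero    = R.sym (+X*-zero (Φ []) (∑ lo r λ a → wordSeries lo r λ b → Φ (b ∷ʳ a)))
  wordSeries-∷ʳ lo r Φ (suc n) = R.trans (R.+-congˡ (begin
    ΣR.∑ lo r (λ a → wordSeries lo r (λ b → Φ (a ∷ b)) n)
      ≈⟨ ΣR.∑-cong lo r (λ a → wordSeries-∷ʳ lo r (Φ ∘ (a ∷_)) n) ⟩
    ΣR.∑ lo r (λ a → (Φ (a ∷ []) S.+ X S.* ∑ lo r (λ a′ → Z a a′)) n)
      ≈⟨ swap n ⟩
    ΣR.∑ lo r (λ a′ → (Φ (a′ ∷ []) S.+ X S.* ∑ lo r (λ a → Z a a′)) n)
      ≈⟨ ΣR.∑-cong lo r (λ a → wordSeries-∷ lo r (λ b → Φ (b ∷ʳ a)) n) ⟨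
    ΣR.∑ lo r (λ a → wordSeries lo r (λ b → Φ (b ∷ʳ a)) n)
      ≡⟨ ∑-coefficient lo r _ n ⟨
    ∑ lo r (λ a → wordSeries lo r (λ b → Φ (b ∷ʳ a))) n ∎))
    (R.sym (+X*-suc (Φ []) (∑ lo r λ a → wordSeries lo r λ b → Φ (b ∷ʳ a)) n))
    where
    Z : ℕ → ℕ → Series
    Z a a′ = wordSeries lo r λ b → Φ (a ∷ b ∷ʳ a′)
    swap : ∀ n → ΣR.∑ lo r (λ a → (Φ (a ∷ []) S.+ X S.* ∑ lo r (λ a′ → Z a a′)) n) R.≈
                 ΣR.∑ lo r (λ a′ → (Φ (a′ ∷ []) S.+ X S.* ∑ lo r (λ a → Z a a′)) n)
    swap n = begin
      ΣR.∑ lo r (λ a → (Φ (a ∷ []) S.+ X S.* ∑ lo r (λ a′ → Z a a′)) n)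
        ≈⟨ ΣR.∑-+ lo r _ _ ⟩
      ΣR.∑ lo r (λ a → Φ (a ∷ []) n) R.+ ΣR.∑ lo r (λ a → (X S.* ∑ lo r (λ a′ → Z a a′)) n)
        ≡⟨ ≡.cong (ΣR.∑ lo r (λ a → Φ (a ∷ []) n) R.+_) (∑-coefficient lo r _ n) ⟨
      ΣR.∑ lo r (λ a → Φ (a ∷ []) n) R.+ ∑ lo r (λ a → X S.* ∑ lo r (λ a′ → Z a a′)) n
        ≈⟨ R.+-congˡ (∑-*ˡ lo r X (λ a → ∑ lo r (λ a′ → Z a a′)) n) ⟩
      ΣR.∑ lo r (λ a → Φ (a ∷ []) n) R.+ (X S.* ∑ lo r (λ a → ∑ lo r (λ a′ → Z a a′))) n
        ≈⟨ R.+-congˡ (S.*-congˡ {X} {∑ lo r λ a → ∑ lo r λ a′ → Z a a′} (∑-comm lo r lo r Z) n) ⟩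
      ΣR.∑ lo r (λ a → Φ (a ∷ []) n) R.+ (X S.* ∑ lo r (λ a′ → ∑ lo r (λ a → Z a a′))) n
        ≈⟨ R.+-congˡ (∑-*ˡ lo r X (λ a′ → ∑ lo r (λ a → Z a a′)) n) ⟨
      ΣR.∑ lo r (λ a → Φ (a ∷ []) n) R.+ ∑ lo r (λ a′ → X S.* ∑ lo r (λ a → Z a a′)) n
        ≡⟨ ≡.cong (ΣR.∑ lo r (λ a → Φ (a ∷ []) n) R.+_) (∑-coefficient lo r _ n) ⟩
      ΣR.∑ lo r (λ a → Φ (a ∷ []) n) R.+ ΣR.∑ lo r (λ a′ → (X S.* ∑ lo r (λ a → Z a a′)) n)
        ≈⟨ ΣR.∑-+ lo r _ _ ⟨
      ΣR.∑ lo r (λ a′ → (Φ (a′ ∷ []) S.+ X S.* ∑ lo r (λ a → Z a a′)) n) ∎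

  ∑-X*-coefficient : ∀ lo r (f : ℕ → Series) n → ΣR.∑ lo r (λ a → (X S.* f a) n) R.≈ (X S.* ∑ lo r f) n
  ∑-X*-coefficient lo r f n = R.trans (R.reflexive (≡.sym (∑-coefficient lo r (λ a → X S.* f a) n))) (∑-*ˡ lo r X f n)

  -- Unique factorisation at the first `lo`: α has only letters above `lo`, while β is arbitrary.
  wordSeries-first : ∀ lo r Φ → wordSeries lo (suc r) Φ ≋
    wordSeries (suc lo) r Φ S.+ X S.* wordSeries lo (suc r) (λ β → wordSeries (suc lo) r (λ α → Φ (α ++ lo ∷ β)))
  wordSeries-first lo r Φ zero    = R.sym (+X*-zero (wordSeries (suc lo) r Φ) (wordSeries lo (suc r) (λ β → wordSeries (suc lo) r (λ α → Φ (α ++ lo ∷ β)))))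
  wordSeries-first lo r Φ (suc n) = begin
    Φ [] (suc n) R.+ (wordSeries lo (suc r) (λ β → Φ (lo ∷ β)) n R.+ ΣR.∑ (suc lo) r (λ a → wordSeries lo (suc r) (λ b → Φ (a ∷ b)) n))
      ≈⟨ R.+-congˡ (R.+-congˡ (R.trans (ΣR.∑-cong (suc lo) r λ a → wordSeries-first lo r (Φ ∘ (a ∷_)) n)
           (R.trans (ΣR.∑-+ (suc lo) r _ _) (R.+-congˡ (∑-X*-coefficient (suc lo) r Y n))))) ⟩
    Φ [] (suc n) R.+ (wordSeries lo (suc r) (λ β → Φ (lo ∷ β)) n R.+ (s R.+ (X S.* ∑ (suc lo) r Y) n))
      ≈⟨ R.trans (R.+-congˡ (x∙yz≈y∙xz _ _ _)) (R.sym (R.+-assoc _ _ _)) ⟩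
    Φ [] (suc n) R.+ s R.+ (wordSeries lo (suc r) (λ β → Φ (lo ∷ β)) S.+ X S.* ∑ (suc lo) r Y) n
      ≈⟨ R.+-congˡ (Y-∷ n) ⟨
    wordSeries (suc lo) r Φ (suc n) R.+ wordSeries lo (suc r) (λ β → wordSeries (suc lo) r (λ α → Φ (α ++ lo ∷ β))) n
      ≈⟨ +X*-suc (wordSeries (suc lo) r Φ) (wordSeries lo (suc r) (λ β → wordSeries (suc lo) r (λ α → Φ (α ++ lo ∷ β)))) n ⟨
    (wordSeries (suc lo) r Φ S.+ X S.* wordSeries lo (suc r) (λ β → wordSeries (suc lo) r (λ α → Φ (α ++ lo ∷ β)))) (suc n) ∎
    where
    s = ΣR.∑ (suc lo) r (λ a → wordSeries (suc lo) r (λ b → Φ (a ∷ b)) n)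
    Y′ : List ℕ → ℕ → Series
    Y′ β a = wordSeries (suc lo) r (λ α → Φ (a ∷ α ++ lo ∷ β))
    Y : ℕ → Series
    Y a = wordSeries lo (suc r) (λ β → Y′ β a)
    Y-∷ : wordSeries lo (suc r) (λ β → wordSeries (suc lo) r (λ α → Φ (α ++ lo ∷ β))) ≋
          wordSeries lo (suc r) (λ β → Φ (lo ∷ β)) S.+ X S.* ∑ (suc lo) r Y
    Y-∷ n = R.trans (wordSeries-cong lo (suc r) (λ β → wordSeries-∷ (suc lo) r (λ α → Φ (α ++ lo ∷ β))) n)
      (R.trans (wordSeries-+ lo (suc r) (λ β → Φ (lo ∷ β)) (λ β → X S.* ∑ (suc lo) r (Y′ β)) n)
        (R.+-congˡ (R.trans (wordSeries-*ˡ lo (suc r) X (λ β → ∑ (suc lo) r (Y′ β)) n)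
          (S.*-congˡ {X} {wordSeries lo (suc r) (λ β → ∑ (suc lo) r (Y′ β))} {∑ (suc lo) r Y}
            (wordSeries-∑ lo (suc r) (suc lo) r (λ a β → Y′ β a)) n))))

  -- Unique factorisation at the last `lo`; the mirror image of `wordSeries-first`, so letters are
  -- peeled off from the right.
  wordSeries-last : ∀ lo r Φ → wordSeries lo (suc r) Φ ≋
    wordSeries (suc lo) r Φ S.+ X S.* wordSeries (suc lo) r (λ β → wordSeries lo (suc r) (λ γ → Φ (γ ++ lo ∷ β)))
  wordSeries-last lo r Φ zero    = R.sym (+X*-zero (wordSeries (suc lo) r Φ) (wordSeries (suc lo) r (λ β → wordSeries lo (suc r) (λ γ → Φ (γ ++ lo ∷ β)))))
  wordSeries-last lo r Φ (suc n) = begin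
    wordSeries lo (suc r) Φ (suc n)
      ≈⟨ snoc-suc lo (suc r) Φ n ⟩
    Φ [] (suc n) R.+ (wordSeries lo (suc r) (λ γ → Φ (γ ∷ʳ lo)) n R.+ ΣR.∑ (suc lo) r (λ a → wordSeries lo (suc r) (λ b → Φ (b ∷ʳ a)) n))
      ≈⟨ R.+-congˡ (R.+-congˡ (R.trans (ΣR.∑-cong (suc lo) r λ a → wordSeries-last lo r (Φ ∘ (_∷ʳ a)) n)
           (R.trans (ΣR.∑-+ (suc lo) r _ _) (R.+-congˡ (∑-X*-coefficient (suc lo) r Y n))))) ⟩
    Φ [] (suc n) R.+ (wordSeries lo (suc r) (λ γ → Φ (γ ∷ʳ lo)) n R.+ (s R.+ (X S.* ∑ (suc lo) r Y) n))
      ≈⟨ R.trans (R.+-congˡ (x∙yz≈y∙xz _ _ _)) (R.sym (R.+-assoc _ _ _)) ⟩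
    Φ [] (suc n) R.+ s R.+ (wordSeries lo (suc r) (λ γ → Φ (γ ∷ʳ lo)) S.+ X S.* ∑ (suc lo) r Y) n
      ≈⟨ R.+-cong (snoc-suc (suc lo) r Φ n) (Y-∷ʳ n) ⟨
    wordSeries (suc lo) r Φ (suc n) R.+ wordSeries (suc lo) r (λ β → wordSeries lo (suc r) (λ γ → Φ (γ ++ lo ∷ β))) n
      ≈⟨ +X*-suc (wordSeries (suc lo) r Φ) (wordSeries (suc lo) r (λ β → wordSeries lo (suc r) (λ γ → Φ (γ ++ lo ∷ β)))) n ⟨
    (wordSeries (suc lo) r Φ S.+ X S.* wordSeries (suc lo) r (λ β → wordSeries lo (suc r) (λ γ → Φ (γ ++ lo ∷ β)))) (suc n) ∎
    where
    snoc-suc : ∀ lo r Φ n → wordSeries lo r Φ (suc n) R.≈ Φ [] (suc n) R.+ ΣR.∑ lo r (λ a → wordSeries lo r (λ b → Φ (b ∷ʳ a)) n)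
    snoc-suc lo r Φ n = R.trans (wordSeries-∷ʳ lo r Φ (suc n))
      (R.trans (+X*-suc (Φ []) (∑ lo r λ a → wordSeries lo r λ b → Φ (b ∷ʳ a)) n)
        (R.+-congˡ (R.reflexive (∑-coefficient lo r _ n))))
    s = ΣR.∑ (suc lo) r (λ a → wordSeries (suc lo) r (λ b → Φ (b ∷ʳ a)) n)
    Y : ℕ → Series
    Y a = wordSeries (suc lo) r (λ β → wordSeries lo (suc r) (λ γ → Φ ((γ ++ lo ∷ β) ∷ʳ a)))
    Y-∷ʳ : wordSeries (suc lo) r (λ β → wordSeries lo (suc r) (λ γ → Φ (γ ++ lo ∷ β))) ≋
          wordSeries lo (suc r) (λ γ → Φ (γ ∷ʳ lo)) S.+ X S.* ∑ (suc lo) r Y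
    Y-∷ʳ n = R.trans (wordSeries-∷ʳ (suc lo) r (λ β → wordSeries lo (suc r) (λ γ → Φ (γ ++ lo ∷ β))) n)
      (R.+-congˡ (S.*-congˡ {X} {_} {∑ (suc lo) r Y} (∑-cong (suc lo) r λ a → wordSeries-cong (suc lo) r λ β → wordSeries-cong lo (suc r) λ γ n →
        R.reflexive (≡.cong (λ b → Φ b n) (≡.sym (List.++-assoc γ (lo ∷ β) (a ∷ []))))) n))

-- Statistics on words

[_<_] : ℕ → ℕ → ℕ
[ a < c ] = if a <ᵇ c then 1 else 0

<⇒[<] : ∀ {a c} → a ℕ.< c → [ a < c ] ≡ 1
<⇒[<] {a} {c} p with a <ᵇ c | ℕ.<⇒<ᵇ p
... | true | _ = ≡.refl

≥⇒[<] : ∀ {a c} → c ≤ a → [ a < c ] ≡ 0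
≥⇒[<] {a} {c} p with a <ᵇ c | ℕ.<ᵇ⇒< a c
... | true  | q = contradiction (q tt) (ℕ.≤⇒≯ p)
... | false | _ = ≡.refl

-- lrmin c b: the strict left-to-right minima of b that are below c.
lrmin : ℕ → List ℕ → ℕ
lrmin c []      = 0
lrmin c (a ∷ b) = [ a < c ] ℕ.+ lrmin (c ℕ.⊓ a) b

-- Letters enter shifted by one, so that the condition on a letter a in front of b, to be below c
-- and at most every letter of b, is the single strict inequality a < `bottom c b`.
bottom : ℕ → List ℕ → ℕ
bottom c []      = c
bottom c (a ∷ b) = bottom c b ℕ.⊓ suc a

-- rlmin c b: the weak right-to-left minima of b that are below c.
rlmin : ℕ → List ℕ → ℕ
rlmin c []      = 0
rlmin c (a ∷ b) = [ a < bottom c b ] ℕ.+ rlmin c b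

-- One more than the largest letter, so that 0 is left for the empty word without a threshold.
top : ℕ → List ℕ → ℕ
top M []      = M
top M (a ∷ b) = top M b ℕ.⊔ suc a

-- rlmax M b: the strict right-to-left maxima of b that are at least M.
rlmax : ℕ → List ℕ → ℕ
rlmax M []      = 0
rlmax M (a ∷ b) = [ top M b < suc a ] ℕ.+ rlmax M b

top-++ : ∀ M α β → top M (α ++ β) ≡ top (top M β) α
top-++ M []      β = ≡.refl
top-++ M (a ∷ α) β = ≡.cong (ℕ._⊔ suc a) (top-++ M α β)

rlmax-++ : ∀ M α β → rlmax M (α ++ β) ≡ rlmax (top M β) α ℕ.+ rlmax M β
rlmax-++ M []      β = ≡.refl
rlmax-++ M (a ∷ α) β = ≡.trans
  (≡.cong₂ (λ m n → [ m < suc a ] ℕ.+ n) (top-++ M α β) (rlmax-++ M α β))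
  (≡.sym (ℕ.+-assoc [ top (top M β) α < suc a ] _ _))

bottom-++ : ∀ c α β → bottom c (α ++ β) ≡ bottom (bottom c β) α
bottom-++ c []      β = ≡.refl
bottom-++ c (a ∷ α) β = ≡.cong (ℕ._⊓ suc a) (bottom-++ c α β)

rlmin-++ : ∀ c α β → rlmin c (α ++ β) ≡ rlmin (bottom c β) α ℕ.+ rlmin c β
rlmin-++ c []      β = ≡.refl
rlmin-++ c (a ∷ α) β = ≡.trans
  (≡.cong₂ (λ m n → [ a < m ] ℕ.+ n) (bottom-++ c α β) (rlmin-++ c α β))
  (≡.sym (ℕ.+-assoc [ a < bottom (bottom c β) α ] _ _))

top-⊔ : ∀ M m b → top (M ℕ.⊔ m) b ≡ top M b ℕ.⊔ m
top-⊔ M m []      = ≡.refl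
top-⊔ M m (a ∷ b) = ≡.trans (≡.cong (ℕ._⊔ suc a) (top-⊔ M m b))
  (≡.trans (ℕ.⊔-assoc (top M b) m (suc a)) (≡.trans (≡.cong (top M b ℕ.⊔_) (ℕ.⊔-comm m (suc a)))
    (≡.sym (ℕ.⊔-assoc (top M b) (suc a) m))))

[⊔<] : ∀ {M m c} → m ℕ.< c → [ M ℕ.⊔ m < c ] ≡ [ M < c ]
[⊔<] {M} {m} {c} p with ℕ.<-≤-connex M c
... | inj₁ q = ≡.trans (<⇒[<] (ℕ.⊔-lub q p)) (≡.sym (<⇒[<] q))
... | inj₂ q = ≡.trans (≥⇒[<] (ℕ.≤-trans q (ℕ.m≤m⊔n M m))) (≡.sym (≥⇒[<] q))

rlmax-⊔ : ∀ M m {b} → All (m ≤_) b → rlmax (M ℕ.⊔ m) b ≡ rlmax M b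
rlmax-⊔ M m []                = ≡.refl
rlmax-⊔ M m {a ∷ b} (p ∷ ps) = ≡.cong₂ ℕ._+_
  (≡.trans (≡.cong [_< suc a ] (top-⊔ M m b)) ([⊔<] {top M b} (s≤s p))) (rlmax-⊔ M m ps)

rlmax-suc : ∀ {lo b} → All (suc lo ≤_) b → rlmax lo b ≡ rlmax (suc lo) b
rlmax-suc {lo} {b} p = ≡.trans (≡.sym (rlmax-⊔ lo (suc lo) p))
  (≡.cong (λ M → rlmax M b) (ℕ.m≤n⇒m⊔n≡n (ℕ.n≤1+n lo)))

top-suc : ∀ lo b → top lo b ℕ.⊔ suc lo ≡ top (suc lo) b
top-suc lo b = ≡.trans (≡.sym (top-⊔ lo (suc lo) b)) (≡.cong (λ M → top M b) (ℕ.m≤n⇒m⊔n≡n (ℕ.n≤1+n lo)))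

<top : ∀ {lo M a b} → All (lo ≤_) (a ∷ b) → lo ℕ.< top M (a ∷ b)
<top (p ∷ _) = ℕ.≤-trans (s≤s p) (ℕ.m≤n⊔m _ _)

<bottom : ∀ {m c b} → m ℕ.< c → All (m ≤_) b → m ℕ.< bottom c b
<bottom p []       = p
<bottom p (q ∷ qs) = ℕ.⊓-glb (<bottom p qs) (s≤s q)

lrmin-none : ∀ {m c b} → c ≤ m → All (m ≤_) b → lrmin c b ≡ 0
lrmin-none p [] = ≡.refl
lrmin-none {c = c} {b = a ∷ b} p (q ∷ qs) =
  ≡.cong₂ ℕ._+_ (≥⇒[<] (ℕ.≤-trans p q)) (lrmin-none (ℕ.≤-trans (ℕ.m⊓n≤m c a) p) qs)

rlmin-none : ∀ {m c b} → c ≤ m → All (m ≤_) b → rlmin c b ≡ 0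
rlmin-none p [] = ≡.refl
rlmin-none {c = c} {b = a ∷ b} p (q ∷ qs) = ≡.cong₂ ℕ._+_
  (≥⇒[<] (ℕ.≤-trans (bottom≤ b) (ℕ.≤-trans p q))) (rlmin-none p qs)
  where
  bottom≤ : ∀ b → bottom c b ≤ c
  bottom≤ []      = ℕ.≤-refl
  bottom≤ (a ∷ b) = ℕ.≤-trans (ℕ.m⊓n≤m _ _) (bottom≤ b)

-- `m` is a new strict minimum, and nothing in β goes below it.
lrmin-first : ∀ {m c} α {β} → m ℕ.< c → All (m ℕ.<_) α → All (m ≤_) β →
  lrmin c (α ++ m ∷ β) ≡ suc (lrmin c α)
lrmin-first {m} {c} [] p _ qs = ≡.cong₂ ℕ._+_ (<⇒[<] p) (lrmin-none (ℕ.m⊓n≤n c m) qs)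
lrmin-first {c = c} (a ∷ α) p (q ∷ qs) rs = ≡.trans
  (≡.cong ([ a < c ] ℕ.+_) (lrmin-first α (ℕ.⊓-glb p q) qs rs)) (ℕ.+-suc _ _)

-- The letters of α exceed the `m` to their right and are no minima.
rlmin-first : ∀ {m c α β} → m ℕ.< c → All (m ℕ.<_) α → All (m ≤_) β →
  rlmin c (α ++ m ∷ β) ≡ suc (rlmin c β)
rlmin-first {m} {c} {α} {β} p qs rs = ≡.trans (rlmin-++ c α (m ∷ β))
  (≡.cong₂ ℕ._+_ (rlmin-none (ℕ.m⊓n≤n (bottom c β) (suc m)) qs) (≡.cong (ℕ._+ rlmin c β) (<⇒[<] (<bottom p rs))))

-- A weak minimum to the left of `m` may tie with it, hence the bound `suc m` for γ.
rlmin-last : ∀ {m c} γ {β} → m ℕ.< c → All (m ≤_) β →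
  rlmin c (γ ++ m ∷ β) ≡ rlmin (suc m) γ ℕ.+ suc (rlmin c β)
rlmin-last {m} {c} γ {β} p rs = ≡.trans (rlmin-++ c γ (m ∷ β))
  (≡.cong₂ (λ k n → rlmin k γ ℕ.+ (n ℕ.+ rlmin c β)) (ℕ.m≥n⇒m⊓n≡n (<bottom p rs)) (<⇒[<] (<bottom p rs)))

-- The generating functions are studied in an abstract ring because
-- unification cannot recover series from equations between them, which are
-- functions.
record WordCalculus {c ℓ} (S : CommutativeRing c ℓ) : Set (c ⊔ˡ ℓ) where
  open CommutativeRing S hiding (zero)
  open RangeSum S
  field
    t : Carrier
    wordSeries : ℕ → ℕ → (List ℕ → Carrier) → Carrier
    wordSeries-cong : ∀ lo r {Φ Ψ} → (∀ b → All (lo ≤_) b → Φ b ≈ Ψ b) → wordSeries lo r Φ ≈ wordSeries lo r Ψ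
    wordSeries-*ˡ : ∀ lo r s Φ → wordSeries lo r (λ b → s * Φ b) ≈ s * wordSeries lo r Φ
    wordSeries-∷ʳ : ∀ lo r Φ → wordSeries lo r Φ ≈ Φ [] + t * ∑ lo r (λ a → wordSeries lo r (λ b → Φ (b ∷ʳ a)))
    wordSeries-first : ∀ lo r Φ → wordSeries lo (suc r) Φ ≈
      wordSeries (suc lo) r Φ + t * wordSeries lo (suc r) (λ β → wordSeries (suc lo) r (λ α → Φ (α ++ lo ∷ β)))
    wordSeries-last : ∀ lo r Φ → wordSeries lo (suc r) Φ ≈
      wordSeries (suc lo) r Φ + t * wordSeries (suc lo) r (λ β → wordSeries lo (suc r) (λ γ → Φ (γ ++ lo ∷ β)))

wordCalculus : ∀ {c ℓ} (R : CommutativeRing c ℓ) → WordCalculus (PowerSeries.commutativeRing R)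
wordCalculus R = record
  { t        = PowerSeries.X R
  ; wordSeries       = wordSeries
  ; wordSeries-cong  = wordSeries-cong-All
  ; wordSeries-*ˡ    = wordSeries-*ˡ
  ; wordSeries-∷ʳ    = wordSeries-∷ʳ
  ; wordSeries-first = wordSeries-first
  ; wordSeries-last  = wordSeries-last
  }
  where open WordSeries R

-- The symmetry and the product formula

module WordAlgebra {c ℓ} (S : CommutativeRing c ℓ) (W : WordCalculus S) where
  open CommutativeRing S hiding (zero)
  open WordCalculus W
  open SetoidReasoning setoid
  open RangeSum S
  open Exponentiation semiring
  open Telescoping S t
  open SemiringSolver commutativeSemiring using (solve; _:=_; _:+_; _:*_; con)
  open GroupProperties +-group using () renaming (∙-cancelˡ to +-cancelˡ)

  ^-≡ : ∀ x {m n} → m ≡ n → x ^ m ≈ x ^ n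
  ^-≡ x p = reflexive (≡.cong (x ^_) p)

  -- `rlmax` and `top` are read from the right, so removing the last letter merely raises the
  -- threshold M. Used with trivial κ for the recursion of F, and with a κ that marks the letter
  -- `lo` for the recursion of B.
  module LastLetter (w : Carrier) (lo r : ℕ) (φ : ℕ → Carrier) (ψ : List ℕ → Carrier) (κ : ℕ → Carrier)
    (ψ-[] : ψ [] ≈ 1#) (ψ-∷ʳ : ∀ b a → lo ≤ a → ψ (b ∷ʳ a) ≈ κ a * ψ b)
    where

    T : ℕ → Carrier
    T M = wordSeries lo r λ γ → ψ γ * (w ^ rlmax M γ * φ (top M γ))

    T-step : ∀ M → T M ≈ φ M + t * ∑ lo r (λ a → (κ a * w ^ [ M < suc a ]) * T (M ℕ.⊔ suc a))
    T-step M = trans (wordSeries-∷ʳ lo r λ γ → ψ γ * (w ^ rlmax M γ * φ (top M γ))) (+-cong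
      (trans (*-cong ψ-[] (*-identityˡ _)) (*-identityˡ _))
      (*-congˡ (∑-cong-< lo r λ a l _ → trans
        (wordSeries-cong lo r λ b _ → begin
          ψ (b ∷ʳ a) * (w ^ rlmax M (b ∷ʳ a) * φ (top M (b ∷ʳ a)))
            ≈⟨ *-cong (ψ-∷ʳ b a l) (*-cong
                 (trans (^-≡ w (≡.trans (rlmax-++ M b (a ∷ []))
                     (≡.cong (rlmax (M ℕ.⊔ suc a) b ℕ.+_) (ℕ.+-identityʳ _))))
                   (^-homo-* w (rlmax (M ℕ.⊔ suc a) b) [ M < suc a ]))
                 (reflexive (≡.cong φ (top-++ M b (a ∷ []))))) ⟩
          κ a * ψ b * (w ^ rlmax (M ℕ.⊔ suc a) b * w ^ [ M < suc a ] * φ (top (M ℕ.⊔ suc a) b))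
            ≈⟨ solve 5 (λ k p u v f → k :* p :* (u :* v :* f) := k :* v :* (p :* (u :* f))) refl _ _ _ _ _ ⟩
          κ a * w ^ [ M < suc a ] * (ψ b * (w ^ rlmax (M ℕ.⊔ suc a) b * φ (top (M ℕ.⊔ suc a) b))) ∎)
        (wordSeries-*ˡ lo r _ _))))

    -- A last letter below M leaves the threshold alone and contributes a multiple of T M itself,
    -- which I resolves. A last letter from M on is a new maximum: it earns a w and raises the
    -- threshold above itself.
    T-solve : ∀ i e {I} → i ℕ.+ e ≡ r → (∀ a → i ℕ.+ lo ≤ a → κ a ≈ 1#) →
      I IsInverseOf1- ∑ lo i κ →
      T (i ℕ.+ lo) ≈ I * (φ (i ℕ.+ lo) + w * (t * ∑ i e (λ j → T (suc j ℕ.+ lo))))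
    T-solve i e {I} ≡.refl κ≈1 inv = trans
      (resolvent inv (trans (T-step M) (+-congˡ (*-congˡ
        (trans (∑-split lo i e _) (+-cong
          (trans (∑-cong-< lo i λ a _ u → *-cong
              (trans (*-congˡ (^-≡ w (≥⇒[<] u))) (*-identityʳ _))
              (reflexive (≡.cong T (ℕ.m≥n⇒m⊔n≡m u))))
            (∑-*ʳ lo i (T M) κ))
          (trans (∑-cong-< M e λ a l _ → *-cong
              (trans (*-cong (κ≈1 a l) (trans (^-≡ w (<⇒[<] (s≤s l))) (*-identityʳ w))) (*-identityˡ w))
              (reflexive (≡.cong T (ℕ.m≤n⇒m⊔n≡n (ℕ.m≤n⇒m≤1+n l)))))
            (trans (∑-*ˡ M e w (T ∘ suc))
              (*-congˡ (reflexive (∑-shift lo i e (T ∘ suc))))))))))))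
      (*-congˡ (+-congˡ (solve 3 (λ t w s → t :* (w :* s) := w :* (t :* s)) refl t w _)))
      where M = i ℕ.+ lo

  -- F_N is the case lo = 1, M = N + 1; the induction removes the smallest letter and therefore
  -- needs every `lo`.
  F : (y w : Carrier) (c lo r M : ℕ) → Carrier
  F y w c lo r M = wordSeries lo r λ α → y ^ lrmin c α * w ^ rlmax M α

  module _ (I : ℕ → Carrier) (invI : ∀ d → I d IsInverseOf1- fromℕ d) where

    module FRecursion (y w : Carrier) {c lo r : ℕ} (lo<c : lo ℕ.< c) where
      F′ : ℕ → Carrier
      F′ = F y w c (suc lo) r

      -- The contribution of the part before the first `lo` if N is the threshold left by what comes
      -- after it; the power of w records whether that `lo` is itself a right-to-left maximum.
      φ : ℕ → Carrier
      φ N = w ^ [ N < suc lo ] * F′ (N ℕ.⊔ suc lo)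

      φ-> : ∀ j → φ (suc j ℕ.+ lo) ≈ F′ (suc j ℕ.+ lo)
      φ-> j = trans (*-cong (^-≡ w (≥⇒[<] (s≤s (ℕ.m≤n+m lo j))))
          (reflexive (≡.cong F′ (ℕ.m≥n⇒m⊔n≡m (s≤s (ℕ.m≤n+m lo j))))))
        (*-identityˡ _)

      φ-lo : φ lo ≈ w * F′ (suc lo)
      φ-lo = *-cong (trans (^-≡ w (<⇒[<] (ℕ.n<1+n lo))) (*-identityʳ w))
        (reflexive (≡.cong F′ (ℕ.m≤n⇒m⊔n≡n (ℕ.n≤1+n lo))))

      open LastLetter w lo (suc r) φ (λ _ → 1#) (λ _ → 1#) refl (λ _ _ _ → sym (*-identityˡ 1#)) public

      F-step : ∀ M → F y w c lo (suc r) M ≈ F′ M + y * (t * T M)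
      F-step M = trans (wordSeries-first lo r _) (+-congˡ (trans (*-congˡ (trans
        (wordSeries-cong lo (suc r) λ β pβ → begin
          wordSeries (suc lo) r (λ α → y ^ lrmin c (α ++ lo ∷ β) * w ^ rlmax M (α ++ lo ∷ β))
            ≈⟨ wordSeries-cong (suc lo) r (λ α pα → trans
                 (*-cong (^-≡ y (lrmin-first α lo<c pα pβ))
                   (trans (^-≡ w (rlmax-++ M α (lo ∷ β)))
                     (trans (^-homo-* w (rlmax (top M (lo ∷ β)) α) _)
                       (*-congˡ (^-homo-* w [ top M β < suc lo ] (rlmax M β))))))
                 (solve 5 (λ y l a m n → y :* l :* (a :* (m :* n)) := (y :* (m :* n)) :* (l :* a)) refl
                   y _ _ _ _)) ⟩
          wordSeries (suc lo) r (λ α → (y * (w ^ [ top M β < suc lo ] * w ^ rlmax M β)) *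
              (y ^ lrmin c α * w ^ rlmax (top M (lo ∷ β)) α))
            ≈⟨ wordSeries-*ˡ (suc lo) r _ _ ⟩
          y * (w ^ [ top M β < suc lo ] * w ^ rlmax M β) * F′ (top M β ℕ.⊔ suc lo)
            ≈⟨ solve 4 (λ y m n f → y :* (m :* n) :* f := y :* (con 1 :* (n :* (m :* f)))) refl y _ _ _ ⟩
          y * (1# * (w ^ rlmax M β * φ (top M β))) ∎)
        (wordSeries-*ˡ lo (suc r) y _)))
        (solve 3 (λ t y s → t :* (y :* s) := y :* (t :* s)) refl t y _)))

      T-eq : ∀ i e → i ℕ.+ e ≡ suc r →
        T (i ℕ.+ lo) ≈ I i * (φ (i ℕ.+ lo) + w * (t * ∑ i e (λ j → T (suc j ℕ.+ lo))))
      T-eq i e p = T-solve i e p (λ _ _ → refl)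
        (trans (invI i) (+-congˡ (*-congʳ (sym (trans (∑-const lo i 1#) (*-identityʳ _))))))

      -- The product E F for the alphabet without `lo`: this is what the induction hypothesis of
      -- `E*F-sym` speaks of.
      H : ℕ → Carrier
      H j = E w I j * F′ (j ℕ.+ suc lo)

      E*φ : ∀ j → E w I j * φ (suc j ℕ.+ lo) ≈ H j
      E*φ j = *-congˡ (trans (φ-> j) (reflexive (≡.cong F′ (≡.sym (ℕ.+-suc j lo)))))

      E*∑ : ∀ i e → e ℕ.+ i ≡ suc r →
        E w I i * ∑ i e (λ j → T (suc j ℕ.+ lo)) ≈ ∑ i e (λ j → I (suc j) * H j)
      E*∑ i e p = trans (E-∑ w I (suc r) {λ j → φ (j ℕ.+ lo)} {λ j → T (j ℕ.+ lo)}
          (λ j e q → T-eq (suc j) e (≡.trans (ℕ.+-comm (suc j) e) q)) i e p)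
        (∑-cong i e λ j → *-congˡ (E*φ j))

      -- Once `E*∑` has traded the sums over T for sums over H, the variables y and w occur only in
      -- the product y w and in H.
      E*F-zero : E w I 0 * F y w c lo (suc r) lo ≈
        H 0 + y * (w * (t * (I 0 * (H 0 + t * ∑ 0 (suc r) (λ j → I (suc j) * H j)))))
      E*F-zero = begin
        1# * F y w c lo (suc r) lo
          ≈⟨ trans (*-identityˡ _) (F-step lo) ⟩
        F′ lo + y * (t * T lo)
          ≈⟨ +-cong F′-lo (*-congˡ (*-congˡ (trans (T-eq 0 (suc r) ≡.refl)
               (*-congˡ (+-cong φ-lo (*-congˡ (*-congˡ (trans (sym (*-identityˡ _)) (E*∑ 0 (suc r) (ℕ.+-identityʳ _)))))))))) ⟩
        F′ (suc lo) + y * (t * (I 0 * (w * F′ (suc lo) + w * (t * s))))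
          ≈⟨ solve 6 (λ f y t i w s → f :+ y :* (t :* (i :* (w :* f :+ w :* (t :* s)))) :=
               con 1 :* f :+ y :* (w :* (t :* (i :* (con 1 :* f :+ t :* s))))) refl (F′ (suc lo)) y t (I 0) w s ⟩
        H 0 + y * (w * (t * (I 0 * (H 0 + t * s)))) ∎
        where
        s = ∑ 0 (suc r) (λ j → I (suc j) * H j)
        F′-lo : F′ lo ≈ F′ (suc lo)
        F′-lo = wordSeries-cong (suc lo) r λ α p → *-congˡ (^-≡ w (≡.trans (≡.sym (rlmax-⊔ lo (suc lo) p))
          (≡.cong (λ M → rlmax M α) (ℕ.m≤n⇒m⊔n≡n (ℕ.n≤1+n lo)))))

      -- The factor in w is the newest factor of `E`; its counterpart in y comes from the words in
      -- which all letters after the first `lo` stay below the threshold.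
      E*F-suc : ∀ d e → suc d ℕ.+ e ≡ suc r → E w I (suc d) * F y w c lo (suc r) (suc d ℕ.+ lo) ≈
        factor w I (suc d) * factor y I (suc d) * H d
          + y * (w * (t * (t * (I (suc d) * ∑ (suc d) e (λ j → I (suc j) * H j)))))
      E*F-suc d e p = begin
        E w I (suc d) * F y w c lo (suc r) (suc d ℕ.+ lo)
          ≈⟨ *-congˡ (F-step (suc d ℕ.+ lo)) ⟩
        E w I (suc d) * (F′ (suc d ℕ.+ lo) + y * (t * T (suc d ℕ.+ lo)))
          ≈⟨ *-congˡ (+-congˡ (*-congˡ (*-congˡ (trans (T-eq (suc d) e p) (*-congˡ (+-congʳ (φ-> d))))))) ⟩
        factor w I (suc d) * E w I d * (f + y * (t * (I (suc d) * (f + w * (t * s)))))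
          ≈⟨ solve 8 (λ a E f y t I w s → a :* E :* (f :+ y :* (t :* (I :* (f :+ w :* (t :* s))))) :=
               a :* (con 1 :+ y :* (t :* I)) :* (E :* f) :+ y :* (w :* (t :* (t :* (I :* (a :* E :* s)))))) refl
               (factor w I (suc d)) (E w I d) f y t (I (suc d)) w s ⟩
        factor w I (suc d) * factor y I (suc d) * (E w I d * f)
          + y * (w * (t * (t * (I (suc d) * (E w I (suc d) * s)))))
          ≈⟨ +-cong (*-congˡ (*-congˡ (reflexive (≡.cong F′ (≡.sym (ℕ.+-suc d lo))))))
               (*-congˡ (*-congˡ (*-congˡ (*-congˡ (*-congˡ (E*∑ (suc d) e (≡.trans (ℕ.+-comm e (suc d)) p))))))) ⟩
        _ ∎
        where
        f = F′ (suc d ℕ.+ lo)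
        s = ∑ (suc d) e (λ j → T (suc j ℕ.+ lo))

    -- Induction on the alphabet, whose smallest letter is removed. The bound on c puts it above all
    -- letters, so that `lrmin c` misses no minimum.
    E*F-sym : ∀ y w c r lo i → i ≤ r → r ℕ.+ lo ≤ c →
      E w I i * F y w c lo r (i ℕ.+ lo) ≈ E y I i * F w y c lo r (i ℕ.+ lo)
    E*F-sym y w c zero lo zero i≤r _ = *-congˡ (trans (F-empty y w) (sym (F-empty w y)))
      where
      F-empty : ∀ y w → F y w c lo 0 lo ≈ 1#
      F-empty y w = trans (wordSeries-∷ʳ lo 0 _)
        (solve 1 (λ t → con 1 :* con 1 :+ t :* con 0 := con 1) refl t)
    E*F-sym y w c (suc r) lo i i≤r r≤c = go i i≤r
      where
      lo<c : lo ℕ.< c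
      lo<c = ℕ.≤-trans (s≤s (ℕ.m≤n+m lo r)) r≤c
      module Fʸʷ = FRecursion y w {c} {lo} {r} lo<c
      module Fʷʸ = FRecursion w y {c} {lo} {r} lo<c
      H-sym : ∀ j → j ≤ r → Fʸʷ.H j ≈ Fʷʸ.H j
      H-sym j j≤r = E*F-sym y w c r (suc lo) j j≤r (≡.subst (_≤ c) (≡.sym (ℕ.+-suc r lo)) r≤c)
      ∑-sym : ∀ i e → e ℕ.+ i ≡ suc r → ∑ i e (λ j → I (suc j) * Fʸʷ.H j) ≈ ∑ i e (λ j → I (suc j) * Fʷʸ.H j)
      ∑-sym i e p = ∑-cong-< i e λ j _ u → *-congˡ (H-sym j (ℕ.≤-pred (≡.subst (j ℕ.<_) p u)))
      y*w*-comm : ∀ y w s → y * (w * s) ≈ w * (y * s)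
      y*w*-comm = solve 3 (λ y w s → y :* (w :* s) := w :* (y :* s)) refl
      go : ∀ i → i ≤ suc r →
        E w I i * F y w c lo (suc r) (i ℕ.+ lo) ≈ E y I i * F w y c lo (suc r) (i ℕ.+ lo)
      go zero _ = trans Fʸʷ.E*F-zero (trans
        (+-cong (H-sym 0 z≤n) (trans (y*w*-comm y w _) (*-congˡ (*-congˡ (*-congˡ (*-congˡ
          (+-cong (H-sym 0 z≤n) (*-congˡ (∑-sym 0 (suc r) (ℕ.+-identityʳ _))))))))))
        (sym Fʷʸ.E*F-zero))
      go (suc d) d<r = trans (Fʸʷ.E*F-suc d e p) (trans
        (+-cong (*-cong (*-comm _ _) (H-sym d (ℕ.≤-pred d<r)))
          (trans (y*w*-comm y w _) (*-congˡ (*-congˡ (*-congˡ (*-congˡ (*-congˡ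
            (∑-sym (suc d) e (≡.trans (ℕ.+-comm e (suc d)) p)))))))))
        (sym (Fʷʸ.E*F-suc d e p)))
        where
        e = suc r ℕ.∸ suc d
        p = ℕ.m+[n∸m]≡n d<r

  -- Words sorted by their largest letter

  module _ (x w : Carrier) (c : ℕ) where

    -- φ is an arbitrary function of the largest letter: cutting at the last `lo` turns B for φ into
    -- values of B for two other functions.
    B : ℕ → ℕ → (ℕ → Carrier) → Carrier
    B lo r φ = wordSeries lo r λ β → x ^ rlmin c β * (w ^ rlmax lo β * φ (top lo β))

    module BRecursion (lo r : ℕ) (φ : ℕ → Carrier) (lo<c : lo ℕ.< c) where
      κ : ℕ → Carrier
      κ a = x ^ [ a < suc lo ]

      ψ-∷ʳ : ∀ b a → lo ≤ a → x ^ rlmin (suc lo) (b ∷ʳ a) ≈ κ a * x ^ rlmin (suc lo) b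
      ψ-∷ʳ b a l = begin
        x ^ rlmin (suc lo) (b ∷ʳ a)
          ≈⟨ ^-≡ x (rlmin-++ (suc lo) b (a ∷ [])) ⟩
        x ^ (rlmin (suc lo ℕ.⊓ suc a) b ℕ.+ ([ a < suc lo ] ℕ.+ 0))
          ≈⟨ ^-≡ x (≡.cong₂ (λ m n → rlmin m b ℕ.+ n) (ℕ.m≤n⇒m⊓n≡m (s≤s l)) (ℕ.+-identityʳ _)) ⟩
        x ^ (rlmin (suc lo) b ℕ.+ [ a < suc lo ])
          ≈⟨ ^-homo-* x (rlmin (suc lo) b) _ ⟩
        x ^ rlmin (suc lo) b * κ a
          ≈⟨ *-comm _ _ ⟩
        κ a * x ^ rlmin (suc lo) b ∎

      open LastLetter w lo (suc r) φ (λ γ → x ^ rlmin (suc lo) γ) κ refl ψ-∷ʳ public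

      -- N stands for `top (suc lo) β`, where β consists of letters above `lo`. The indicators
      -- single out empty β: there φ₁ corrects the threshold back to `lo`, and in φ₂ the last `lo`
      -- is a right-to-left maximum and earns a w.
      φ₁ φ₂ : ℕ → Carrier
      φ₁ N = φ (N ℕ.∸ [ N < suc (suc lo) ])
      φ₂ N = w ^ [ N < suc (suc lo) ] * T N

      B-step : B lo (suc r) φ ≈ B (suc lo) r φ₁ + x * (t * B (suc lo) r φ₂)
      B-step = trans (wordSeries-last lo r _) (+-cong
        (wordSeries-cong (suc lo) r λ β p → *-congˡ (*-cong (^-≡ w (rlmax-suc p)) (reflexive (≡.cong φ (top-φ₁ β p)))))
        (trans (*-congˡ (trans (wordSeries-cong (suc lo) r λ β p → begin
          wordSeries lo (suc r) (λ γ → x ^ rlmin c (γ ++ lo ∷ β) * (w ^ rlmax lo (γ ++ lo ∷ β) * φ (top lo (γ ++ lo ∷ β))))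
            ≈⟨ wordSeries-cong lo (suc r) (λ γ _ → trans
                 (*-cong (trans (^-≡ x (rlmin-last γ lo<c (All.map ℕ.<⇒≤ p))) (^-homo-* x (rlmin (suc lo) γ) (suc (rlmin c β))))
                   (*-cong (trans (^-≡ w (≡.trans (rlmax-++ lo γ (lo ∷ β))
                         (≡.cong₂ (λ k m → rlmax k γ ℕ.+ m) (top-suc lo β)
                           (≡.cong₂ ℕ._+_ (indicator β p) (rlmax-suc p)))))
                       (trans (^-homo-* w (rlmax (top (suc lo) β) γ) _)
                         (*-congˡ (^-homo-* w [ top (suc lo) β < suc (suc lo) ] (rlmax (suc lo) β)))))
                     (reflexive (≡.cong φ (≡.trans (top-++ lo γ (lo ∷ β)) (≡.cong (λ k → top k γ) (top-suc lo β)))))))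
                 (solve 7 (λ l x k m i n f → l :* (x :* k) :* (m :* (i :* n) :* f) :=
                   (x :* (k :* (n :* i))) :* (l :* (m :* f))) refl _ x _ _ _ _ _)) ⟩
          wordSeries lo (suc r) (λ γ → (x * (x ^ rlmin c β * (w ^ rlmax (suc lo) β * w ^ [ top (suc lo) β < suc (suc lo) ]))) *
            (x ^ rlmin (suc lo) γ * (w ^ rlmax (top (suc lo) β) γ * φ (top (top (suc lo) β) γ))))
            ≈⟨ wordSeries-*ˡ lo (suc r) _ _ ⟩
          (x * (x ^ rlmin c β * (w ^ rlmax (suc lo) β * w ^ [ top (suc lo) β < suc (suc lo) ]))) * T (top (suc lo) β)
            ≈⟨ solve 5 (λ x k n i T → x :* (k :* (n :* i)) :* T := x :* (k :* (n :* (i :* T)))) refl x _ _ _ _ ⟩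
          x * (x ^ rlmin c β * (w ^ rlmax (suc lo) β * φ₂ (top (suc lo) β))) ∎)
          (wordSeries-*ˡ (suc lo) r x _)))
          (solve 3 (λ t x s → t :* (x :* s) := x :* (t :* s)) refl t x _)))
        where
        top-φ₁ : ∀ β → All (suc lo ≤_) β → top lo β ≡ top (suc lo) β ℕ.∸ [ top (suc lo) β < suc (suc lo) ]
        top-φ₁ []      _ = ≡.cong (suc lo ℕ.∸_) (≡.sym (<⇒[<] (ℕ.n<1+n (suc lo))))
        top-φ₁ (b ∷ β) p = ≡.trans (≡.sym (ℕ.m≥n⇒m⊔n≡m (ℕ.<⇒≤ (<top p))))
          (≡.trans (top-suc lo (b ∷ β)) (≡.cong (top (suc lo) (b ∷ β) ℕ.∸_) (≡.sym (≥⇒[<] (<top p)))))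
        indicator : ∀ β → All (suc lo ≤_) β → [ top lo β < suc lo ] ≡ [ top (suc lo) β < suc (suc lo) ]
        indicator []      _ = ≡.refl
        indicator (b ∷ β) p = ≡.trans (≥⇒[<] (ℕ.<⇒≤ (<top p))) (≡.sym (≥⇒[<] (<top p)))

      φ₁-lo : φ₁ (suc lo) ≈ φ lo
      φ₁-lo = reflexive (≡.cong (λ k → φ (suc lo ℕ.∸ k)) (<⇒[<] (ℕ.n<1+n (suc lo))))

      φ₂-lo : φ₂ (suc lo) ≈ w * T (suc lo)
      φ₂-lo = *-congʳ (trans (^-≡ w (<⇒[<] (ℕ.n<1+n (suc lo)))) (*-identityʳ w))

      index : ∀ N → [ suc N ℕ.+ suc lo < suc (suc lo) ] ≡ 0
      index N = ≥⇒[<] (s≤s (ℕ.m≤n+m (suc lo) N))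

      φ₁-> : ∀ N → φ₁ (suc N ℕ.+ suc lo) ≈ φ (suc (suc N) ℕ.+ lo)
      φ₁-> N = reflexive (≡.trans (≡.cong (λ k → φ (suc N ℕ.+ suc lo ℕ.∸ k)) (index N)) (≡.cong (φ ∘ suc) (ℕ.+-suc N lo)))

      φ₂-> : ∀ N → φ₂ (suc N ℕ.+ suc lo) ≈ T (suc (suc N) ℕ.+ lo)
      φ₂-> N = trans (*-cong (^-≡ w (index N)) (reflexive (≡.cong (T ∘ suc) (ℕ.+-suc N lo)))) (*-identityˡ _)

    module _ (J : ℕ → Carrier) (invJ : ∀ N → J N IsInverseOf1- (fromℕ N + x)) where

      -- As φ is arbitrary, this identifies `X x w J N` as the series of the words with largest
      -- letter `lo` + N. The separate term is the empty word.
      B-eq : ∀ r lo φ → r ℕ.+ lo ≤ c → B lo r φ ≈ φ lo + ∑ 0 r (λ N → X x w J N * φ (suc N ℕ.+ lo))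
      B-eq zero lo φ _ = trans (wordSeries-∷ʳ lo 0 _)
        (solve 2 (λ t f → con 1 :* (con 1 :* f) :+ t :* con 0 := f :+ con 0) refl t (φ lo))
      B-eq (suc r) lo φ r≤c = begin
        B lo (suc r) φ
          ≈⟨ B-step ⟩
        B (suc lo) r φ₁ + x * (t * B (suc lo) r φ₂)
          ≈⟨ +-cong (B-eq r (suc lo) φ₁ r≤c′) (*-congˡ (*-congˡ (B-eq r (suc lo) φ₂ r≤c′))) ⟩
        φ₁ (suc lo) + ∑ 0 r (λ N → X x w J N * φ₁ (suc N ℕ.+ suc lo))
          + x * (t * (φ₂ (suc lo) + ∑ 0 r (λ N → X x w J N * φ₂ (suc N ℕ.+ suc lo))))
          ≈⟨ +-cong (+-cong φ₁-lo (∑-cong 0 r λ N → *-congˡ (φ₁-> N)))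
               (*-congˡ (*-congˡ (+-cong φ₂-lo (∑-cong 0 r λ N → *-congˡ (φ₂-> N))))) ⟩
        φ lo + ∑ 0 r (λ N → X x w J N * φ (suc (suc N) ℕ.+ lo))
          + x * (t * (w * T (suc lo) + ∑ 0 r (λ N → X x w J N * T (suc (suc N) ℕ.+ lo))))
          ≈⟨ +-assoc _ _ _ ⟩
        φ lo + (∑ 0 r (λ N → X x w J N * φ (suc (suc N) ℕ.+ lo))
          + x * (t * (w * T (suc lo) + ∑ 0 r (λ N → X x w J N * T (suc (suc N) ℕ.+ lo)))))
          ≈⟨ +-congˡ (X-telescope x w J r {λ j → φ (suc j ℕ.+ lo)} {λ j → T (suc j ℕ.+ lo)} T-eq) ⟩
        φ lo + (X x w J 0 * φ (suc lo) + ∑ 0 r (λ N → X x w J (suc N) * φ (suc (suc N) ℕ.+ lo)))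
          ≈⟨ +-congˡ (+-congˡ (reflexive (∑-suc 0 r _))) ⟨
        φ lo + ∑ 0 (suc r) (λ N → X x w J N * φ (suc N ℕ.+ lo)) ∎
        where
        open BRecursion lo r φ (ℕ.≤-trans (s≤s (ℕ.m≤n+m lo r)) r≤c)
        r≤c′ : r ℕ.+ suc lo ≤ c
        r≤c′ = ≡.subst (_≤ c) (≡.sym (ℕ.+-suc r lo)) r≤c
        -- The letter `lo` counts x and each of the other j letters counts 1; this is the origin of
        -- the denominators 1 - (j + x) t.
        ∑κ : ∀ j → ∑ lo (suc j) κ ≈ fromℕ j + x
        ∑κ j = trans (+-cong (trans (^-≡ x (<⇒[<] (ℕ.n<1+n lo))) (*-identityʳ x))
            (trans (∑-cong-< (suc lo) j λ a l _ → ^-≡ x (≥⇒[<] l)) (trans (∑-const (suc lo) j 1#) (*-identityʳ _))))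
          (+-comm x _)
        T-eq : ∀ j e → e ℕ.+ j ≡ r → T (suc j ℕ.+ lo) ≈
          J j * (φ (suc j ℕ.+ lo) + w * (t * ∑ j e (λ k → T (suc (suc k) ℕ.+ lo))))
        T-eq j e p = trans
          (T-solve (suc j) e (≡.cong suc (≡.trans (ℕ.+-comm j e) p))
            (λ a l → ^-≡ x (≥⇒[<] (ℕ.≤-trans (s≤s (ℕ.m≤n+m lo j)) l)))
            (trans (invJ j) (+-congˡ (*-congʳ (sym (∑κ j))))))
          (*-congˡ (+-congˡ (*-congˡ (*-congˡ (reflexive (∑-suc j e _))))))

  -- The series Dₖ, its symmetry and its value at y = 1

  weight : (x y w : Carrier) (c : ℕ) → List ℕ → Carrier
  weight x y w c b = y ^ lrmin c b * (x ^ rlmin c b * w ^ rlmax 0 b)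

  D : (x y w : Carrier) (k : ℕ) → Carrier
  D x y w k = t * wordSeries 0 (suc k) λ β → wordSeries 1 k λ α → weight x y w (suc k) (α ++ 0 ∷ β)

  D-complement : ∀ x y w k →
    wordSeries 0 (suc k) (weight x y w (suc k)) ≈ wordSeries 1 k (weight x y w (suc k)) + D x y w k
  D-complement x y w k = wordSeries-first 0 k _

  module _ (I J : ℕ → Carrier) (x : Carrier)
    (invI : ∀ d → I d IsInverseOf1- fromℕ d) (invJ : ∀ N → J N IsInverseOf1- (fromℕ N + x))
    where

    -- The term outside the sum belongs to empty β, where the w in front is earned by the letter 0
    -- itself. For nonempty β with largest letter N the same w is split off from X N = w c_N E_N.
    D-eq : ∀ y w k → D x y w k ≈ x * (y * (w * (t *
      (E w I 0 * F y w (suc k) 1 k 1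
        + ∑ 0 (suc k) (λ N → residue x J N * (E w I N * F y w (suc k) 1 k (N ℕ.+ 1)))))))
    D-eq y w k = begin
      t * wordSeries 0 (suc k) (λ β → wordSeries 1 k λ α → weight x y w (suc k) (α ++ 0 ∷ β))
        ≈⟨ *-congˡ (trans (wordSeries-cong 0 (suc k) λ β pβ → begin
             wordSeries 1 k (λ α → weight x y w (suc k) (α ++ 0 ∷ β))
               ≈⟨ wordSeries-cong 1 k (λ α pα → trans
                    (*-cong (^-≡ y (lrmin-first α (s≤s z≤n) pα pβ))
                      (*-cong (^-≡ x (rlmin-first {α = α} (s≤s z≤n) pα pβ))
                        (trans (^-≡ w (rlmax-++ 0 α (0 ∷ β)))
                          (trans (^-homo-* w (rlmax (top 0 (0 ∷ β)) α) _)
                            (*-congˡ (^-homo-* w [ top 0 β < 1 ] (rlmax 0 β)))))))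
                    (solve 7 (λ y l x k a m n → (y :* l) :* ((x :* k) :* (a :* (m :* n))) :=
                       (x :* (y :* (k :* (n :* m)))) :* (l :* a)) refl y _ x _ _ _ _)) ⟩
             wordSeries 1 k (λ α → (x * (y * (x ^ rlmin (suc k) β * (w ^ rlmax 0 β * w ^ [ top 0 β < 1 ])))) *
                (y ^ lrmin (suc k) α * w ^ rlmax (top 0 (0 ∷ β)) α))
               ≈⟨ wordSeries-*ˡ 1 k _ _ ⟩
             (x * (y * (x ^ rlmin (suc k) β * (w ^ rlmax 0 β * w ^ [ top 0 β < 1 ])))) * F y w (suc k) 1 k (top 0 β ℕ.⊔ 1)
               ≈⟨ solve 6 (λ x y k n m f → x :* (y :* (k :* (n :* m))) :* f := (x :* y) :* (k :* (n :* (m :* f)))) refl x y _ _ _ _ ⟩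
             (x * y) * (x ^ rlmin (suc k) β * (w ^ rlmax 0 β * φ (top 0 β))) ∎)
             (wordSeries-*ˡ 0 (suc k) _ _)) ⟩
      t * ((x * y) * B x w (suc k) 0 (suc k) φ)
        ≈⟨ *-congˡ (*-congˡ (trans (B-eq x w (suc k) J invJ (suc k) 0 φ (ℕ.≤-reflexive (ℕ.+-identityʳ (suc k))))
             (+-cong φ-lo (trans (∑-cong 0 (suc k) λ N → trans
               (*-cong (X-factors x w J invI invJ N) (trans (φ-> N) (reflexive (≡.cong F′ (≡.sym (ℕ.+-suc N 0))))))
               (solve 4 (λ w c e f → w :* (c :* e) :* f := w :* (c :* (e :* f))) refl w _ _ _))
               (∑-*ˡ 0 (suc k) w _))))) ⟩
      t * ((x * y) * (w * F′ 1 + w * s))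
        ≈⟨ solve 6 (λ t x y w f s → t :* ((x :* y) :* (w :* f :+ w :* s)) :=
             x :* (y :* (w :* (t :* (con 1 :* f :+ s))))) refl t x y w (F′ 1) s ⟩
      x * (y * (w * (t * (1# * F′ 1 + s)))) ∎
      where
      open FRecursion I invI y w {suc k} {0} {k} (s≤s z≤n) using (φ; φ-lo; φ->; F′)
      s = ∑ 0 (suc k) (λ N → residue x J N * (E w I N * F′ (N ℕ.+ 1)))

    D-sym : ∀ y w k → D x y w k ≈ D x w y k
    D-sym y w k = begin
      D x y w k
        ≈⟨ D-eq y w k ⟩
      _ ≈⟨ *-congˡ (trans (solve 3 (λ y w s → y :* (w :* s) := w :* (y :* s)) refl y w _)
             (*-congˡ (*-congˡ (*-congˡ (+-cong (EF-sym 0 z≤n)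
               (∑-cong-< 0 (suc k) λ N _ u → *-congˡ
                 (EF-sym N (ℕ.≤-pred (≡.subst (N ℕ.<_) (ℕ.+-identityʳ (suc k)) u))))))))) ⟩
      _ ≈⟨ D-eq w y k ⟨
      D x w y k ∎
      where
      EF-sym : ∀ N → N ≤ k → E w I N * F y w (suc k) 1 k (N ℕ.+ 1) ≈ E y I N * F w y (suc k) 1 k (N ℕ.+ 1)
      EF-sym N N≤k = E*F-sym I invI y w (suc k) k 1 N N≤k (ℕ.≤-reflexive (ℕ.+-comm k 1))

    -- For y = 1 the weight no longer depends on `lrmin`, so `B-eq` with constant φ sums all words
    -- over k + 1 and over k letters; the two sums of X differ in their last term only.
    D-product : ∀ w k → D x 1# w k ≈ X x w J k
    D-product w k = +-cancelˡ (wordSeries 1 k (weight x 1# w (suc k))) _ _ (begin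
      wordSeries 1 k (weight x 1# w (suc k)) + D x 1# w k
        ≈⟨ D-complement x 1# w k ⟨
      wordSeries 0 (suc k) (weight x 1# w (suc k))
        ≈⟨ wordSeries-cong 0 (suc k) (λ b _ → weight-B b) ⟩
      B x w (suc k) 0 (suc k) (λ _ → 1#)
        ≈⟨ B-eq x w (suc k) J invJ (suc k) 0 _ (ℕ.≤-reflexive (ℕ.+-identityʳ (suc k))) ⟩
      1# + ∑ 0 (suc k) (λ N → X x w J N * 1#)
        ≈⟨ +-congˡ (∑-last 0 k _) ⟩
      1# + (∑ 0 k (λ N → X x w J N * 1#) + X x w J (k ℕ.+ 0) * 1#)
        ≈⟨ +-assoc _ _ _ ⟨
      1# + ∑ 0 k (λ N → X x w J N * 1#) + X x w J (k ℕ.+ 0) * 1#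
        ≈⟨ +-cong (B-eq x w (suc k) J invJ k 1 _ (ℕ.≤-reflexive (ℕ.+-comm k 1)))
             (trans (reflexive (≡.cong (X x w J) (≡.sym (ℕ.+-identityʳ k)))) (sym (*-identityʳ _))) ⟨
      B x w (suc k) 1 k (λ _ → 1#) + X x w J k
        ≈⟨ +-congʳ (wordSeries-cong 1 k (λ b p → trans (weight-B b)
             (*-congˡ (*-congʳ (^-≡ w (rlmax-suc p)))))) ⟨
      wordSeries 1 k (weight x 1# w (suc k)) + X x w J k ∎)
      where
      1^ : ∀ n → 1# ^ n ≈ 1#
      1^ zero    = refl
      1^ (suc n) = trans (*-identityˡ _) (1^ n)
      weight-B : ∀ b → weight x 1# w (suc k) b ≈ x ^ rlmin (suc k) b * (w ^ rlmax 0 b * 1#)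
      weight-B b = trans (*-congʳ (1^ (lrmin (suc k) b))) (trans (*-identityˡ _) (*-congˡ (sym (*-identityʳ _))))

-- Words as barred permutations

insertAt : ℕ → ℕ → List ℕ → List ℕ
insertAt zero    l b       = l ∷ b
insertAt (suc v) l []      = l ∷ []
insertAt (suc v) l (a ∷ b) = a ∷ insertAt v l b

-- What b must satisfy so that l, inserted at position s, becomes a smallest letter at its first
-- occurrence. On the side of permutations: no value below π₁ shares the block of π₁ or comes
-- earlier.
Above : ℕ → ℕ → List ℕ → Set
Above l zero    b       = All (l ≤_) b
Above l (suc s) []      = ⊤
Above l (suc s) (a ∷ b) = l ℕ.< a × Above l s b

-- Positions of the word are values of π, and the left-to-right minima after π₁ are values below π₁.
-- A recursion that deletes π₁ therefore has to carry a cut-off i; `rlminFrom` is the counterpart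
-- for left-to-right maxima.
lrminTo : ℕ → ℕ → List ℕ → ℕ
lrminTo zero    c b       = 0
lrminTo (suc i) c []      = 0
lrminTo (suc i) c (a ∷ b) = [ a < c ] ℕ.+ lrminTo i (c ℕ.⊓ a) b

rlminFrom : ℕ → ℕ → List ℕ → ℕ
rlminFrom zero    c b       = rlmin c b
rlminFrom (suc j) c []      = 0
rlminFrom (suc j) c (a ∷ b) = rlminFrom j c b

lrminTo-all : ∀ {n} c b → length b ≡ n → lrminTo n c b ≡ lrmin c b
lrminTo-all {zero}  c []      p = ≡.refl
lrminTo-all {suc n} c (a ∷ b) p = ≡.cong ([ a < c ] ℕ.+_) (lrminTo-all (c ℕ.⊓ a) b (ℕ.suc-injective p))

lrminTo-[] : ∀ i c → lrminTo i c [] ≡ 0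
lrminTo-[] zero    c = ≡.refl
lrminTo-[] (suc i) c = ≡.refl

rlminFrom-[] : ∀ j c → rlminFrom j c [] ≡ 0
rlminFrom-[] zero    c = ≡.refl
rlminFrom-[] (suc j) c = ≡.refl

lrminTo-none : ∀ {m} i {c b} → c ≤ m → All (m ≤_) b → lrminTo i c b ≡ 0
lrminTo-none zero    p qs = ≡.refl
lrminTo-none (suc i) p [] = ≡.refl
lrminTo-none (suc i) {c} {a ∷ b} p (q ∷ qs) =
  ≡.cong₂ ℕ._+_ (≥⇒[<] (ℕ.≤-trans p q)) (lrminTo-none i (ℕ.≤-trans (ℕ.m⊓n≤m c a) p) qs)

open CommutativeSemigroupProperties ℕ.+-commutativeSemigroup using (x∙yz≈y∙xz)

-- Behind a smallest letter there is no further strict minimum, so apart from `l` only positions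
-- before both v and i count.
lrminTo-insertAt : ∀ {l} i v {c} b → l ℕ.< c → v ≤ length b → Above l v b →
  lrminTo i c (insertAt v l b) ≡ [ v < i ] ℕ.+ lrminTo (v ℕ.⊓ i) c b
lrminTo-insertAt zero    v       {c} b       l<c v≤ p =
  ≡.sym (≡.cong (λ k → lrminTo k c b) (ℕ.⊓-zeroʳ v))
lrminTo-insertAt {l} (suc i) zero {c} b       l<c v≤ p =
  ≡.cong₂ ℕ._+_ (<⇒[<] l<c) (lrminTo-none i (ℕ.m⊓n≤n c l) p)
lrminTo-insertAt (suc i) (suc v) {c} (a ∷ b) l<c (s≤s v≤) (q , p) = ≡.trans
  (≡.cong ([ a < c ] ℕ.+_) (lrminTo-insertAt i v b (ℕ.⊓-glb l<c q) v≤ p))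
  (x∙yz≈y∙xz [ a < c ] [ v < i ] _)

bottom-insertAt : ∀ c v l b → bottom c (insertAt v l b) ≤ suc l
bottom-insertAt c zero    l b       = ℕ.m⊓n≤n _ _
bottom-insertAt c (suc v) l []      = ℕ.m⊓n≤n _ _
bottom-insertAt c (suc v) l (a ∷ b) = ℕ.≤-trans (ℕ.m⊓n≤m _ _) (bottom-insertAt c v l b)

rlmin-insertAt : ∀ {l} v {c} b → l ℕ.< c → v ≤ length b → Above l v b →
  rlmin c (insertAt v l b) ≡ suc (rlminFrom v c b)
rlmin-insertAt zero    b       l<c v≤ p = ≡.cong (ℕ._+ _) (<⇒[<] (<bottom l<c p))
rlmin-insertAt {l} (suc v) {c} (a ∷ b) l<c (s≤s v≤) (q , p) = ≡.cong₂ ℕ._+_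
  (≥⇒[<] (ℕ.≤-trans (bottom-insertAt c v l b) q)) (rlmin-insertAt v b l<c v≤ p)

-- The letters before `l` exceed it and are no minima; those behind it move down by one position
-- when `l` is removed, whence `pred j`.
rlminFrom-insertAt : ∀ {l} j v {c} b → l ℕ.< c → v ≤ length b → Above l v b →
  rlminFrom j c (insertAt v l b) ≡ [ j < suc v ] ℕ.+ rlminFrom (v ℕ.⊔ ℕ.pred j) c b
rlminFrom-insertAt zero v {c} b l<c v≤ p = ≡.trans (rlmin-insertAt v b l<c v≤ p)
  (≡.cong (λ k → suc (rlminFrom k c b)) (≡.sym (ℕ.⊔-identityʳ v)))
rlminFrom-insertAt (suc j) zero    b       l<c v≤ p = ≡.refl
rlminFrom-insertAt (suc j) (suc v) {c} (a ∷ b) l<c (s≤s v≤) (q , p) = ≡.trans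
  (rlminFrom-insertAt j v b l<c v≤ p) (≡.cong ([ j < suc v ] ℕ.+_) (pred-suc j))
  where
  pred-suc : ∀ j → rlminFrom (v ℕ.⊔ ℕ.pred j) c b ≡ rlminFrom (suc v ℕ.⊔ j) c (a ∷ b)
  pred-suc zero    = ≡.cong (λ k → rlminFrom k c b) (ℕ.⊔-identityʳ v)
  pred-suc (suc j) = ≡.refl

top-insertAt : ∀ M v l b → top M (insertAt v l b) ≡ top M b ℕ.⊔ suc l
top-insertAt M zero    l b       = ≡.refl
top-insertAt M (suc v) l []      = ≡.refl
top-insertAt M (suc v) l (a ∷ b) = ≡.trans (≡.cong (ℕ._⊔ suc a) (top-insertAt M v l b))
  (≡.trans (ℕ.⊔-assoc (top M b) _ _) (≡.trans (≡.cong (top M b ℕ.⊔_) (ℕ.⊔-comm (suc l) (suc a)))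
    (≡.sym (ℕ.⊔-assoc (top M b) _ _))))

-- No letter behind `l` is smaller, so `l` is a strict right-to-left maximum only at the very end;
-- letters before it are larger and do not notice it.
rlmax-insertAt : ∀ {l} v b → v ≤ length b → Above l v b →
  rlmax 0 (insertAt v l b) ≡ [ length b < suc v ] ℕ.+ rlmax 0 b
rlmax-insertAt zero [] v≤ p = ≡.refl
rlmax-insertAt zero (a ∷ b) v≤ (q ∷ p) = ≡.cong (ℕ._+ rlmax 0 (a ∷ b))
  (≥⇒[<] (ℕ.≤-trans (s≤s q) (ℕ.m≤n⊔m (top 0 b) (suc a))))
rlmax-insertAt {l} (suc v) (a ∷ b) (s≤s v≤) (q , p) = ≡.trans
  (≡.cong₂ ℕ._+_ (≡.trans (≡.cong [_< suc a ] (top-insertAt 0 v l b)) ([⊔<] {top 0 b} (s≤s q))) (rlmax-insertAt v b v≤ p))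
  (x∙yz≈y∙xz [ top 0 b < suc a ] [ length b < suc v ] _)

-- A permutation π of size suc n is coded by π₁ followed by the code of the
-- permutation obtained by deleting π₁ (its Lehmer code).
lminCode : ℕ → List ℕ → ℕ
lminCode i []      = 0
lminCode i (v ∷ p) = [ v < i ] ℕ.+ lminCode (v ℕ.⊓ i) p

lmaxCode : ℕ → List ℕ → ℕ
lmaxCode j []      = 0
lmaxCode j (v ∷ p) = [ j < suc v ] ℕ.+ lmaxCode (v ℕ.⊔ ℕ.pred j) p

rmaxCode : List ℕ → ℕ
rmaxCode []      = 0
rmaxCode (v ∷ p) = [ length p < suc v ] ℕ.+ rmaxCode p

isDescent : ℕ → List ℕ → ℕ
isDescent v []       = 0
isDescent v (v′ ∷ _) = [ v′ < v ]

desCode : List ℕ → ℕ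
desCode []      = 0
desCode (v ∷ p) = isDescent v p ℕ.+ desCode p

-- The number of ways to distribute π₁ ⋯ πₙ to r + 1 consecutive blocks such
-- that every block is increasing, and such that π₁ ≥ s if the first block
-- is not empty.
barrings : List ℕ → ℕ → ℕ → ℕ
barrings []      r       s = 1
barrings (v ∷ p) zero    s = if v <ᵇ s then 0 else barrings p 0 v
barrings (v ∷ p) (suc r) s = barrings (v ∷ p) r 0 ℕ.+ (if v <ᵇ s then 0 else barrings p (suc r) v)

-- The coefficient of uᵏ in uᵈ/(1-u)ⁿ.
expansion : ℕ → ℕ → ℕ → ℕ
expansion zero    zero    zero    = 1
expansion zero    zero    (suc k) = 0
expansion zero    (suc n) zero    = 1
expansion zero    (suc n) (suc k) = expansion zero (suc n) k ℕ.+ expansion zero n (suc k)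
expansion (suc d) n       zero    = 0
expansion (suc d) n       (suc k) = expansion d n k

expansion-0 : ∀ d n → expansion d (suc n) 0 ≡ expansion d n 0
expansion-0 zero    zero    = ≡.refl
expansion-0 zero    (suc n) = ≡.refl
expansion-0 (suc d) n       = ≡.refl

-- The coefficients of (1 - u) · uᵈ/(1 - u)ⁿ⁺¹ = uᵈ/(1 - u)ⁿ.
expansion-suc : ∀ d n k → expansion d (suc n) (suc k) ≡ expansion d (suc n) k ℕ.+ expansion d n (suc k)
expansion-suc zero    n k       = ≡.refl
expansion-suc (suc d) n zero    = expansion-0 d n
expansion-suc (suc d) n (suc k) = expansion-suc d n k

-- An entry v that may stay in the current block may also come after any number of further bars: a
-- factor 1/(1 - u).
barrings-ascent : ∀ d n v p s → (v <ᵇ s) ≡ false → (∀ k → barrings p k v ≡ expansion d n k) →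
  ∀ k → barrings (v ∷ p) k s ≡ expansion d (suc n) k
barrings-ascent d n v p s eq h zero rewrite eq = ≡.trans (h 0) (≡.sym (expansion-0 d n))
barrings-ascent d n v p s eq h (suc k) rewrite eq = ≡.trans
  (≡.cong₂ ℕ._+_ (barrings-ascent d n v p 0 ≡.refl h k) (h (suc k))) (≡.sym (expansion-suc d n k))

-- The bound v says that v already stands in the first block, which is thus nonempty. A descent
-- forces one bar before the next entry: a factor u.
barrings-expansion : ∀ v p k → barrings p k v ≡ expansion (desCode (v ∷ p)) (suc (length p)) k
barrings-expansion v [] k = ≡.sym (geometric k)
  where
  geometric : ∀ k → expansion 0 1 k ≡ 1
  geometric zero    = ≡.refl
  geometric (suc k) = ≡.trans (ℕ.+-identityʳ _) (geometric k)
barrings-expansion v (v′ ∷ p) k with v′ <ᵇ v in eq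
... | false = barrings-ascent (desCode (v′ ∷ p)) (suc (length p)) v′ p v eq (barrings-expansion v′ p) k
... | true  = descent k
  where
  descent : ∀ k → barrings (v′ ∷ p) k v ≡ expansion (suc (desCode (v′ ∷ p))) (suc (suc (length p))) k
  descent zero    rewrite eq = ≡.refl
  descent (suc k) rewrite eq = ≡.trans (ℕ.+-identityʳ _)
    (barrings-ascent (desCode (v′ ∷ p)) (suc (length p)) v′ p 0 ≡.refl (barrings-expansion v′ p) k)

-- Sums over words as sums over codes

module Encoding {c ℓ} (R : CommutativeRing c ℓ) where
  open CommutativeRing R hiding (zero)
  open SetoidReasoning setoid
  open RangeSum R
  open Multiplication semiring using (×-homo-+; ×-congʳ) renaming (_×_ to _·_)

  sumWords : ℕ → ℕ → ℕ → (List ℕ → Carrier) → Carrier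
  sumWords lo r zero    f = f []
  sumWords lo r (suc n) f = ∑ lo r λ a → sumWords lo r n (f ∘ (a ∷_))

  -- The sum over the words of length n with letters in [lo, lo + r] whose
  -- first s letters are different from lo.
  sumRestricted : ℕ → ℕ → ℕ → ℕ → (List ℕ → Carrier) → Carrier
  sumRestricted lo r n       zero    f = sumWords lo (suc r) n f
  sumRestricted lo r zero    (suc s) f = f []
  sumRestricted lo r (suc n) (suc s) f = ∑ (suc lo) r λ a → sumRestricted lo r n s (f ∘ (a ∷_))

  sumWords-cong : ∀ lo r n {f g} → (∀ b → length b ≡ n → All (lo ≤_) b → f b ≈ g b) → sumWords lo r n f ≈ sumWords lo r n g
  sumWords-cong lo r zero    h = h [] ≡.refl []
  sumWords-cong lo r (suc n) h = ∑-cong-< lo r λ a l _ →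
    sumWords-cong lo r n λ b p q → h (a ∷ b) (≡.cong suc p) (l ∷ q)

  sumRestricted-cong : ∀ lo r n s {f g} → (∀ b → length b ≡ n → Above lo s b → f b ≈ g b) → sumRestricted lo r n s f ≈ sumRestricted lo r n s g
  sumRestricted-cong lo r n       zero    h = sumWords-cong lo (suc r) n h
  sumRestricted-cong lo r zero    (suc s) h = h [] ≡.refl tt
  sumRestricted-cong lo r (suc n) (suc s) h = ∑-cong-< (suc lo) r λ a l _ →
    sumRestricted-cong lo r n s λ b p q → h (a ∷ b) (≡.cong suc p) (l , q)

  private
    ∑-if : ∀ (b : Bool) lo r (g : ℕ → Carrier) →
      ∑ lo r (λ a → if b then 0# else g a) ≈ (if b then 0# else ∑ lo r g)
    ∑-if true  lo r g = ∑-0 lo r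
    ∑-if false lo r g = refl

    if-cong : ∀ (b : Bool) {x y} → x ≈ y → (if b then 0# else x) ≈ (if b then 0# else y)
    if-cong true  _ = refl
    if-cong false e = e

  -- Sorted by the position v ≥ s of the first `lo`; deleting that letter leaves a word whose first
  -- v letters differ from `lo`. The signature comes early because the proof recurses through
  -- `sumRestricted-min-tail`, the words that do not begin with `lo`.
  sumRestricted-min : ∀ lo r n s f → sumRestricted lo r (suc n) s f ≈
    sumWords (suc lo) r (suc n) f + ∑ 0 (suc n) (λ v → if v <ᵇ s then 0# else sumRestricted lo r n v (f ∘ insertAt v lo))

  private
    sumRestricted-min-tail : ∀ lo r n s f → ∑ (suc lo) r (λ a → sumRestricted lo r n s (f ∘ (a ∷_))) ≈
      sumWords (suc lo) r (suc n) f + ∑ 0 n (λ v → if v <ᵇ s then 0# else sumRestricted lo r n (suc v) (f ∘ insertAt (suc v) lo))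
    sumRestricted-min-tail lo r zero    zero    f = sym (+-identityʳ _)
    sumRestricted-min-tail lo r zero    (suc s) f = sym (+-identityʳ _)
    sumRestricted-min-tail lo r (suc n) s f = begin
      ∑ (suc lo) r (λ a → sumRestricted lo r (suc n) s (f ∘ (a ∷_)))
        ≈⟨ trans (∑-cong (suc lo) r λ a → sumRestricted-min lo r n s (f ∘ (a ∷_))) (∑-+ (suc lo) r _ _) ⟩
      sumWords (suc lo) r (suc (suc n)) f + ∑ (suc lo) r (λ a → ∑ 0 (suc n) λ v →
        if v <ᵇ s then 0# else sumRestricted lo r n v (f ∘ (a ∷_) ∘ insertAt v lo))
        ≈⟨ +-congˡ (trans (∑-comm (suc lo) r 0 (suc n) _)
             (∑-cong 0 (suc n) λ v → ∑-if (v <ᵇ s) (suc lo) r _)) ⟩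
      sumWords (suc lo) r (suc (suc n)) f + ∑ 0 (suc n) (λ v →
        if v <ᵇ s then 0# else sumRestricted lo r (suc n) (suc v) (f ∘ insertAt (suc v) lo)) ∎

  sumRestricted-min lo r n zero f = begin
    sumWords lo (suc r) n (f ∘ (lo ∷_)) + ∑ (suc lo) r (λ a → sumWords lo (suc r) n (f ∘ (a ∷_)))
      ≈⟨ +-congˡ (sumRestricted-min-tail lo r n 0 f) ⟩
    h + (w + ∑ 0 n (λ v → sumRestricted lo r n (suc v) (f ∘ insertAt (suc v) lo)))
      ≈⟨ trans (sym (+-assoc h w _)) (trans (+-congʳ (+-comm h w)) (+-assoc w h _)) ⟩
    w + (h + ∑ 0 n (λ v → sumRestricted lo r n (suc v) (f ∘ insertAt (suc v) lo)))
      ≡⟨ ≡.cong (λ s → w + (h + s)) (∑-suc 0 n _) ⟨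
    w + ∑ 0 (suc n) (λ v → sumRestricted lo r n v (f ∘ insertAt v lo)) ∎
    where
    h = sumWords lo (suc r) n (f ∘ (lo ∷_))
    w = sumWords (suc lo) r (suc n) f
  sumRestricted-min lo r n (suc s) f = trans (sumRestricted-min-tail lo r n s f)
    (+-congˡ (trans (reflexive (≡.sym (∑-suc 0 n _))) (sym (+-identityˡ _))))

  sumCodes : ℕ → (List ℕ → Carrier) → Carrier
  sumCodes zero    g = g []
  sumCodes (suc n) g = ∑ 0 (suc n) λ v → sumCodes n (g ∘ (v ∷_))

  sumCodes-cong : ∀ n {f g} → (∀ p → length p ≡ n → f p ≈ g p) → sumCodes n f ≈ sumCodes n g
  sumCodes-cong zero    h = h [] ≡.refl
  sumCodes-cong (suc n) h = ∑-cong 0 (suc n) λ v → sumCodes-cong n λ p q → h (v ∷ p) (≡.cong suc q)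

  sumCodes-+ : ∀ n f g → sumCodes n (λ p → f p + g p) ≈ sumCodes n f + sumCodes n g
  sumCodes-+ zero    f g = refl
  sumCodes-+ (suc n) f g = trans (∑-cong 0 (suc n) λ v → sumCodes-+ n _ _) (∑-+ 0 (suc n) _ _)

  sumCodes-0 : ∀ n → sumCodes n (λ _ → 0#) ≈ 0#
  sumCodes-0 zero    = refl
  sumCodes-0 (suc n) = trans (∑-cong 0 (suc n) λ v → sumCodes-0 n) (∑-0 0 (suc n))

  module _ (c : ℕ) where

    wordStats : (ℕ → ℕ → ℕ → Carrier) → ℕ → ℕ → List ℕ → Carrier
    wordStats h i j b = h (lrminTo i c b) (rlminFrom j c b) (rlmax 0 b)

    codeStats : (ℕ → ℕ → ℕ → Carrier) → ℕ → ℕ → List ℕ → Carrier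
    codeStats h i j p = h (lminCode i p) (lmaxCode j p) (rmaxCode p)

    private
      h-cong : (h : ℕ → ℕ → ℕ → Carrier) → ∀ {a a′ b b′ d d′} → a ≡ a′ → b ≡ b′ → d ≡ d′ → h a b d ≈ h a′ b′ d′
      h-cong h ≡.refl ≡.refl ≡.refl = refl

    -- Both sides obey the same recursion: to delete the first smallest letter of a word is to
    -- delete π₁, and v is the position of the former and the value of the latter. The multiplicity
    -- counts the words that belong to one permutation.
    sumRestricted-codes : ∀ n r lo s i j h → suc r ℕ.+ lo ≤ c →
      sumRestricted lo r n s (wordStats h i j) ≈ sumCodes n (λ p → barrings p r s · codeStats h i j p)

    sumRestricted-insertAt-codes : ∀ n r lo v i j h → v ≤ n → suc r ℕ.+ lo ≤ c →
      sumRestricted lo r n v (wordStats h i j ∘ insertAt v lo) ≈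
      sumCodes n (λ p → barrings p r v · codeStats h i j (v ∷ p))
    sumRestricted-insertAt-codes n r lo v i j h v≤n r≤c = begin
      sumRestricted lo r n v (wordStats h i j ∘ insertAt v lo)
        ≈⟨ sumRestricted-cong lo r n v (λ b p q → let v≤b = ℕ.≤-trans v≤n (ℕ.≤-reflexive (≡.sym p)) in h-cong h
             (lrminTo-insertAt i v b lo<c v≤b q)
             (rlminFrom-insertAt j v b lo<c v≤b q)
             (≡.trans (rlmax-insertAt v b v≤b q) (≡.cong (λ k → [ k < suc v ] ℕ.+ rlmax 0 b) p))) ⟩
      sumRestricted lo r n v (wordStats h′ (v ℕ.⊓ i) (v ℕ.⊔ ℕ.pred j))
        ≈⟨ sumRestricted-codes n r lo v (v ℕ.⊓ i) (v ℕ.⊔ ℕ.pred j) h′ r≤c ⟩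
      sumCodes n (λ p → barrings p r v · codeStats h′ (v ℕ.⊓ i) (v ℕ.⊔ ℕ.pred j) p)
        ≈⟨ sumCodes-cong n (λ p q → ×-congʳ (barrings p r v) (h-cong h ≡.refl ≡.refl
             (≡.cong (λ k → [ k < suc v ] ℕ.+ rmaxCode p) (≡.sym q)))) ⟩
      sumCodes n (λ p → barrings p r v · codeStats h i j (v ∷ p)) ∎
      where
      -- The share of the deleted letter is absorbed into the arbitrary function h; n is the length
      -- of the remaining word.
      h′ : ℕ → ℕ → ℕ → Carrier
      h′ a b d = h ([ v < i ] ℕ.+ a) ([ j < suc v ] ℕ.+ b) ([ n < suc v ] ℕ.+ d)
      lo<c : lo ℕ.< c
      lo<c = ℕ.≤-trans (s≤s (ℕ.m≤n+m lo r)) r≤c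

    sumRestricted-codes zero r lo zero i j h r≤c = trans
      (h-cong h (lrminTo-[] i c) (rlminFrom-[] j c) ≡.refl) (sym (+-identityʳ _))
    sumRestricted-codes zero r lo (suc s) i j h r≤c = trans
      (h-cong h (lrminTo-[] i c) (rlminFrom-[] j c) ≡.refl) (sym (+-identityʳ _))
    sumRestricted-codes (suc n) r lo s i j h r≤c = trans (sumRestricted-min lo r n s _) (trans
      (+-congˡ (∑-cong-< 0 (suc n) λ v _ u → if-cong (v <ᵇ s)
        (sumRestricted-insertAt-codes n r lo v i j h (ℕ.≤-pred (≡.subst (v ℕ.<_) (ℕ.+-identityʳ (suc n)) u)) r≤c)))
      (combine r r≤c))
      where
      first : ℕ → ℕ → List ℕ → Carrier
      first r v p = (if v <ᵇ s then 0 else barrings p r v) · codeStats h i j (v ∷ p)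
      if-· : ∀ r v → (if v <ᵇ s then 0# else sumCodes n (λ p → barrings p r v · codeStats h i j (v ∷ p))) ≈
        sumCodes n (first r v)
      if-· r v with v <ᵇ s
      ... | true  = sym (sumCodes-0 n)
      ... | false = refl
      -- Words without `lo` have an empty first block. With a single letter there are none of
      -- positive length; otherwise one letter fewer is available and the bound s on π₁ is gone.
      combine : ∀ r → suc r ℕ.+ lo ≤ c → sumWords (suc lo) r (suc n) (wordStats h i j) +
        ∑ 0 (suc n) (λ v → if v <ᵇ s then 0# else sumCodes n (λ p → barrings p r v · codeStats h i j (v ∷ p))) ≈
        sumCodes (suc n) (λ p → barrings p r s · codeStats h i j p)
      combine zero    r≤c = trans (+-identityˡ _) (∑-cong 0 (suc n) λ v → if-· 0 v)
      combine (suc r) r≤c = begin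
        sumWords (suc lo) (suc r) (suc n) (wordStats h i j) + _
          ≈⟨ +-cong
               (sumRestricted-codes (suc n) r (suc lo) 0 i j h (≡.subst (_≤ c) (≡.cong suc (≡.sym (ℕ.+-suc r lo))) r≤c))
               (∑-cong 0 (suc n) λ v → if-· (suc r) v) ⟩
        sumCodes (suc n) (λ p → barrings p r 0 · codeStats h i j p) + ∑ 0 (suc n) (λ v → sumCodes n (first (suc r) v))
          ≈⟨ ∑-+ 0 (suc n) _ _ ⟨
        ∑ 0 (suc n) (λ v → sumCodes n (λ p → barrings (v ∷ p) r 0 · codeStats h i j (v ∷ p)) + sumCodes n (first (suc r) v))
          ≈⟨ ∑-cong 0 (suc n) (λ v → trans (sym (sumCodes-+ n _ _)) (sumCodes-cong n λ p _ →
               sym (×-homo-+ (codeStats h i j (v ∷ p)) (barrings (v ∷ p) r 0) _))) ⟩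
        sumCodes (suc n) (λ p → barrings p (suc r) s · codeStats h i j p) ∎

module ConstantSeries {c ℓ} (R : CommutativeRing c ℓ) where
  private
    module R = CommutativeRing R
    module S = CommutativeRing (PowerSeries.commutativeRing R)
    module RE = Exponentiation R.semiring
    module SE = Exponentiation S.semiring
  open PowerSeries R using (constant; _≋_)
  open SeriesCoefficients R

  constant-cong : ∀ {x y} → x R.≈ y → constant x ≋ constant y
  constant-cong p zero    = p
  constant-cong p (suc n) = R.refl

  constant-* : ∀ x y → constant (x R.* y) ≋ constant x S.* constant y
  constant-* x y zero    = R.sym (constant-*-coefficient x (constant y) 0)
  constant-* x y (suc n) = R.sym (R.trans (constant-*-coefficient x (constant y) (suc n)) (R.zeroʳ x))

  constant-^ : ∀ x n → constant (x RE.^ n) ≋ constant x SE.^ n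
  constant-^ x zero    = S.refl {constant R.1#}
  constant-^ x (suc n) k = R.trans (constant-* x (x RE.^ n) k)
    (S.*-congˡ {constant x} {constant (x RE.^ n)} {constant x SE.^ n} (constant-^ x n) k)

module _ {c ℓ} (R : CommutativeRing c ℓ) (x y w : CommutativeRing.Carrier R) where
  open CommutativeRing R hiding (zero)
  open Encoding R
  open Exponentiation semiring
  open Multiplication semiring using () renaming (_×_ to _·_)
  open RangeSum R
  open PowerSeries R using (constant; _≋_)
  open WordSeries R
  open SeriesCoefficients R
  open ConstantSeries R
  open SetoidReasoning setoid
  open GroupProperties +-group using () renaming (∙-cancelˡ to +-cancelˡ)
  private
    module S = CommutativeRing (PowerSeries.commutativeRing R)
    module WA = WordAlgebra (PowerSeries.commutativeRing R) (wordCalculus R)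

  monomial : ℕ → ℕ → ℕ → Carrier
  monomial i j k = y ^ i * (x ^ j * w ^ k)

  Dₖ : ℕ → ℕ → Carrier
  Dₖ = WA.D (constant x) (constant y) (constant w)

  Dₖ-zero : ∀ k → Dₖ k 0 ≈ 0#
  Dₖ-zero k = X*-zero (wordSeries 0 (suc k) λ β → wordSeries 1 k λ α →
    WA.weight (constant x) (constant y) (constant w) (suc k) (α ++ 0 ∷ β))

  private
    wordSeries-constant : ∀ lo r n f → wordSeries lo r (constant ∘ f) n ≈ sumWords lo r n f
    wordSeries-constant lo r zero    f = refl
    wordSeries-constant lo r (suc n) f = trans (+-identityˡ _) (∑-cong lo r λ a → wordSeries-constant lo r n (f ∘ (a ∷_)))

    weight-constant : ∀ c b → WA.weight (constant x) (constant y) (constant w) c b ≋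
      constant (monomial (lrmin c b) (rlmin c b) (rlmax 0 b))
    weight-constant c b = S.sym {constant (monomial i j k)} {WA.weight (constant x) (constant y) (constant w) c b}
      (S.trans (constant-* (y ^ i) (x ^ j * w ^ k)) (S.*-cong
        {constant (y ^ i)} {_} {constant (x ^ j * w ^ k)} (constant-^ y i)
        (S.trans (constant-* (x ^ j) (w ^ k)) (S.*-cong {constant (x ^ j)} {_} {constant (w ^ k)} (constant-^ x j) (constant-^ w k)))))
      where
      i = lrmin c b
      j = rlmin c b
      k = rlmax 0 b

  -- v is the position of the first 0, hence the entry π₁, which lies in block 0; this is how the
  -- nonempty first block enters. The words without 0 cancel.
  D-codes : ∀ k n → Dₖ k (suc n) ≈ ∑ 0 (suc n) λ v → sumCodes n λ p →
    expansion (desCode (v ∷ p)) (suc (length p)) k ·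
      monomial (lminCode (suc n) (v ∷ p)) (lmaxCode 0 (v ∷ p)) (rmaxCode (v ∷ p))
  D-codes k n = +-cancelˡ (sumWords 1 k (suc n) f) _ _ (begin
    sumWords 1 k (suc n) f + Dₖ k (suc n)
      ≈⟨ +-congʳ (wordSeries-f 1 k (suc n)) ⟨
    wordSeries 1 k (WA.weight (constant x) (constant y) (constant w) (suc k)) (suc n) + Dₖ k (suc n)
      ≈⟨ WA.D-complement (constant x) (constant y) (constant w) k (suc n) ⟨
    wordSeries 0 (suc k) (WA.weight (constant x) (constant y) (constant w) (suc k)) (suc n)
      ≈⟨ wordSeries-f 0 (suc k) (suc n) ⟩
    sumWords 0 (suc k) (suc n) f
      ≈⟨ sumRestricted-min 0 k n 0 f ⟩
    sumWords 1 k (suc n) f + ∑ 0 (suc n) (λ v → sumRestricted 0 k n v (f ∘ insertAt v 0))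
      ≈⟨ +-congˡ (∑-cong-< 0 (suc n) λ v _ u → let v≤n = ℕ.≤-pred (≡.subst (v ℕ.<_) (ℕ.+-identityʳ (suc n)) u) in
           trans (sumRestricted-cong 0 k n v λ b p _ → reflexive (≡.cong (λ i → monomial i (rlmin (suc k) (insertAt v 0 b)) (rlmax 0 (insertAt v 0 b)))
             (≡.sym (lrminTo-all (suc k) (insertAt v 0 b) (≡.trans (length-insertAt v 0 b) (≡.cong suc p))))))
           (trans (sumRestricted-insertAt-codes (suc k) n k 0 v (suc n) 0 monomial v≤n (ℕ.≤-reflexive (ℕ.+-identityʳ (suc k))))
             (sumCodes-cong n λ p _ → reflexive (≡.cong (_· _) (barrings-expansion v p k))))) ⟩
    sumWords 1 k (suc n) f + _ ∎)
    where
    f : List ℕ → Carrier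
    f b = monomial (lrmin (suc k) b) (rlmin (suc k) b) (rlmax 0 b)
    wordSeries-f : ∀ lo r n → wordSeries lo r (WA.weight (constant x) (constant y) (constant w) (suc k)) n ≈ sumWords lo r n f
    wordSeries-f lo r n = trans (wordSeries-cong lo r (weight-constant (suc k)) n) (wordSeries-constant lo r n f)
    length-insertAt : ∀ v l b → length (insertAt v l b) ≡ suc (length b)
    length-insertAt zero    l b       = ≡.refl
    length-insertAt (suc v) l []      = ≡.refl
    length-insertAt (suc v) l (a ∷ b) = ≡.cong suc (length-insertAt v l b)

-- Permutations and their codes

𝟙 : ∀ {a} {A : Set a} → Dec A → ℕ
𝟙 a? = if does a? then 1 else 0

𝟙-cong : ∀ {a b} {A : Set a} {B : Set b} {a? : Dec A} {b? : Dec B} → A ⇔ B → 𝟙 a? ≡ 𝟙 b?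
𝟙-cong {a? = a?} {b?} e = ≡.cong (if_then 1 else 0) (does-⇔ e a? b?)

𝟙-< : ∀ {a} {A : Set a} {a? : Dec A} {m n} → A ⇔ (m < n) → 𝟙 a? ≡ [ m < n ]
𝟙-< {a? = a?} {m} {n} e = 𝟙-cong {a? = a?} {m ℕ.<? n} e

count-sum : ∀ {p} {P : Pred (Fin n) p} (P? : Decidable P) → count P? ≡ sum λ i → 𝟙 (P? i)
count-sum P? = go P? λ i → i
  where
  go : ∀ {m n p} {P : Pred (Fin m) p} (P? : Decidable P) (f : Fin n → Fin m) →
    length (filter P? (tabulate f)) ≡ sum λ i → 𝟙 (P? (f i))
  go {n = zero}  P? f = ≡.refl
  go {n = suc n} P? f with does (P? (f zero))
  ... | true  = ≡.cong suc (go P? (f ∘ suc))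
  ... | false = go P? (f ∘ suc)

toℕ-punchIn-< : ∀ (v : Fin (suc n)) u → toℕ u < toℕ v → toℕ (punchIn v u) ≡ toℕ u
toℕ-punchIn-< (suc v) zero    p       = ≡.refl
toℕ-punchIn-< (suc v) (suc u) (s≤s p) = ≡.cong suc (toℕ-punchIn-< v u p)

toℕ-punchIn-≥ : ∀ (v : Fin (suc n)) u → toℕ v ≤ toℕ u → toℕ (punchIn v u) ≡ suc (toℕ u)
toℕ-punchIn-≥ zero    u       p       = ≡.refl
toℕ-punchIn-≥ (suc v) (suc u) (s≤s p) = ≡.cong suc (toℕ-punchIn-≥ v u p)

punchIn-<⇔ : ∀ (v : Fin (suc n)) u w → (punchIn v u Fin.< punchIn v w) ⇔ (u Fin.< w)
punchIn-<⇔ v u w = mk⇔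
  (λ p → ℕ.≰⇒> λ q → ℕ.<⇒≱ p (Fin.punchIn-mono-≤ v w u q))
  (λ p → ℕ.≰⇒> λ q → ℕ.<⇒≱ p (Fin.punchIn-cancel-≤ v w u q))

pred≤⇒≤suc : ∀ s {u} → ℕ.pred s ≤ u → s ≤ suc u
pred≤⇒≤suc zero    p = z≤n
pred≤⇒≤suc (suc s) p = s≤s p

module _ (v : Fin (suc n)) (u : Fin n) where

  punchIn<⇔ : ∀ {s} → (toℕ (punchIn v u) < toℕ v × toℕ (punchIn v u) < s) ⇔ (toℕ u < toℕ v ℕ.⊓ s)
  punchIn<⇔ {s} with ℕ.<-≤-connex (toℕ u) (toℕ v)
  ... | inj₁ u<v rewrite toℕ-punchIn-< v u u<v = mk⇔
    (λ (p , q) → ℕ.⊓-glb p q) (λ p → u<v , ℕ.≤-trans p (ℕ.m⊓n≤n _ s))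
  ... | inj₂ v≤u rewrite toℕ-punchIn-≥ v u v≤u = mk⇔
    (λ (p , _) → contradiction (ℕ.<⇒≤ p) (ℕ.<⇒≱ (s≤s v≤u)))
    (λ p → contradiction (ℕ.≤-trans p (ℕ.m⊓n≤m _ s)) (ℕ.≤⇒≯ v≤u))

  <punchIn⇔ : ∀ {s} → (toℕ v < toℕ (punchIn v u) × s < suc (toℕ (punchIn v u))) ⇔ (toℕ v ℕ.⊔ ℕ.pred s < suc (toℕ u))
  <punchIn⇔ {s} with ℕ.<-≤-connex (toℕ u) (toℕ v)
  ... | inj₁ u<v rewrite toℕ-punchIn-< v u u<v = mk⇔
    (λ (p , _) → contradiction (ℕ.<⇒≤ p) (ℕ.<⇒≱ u<v))
    (λ p → contradiction (ℕ.≤-trans (ℕ.m≤m⊔n _ _) (ℕ.≤-pred p)) (ℕ.<⇒≱ u<v))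
  ... | inj₂ v≤u rewrite toℕ-punchIn-≥ v u v≤u = mk⇔
    (λ (p , q) → s≤s (ℕ.⊔-lub v≤u (ℕ.pred-mono-≤ (ℕ.≤-pred q))))
    (λ p → s≤s v≤u , s≤s (pred≤⇒≤suc s (ℕ.≤-trans (ℕ.m≤n⊔m (toℕ v) _) (ℕ.≤-pred p))))

code : Permutation′ n → List ℕ
code {zero}  π = []
code {suc n} π = toℕ (π ⟨$⟩ʳ zero) ∷ code (remove zero π)

length-code : (π : Permutation′ n) → length (code π) ≡ n
length-code {zero}  π = ≡.refl
length-code {suc n} π = ≡.cong suc (length-code (remove zero π))

module _ (π : Permutation′ (suc n)) where
  private
    v = π ⟨$⟩ʳ zero
    π′ = remove zero π

  at-suc : ∀ i → π ⟨$⟩ʳ suc i ≡ punchIn v (π′ ⟨$⟩ʳ i)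
  at-suc = Perm.punchIn-permute π zero

  suc-<⇔ : ∀ i j → (π ⟨$⟩ʳ suc i Fin.< π ⟨$⟩ʳ suc j) ⇔ (π′ ⟨$⟩ʳ i Fin.< π′ ⟨$⟩ʳ j)
  suc-<⇔ i j = ≡.subst₂ (λ a b → (a Fin.< b) ⇔ (π′ ⟨$⟩ʳ i Fin.< π′ ⟨$⟩ʳ j))
    (≡.sym (at-suc i)) (≡.sym (at-suc j)) (punchIn-<⇔ v (π′ ⟨$⟩ʳ i) (π′ ⟨$⟩ʳ j))

IsLMin IsLMax IsRMax : Permutation′ n → Fin n → Set
IsLMin π i = ∀ j → j Fin.< i → π ⟨$⟩ʳ i Fin.< π ⟨$⟩ʳ j
IsLMax π i = ∀ j → j Fin.< i → π ⟨$⟩ʳ j Fin.< π ⟨$⟩ʳ i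
IsRMax π i = ∀ j → i Fin.< j → π ⟨$⟩ʳ j Fin.< π ⟨$⟩ʳ i

isLMin? : (π : Permutation′ n) → Decidable (IsLMin π)
isLMin? π i = Fin.all? λ j → (j Fin.<? i) →-dec (π ⟨$⟩ʳ i Fin.<? π ⟨$⟩ʳ j)

isLMax? : (π : Permutation′ n) → Decidable (IsLMax π)
isLMax? π i = Fin.all? λ j → (j Fin.<? i) →-dec (π ⟨$⟩ʳ j Fin.<? π ⟨$⟩ʳ i)

isRMax? : (π : Permutation′ n) → Decidable (IsRMax π)
isRMax? π i = Fin.all? λ j → (i Fin.<? j) →-dec (π ⟨$⟩ʳ j Fin.<? π ⟨$⟩ʳ i)

-- With the bound s on the value, the statistic satisfies under deletion of π₁ the recursion that
-- defines `lminCode`; `lmaxFrom?` does the same for `lmaxCode`.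
lminBelow? : ∀ s (π : Permutation′ n) i → Dec (IsLMin π i × toℕ (π ⟨$⟩ʳ i) < s)
lminBelow? s π i = isLMin? π i ×-dec (toℕ (π ⟨$⟩ʳ i) ℕ.<? s)

lmaxFrom? : ∀ s (π : Permutation′ n) i → Dec (IsLMax π i × s < suc (toℕ (π ⟨$⟩ʳ i)))
lmaxFrom? s π i = isLMax? π i ×-dec (s ℕ.<? suc (toℕ (π ⟨$⟩ʳ i)))

module _ (π : Permutation′ (suc n)) where
  private
    v = π ⟨$⟩ʳ zero
    π′ = remove zero π

  IsLMin-suc : ∀ s i → (IsLMin π (suc i) × toℕ (π ⟨$⟩ʳ suc i) < s) ⇔
                       (IsLMin π′ i × toℕ (π′ ⟨$⟩ʳ i) < toℕ v ℕ.⊓ s)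
  IsLMin-suc s i = mk⇔
    (λ (h , p) → (λ j j<i → to (suc-<⇔ π i j) (h (suc j) (s≤s j<i)))
               , to (punchIn<⇔ v (π′ ⟨$⟩ʳ i)) (≡.subst (λ k → toℕ k < toℕ v × toℕ k < s) (at-suc π i) (h zero (s≤s z≤n) , p)))
    λ (h , p) → let (p₁ , p₂) = ≡.subst (λ k → toℕ k < toℕ v × toℕ k < s) (≡.sym (at-suc π i))
                                   (from (punchIn<⇔ v (π′ ⟨$⟩ʳ i)) p) in
      (λ { zero _ → p₁ ; (suc j) (s≤s j<i) → from (suc-<⇔ π i j) (h j j<i) }) , p₂

  IsLMax-suc : ∀ s i → (IsLMax π (suc i) × s < suc (toℕ (π ⟨$⟩ʳ suc i))) ⇔
                       (IsLMax π′ i × toℕ v ℕ.⊔ ℕ.pred s < suc (toℕ (π′ ⟨$⟩ʳ i)))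
  IsLMax-suc s i = mk⇔
    (λ (h , p) → (λ j j<i → to (suc-<⇔ π j i) (h (suc j) (s≤s j<i)))
               , to (<punchIn⇔ v (π′ ⟨$⟩ʳ i)) (≡.subst (λ k → toℕ v < toℕ k × s < suc (toℕ k)) (at-suc π i) (h zero (s≤s z≤n) , p)))
    λ (h , p) → let (p₁ , p₂) = ≡.subst (λ k → toℕ v < toℕ k × s < suc (toℕ k)) (≡.sym (at-suc π i))
                                   (from (<punchIn⇔ v (π′ ⟨$⟩ʳ i)) p) in
      (λ { zero _ → p₁ ; (suc j) (s≤s j<i) → from (suc-<⇔ π j i) (h j j<i) }) , p₂

  IsRMax-suc : ∀ i → IsRMax π (suc i) ⇔ IsRMax π′ i
  IsRMax-suc i = mk⇔
    (λ h j i<j → to (suc-<⇔ π j i) (h (suc j) (s≤s i<j)))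
    λ { h (suc j) (s≤s i<j) → from (suc-<⇔ π j i) (h j i<j) }

  suc<zero⇔ : ∀ j → (π ⟨$⟩ʳ suc j Fin.< v) ⇔ (toℕ (π′ ⟨$⟩ʳ j) < toℕ v)
  suc<zero⇔ j = mk⇔
    (λ p → ≡.subst (toℕ (π′ ⟨$⟩ʳ j) <_) (ℕ.⊓-idem (toℕ v))
      (to (punchIn<⇔ v (π′ ⟨$⟩ʳ j)) (≡.subst (λ k → toℕ k < toℕ v × toℕ k < toℕ v) (at-suc π j) (p , p))))
    (λ p → ≡.subst (Fin._< v) (≡.sym (at-suc π j))
      (proj₁ (from (punchIn<⇔ v (π′ ⟨$⟩ʳ j)) (≡.subst (toℕ (π′ ⟨$⟩ʳ j) <_) (≡.sym (ℕ.⊓-idem (toℕ v))) p))))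

  IsRMax-zero : IsRMax π zero ⇔ (n < suc (toℕ v))
  IsRMax-zero = mk⇔
    -- If v is not the largest value, the position with value v in π′ has value v + 1 in π and
    -- contradicts maximality.
    (λ h → ℕ.≰⇒> λ v<n → let j = π′ ⟨$⟩ˡ fromℕ< v<n in
      ℕ.<-irrefl (≡.trans (≡.cong toℕ (Perm.inverseʳ π′)) (Fin.toℕ-fromℕ< v<n))
        (to (suc<zero⇔ j) (h (suc j) (s≤s z≤n))))
    λ { p (suc j) _ → from (suc<zero⇔ j) (ℕ.<-≤-trans (Fin.toℕ<n (π′ ⟨$⟩ʳ j)) (ℕ.≤-pred p)) }

lmin-code : ∀ s (π : Permutation′ n) → sum (λ i → 𝟙 (lminBelow? s π i)) ≡ lminCode s (code π)
lmin-code {zero}  s π = ≡.refl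
lmin-code {suc n} s π = ≡.cong₂ ℕ._+_
  (𝟙-< {a? = lminBelow? s π zero} (mk⇔ proj₂ λ p → (λ _ ()) , p))
  (≡.trans (sum-cong-≗ λ i → 𝟙-cong {a? = lminBelow? s π (suc i)} {lminBelow? _ (remove zero π) i} (IsLMin-suc π s i))
    (lmin-code _ (remove zero π)))

lmax-code : ∀ s (π : Permutation′ n) → sum (λ i → 𝟙 (lmaxFrom? s π i)) ≡ lmaxCode s (code π)
lmax-code {zero}  s π = ≡.refl
lmax-code {suc n} s π = ≡.cong₂ ℕ._+_
  (𝟙-< {a? = lmaxFrom? s π zero} (mk⇔ proj₂ λ p → (λ _ ()) , p))
  (≡.trans (sum-cong-≗ λ i → 𝟙-cong {a? = lmaxFrom? s π (suc i)} {lmaxFrom? _ (remove zero π) i} (IsLMax-suc π s i))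
    (lmax-code _ (remove zero π)))

lmin≡ : (π : Permutation′ n) → lmin π ≡ lminCode n (code π)
lmin≡ {n} π = ≡.trans (count-sum (isLMin? π)) (≡.trans
  (sum-cong-≗ λ i → 𝟙-cong {a? = isLMin? π i} {lminBelow? n π i} (mk⇔ (λ h → h , Fin.toℕ<n _) proj₁))
  (lmin-code n π))

lmax≡ : (π : Permutation′ n) → lmax π ≡ lmaxCode 0 (code π)
lmax≡ π = ≡.trans (count-sum (isLMax? π)) (≡.trans
  (sum-cong-≗ λ i → 𝟙-cong {a? = isLMax? π i} {lmaxFrom? 0 π i} (mk⇔ (λ h → h , s≤s z≤n) proj₁))
  (lmax-code 0 π))

rmax≡ : (π : Permutation′ n) → rmax π ≡ rmaxCode (code π)
rmax≡ π = ≡.trans (count-sum (isRMax? π)) (go π)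
  where
  go : (π : Permutation′ n) → sum (λ i → 𝟙 (isRMax? π i)) ≡ rmaxCode (code π)
  go {zero}  π = ≡.refl
  go {suc n} π = ≡.cong₂ ℕ._+_
    (≡.trans (𝟙-< {a? = isRMax? π zero} (IsRMax-zero π))
      (≡.cong [_< suc (toℕ (π ⟨$⟩ʳ zero)) ] (≡.sym (length-code (remove zero π)))))
    (≡.trans (sum-cong-≗ λ i → 𝟙-cong {a? = isRMax? π (suc i)} {isRMax? (remove zero π) i} (IsRMax-suc π i))
      (go (remove zero π)))

isDescent? : ∀ {m} (π : Permutation′ (suc m)) i → Dec (π ⟨$⟩ʳ suc i Fin.< π ⟨$⟩ʳ inject₁ i)
isDescent? π i = π ⟨$⟩ʳ suc i Fin.<? π ⟨$⟩ʳ inject₁ i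

des≡ : (π : Permutation′ n) → des π ≡ desCode (code π)
des≡ {zero}  π = ≡.refl
des≡ {suc m} π = ≡.trans (count-sum (isDescent? π)) (go π)
  where
  go : ∀ {m} (π : Permutation′ (suc m)) → sum (λ i → 𝟙 (isDescent? π i)) ≡ desCode (code π)
  go {zero}  π = ≡.refl
  go {suc m} π = ≡.cong₂ ℕ._+_
    (𝟙-< {a? = isDescent? π zero} (suc<zero⇔ π zero))
    (≡.trans (sum-cong-≗ λ i → 𝟙-cong {a? = isDescent? π (suc i)} {isDescent? (remove zero π) i} (suc-<⇔ π (suc i) (inject₁ i)))
      (go (remove zero π)))

-- Sums over 𝔖 and the reflection

remove-cong : ∀ {π ρ : Permutation′ (suc n)} → π Perm.≈ ρ → remove zero π Perm.≈ remove zero ρ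
remove-cong {π = π} {ρ} e i = Fin.punchIn-injective (π ⟨$⟩ʳ zero) _ _
  (≡.trans (≡.sym (at-suc π i)) (≡.trans (e (suc i))
    (≡.trans (at-suc ρ i) (≡.cong (λ k → punchIn k (remove zero ρ ⟨$⟩ʳ i)) (≡.sym (e zero))))))

code-cong : ∀ {π ρ : Permutation′ n} → π Perm.≈ ρ → code π ≡ code ρ
code-cong {zero}  e = ≡.refl
code-cong {suc n} {π} {ρ} e = ≡.cong₂ _∷_ (≡.cong toℕ (e zero))
  (code-cong {π = remove zero π} {remove zero ρ} (remove-cong {π = π} {ρ} e))

code-insert : ∀ v (π : Permutation′ n) → code (insert zero v π) ≡ toℕ v ∷ code π
code-insert v π = ≡.cong (toℕ v ∷_)
  (code-cong {π = remove zero (insert zero v π)} {π} (Perm.remove-insert zero v π))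

-- π ↦ the permutation whose diagram is the mirror image of that of π in the
-- antidiagonal.
reflect : Permutation′ n → Permutation′ n
reflect π = Perm.reverse ∘ₚ Perm.flip π ∘ₚ Perm.reverse

⟨$⟩ˡ-cong : ∀ {π ρ : Permutation′ n} → π Perm.≈ ρ → ∀ i → π ⟨$⟩ˡ i ≡ ρ ⟨$⟩ˡ i
⟨$⟩ˡ-cong {π = π} {ρ} e i = ≡.trans (≡.cong (π ⟨$⟩ˡ_) (≡.trans (≡.sym (Perm.inverseʳ ρ)) (≡.sym (e (ρ ⟨$⟩ˡ i)))))
  (Perm.inverseˡ π)

reflect-cong : ∀ {π ρ : Permutation′ n} → π Perm.≈ ρ → reflect π Perm.≈ reflect ρ
reflect-cong {π = π} {ρ} e i = ≡.cong opposite (⟨$⟩ˡ-cong {π = π} {ρ} e (opposite i))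

reflect-involutive : (π : Permutation′ n) → reflect (reflect π) Perm.≈ π
reflect-involutive π i = ≡.trans (Fin.opposite-involutive _) (≡.cong (π ⟨$⟩ʳ_) (Fin.opposite-involutive i))

opposite-<⇔ : ∀ {i j : Fin n} → (opposite i Fin.< opposite j) ⇔ (j Fin.< i)
opposite-<⇔ {n} = mk⇔
  (λ p → ≡.subst₂ Fin._<_ (Fin.opposite-involutive _) (Fin.opposite-involutive _) (mono p)) mono
  where
  mono : ∀ {i j : Fin n} → i Fin.< j → opposite j Fin.< opposite i
  mono {i} {j} p = ≡.subst₂ _<_ (≡.sym (Fin.opposite-prop j)) (≡.sym (Fin.opposite-prop i))
    (ℕ.∸-monoʳ-< (s≤s p) (Fin.toℕ<n j))

-- By trichotomy; the hypothesis on equality will be injectivity or congruence of π.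
contraposition : ∀ {a b c d} → (a ≡ b → c ≡ d) → (a < b → c < d) → d < c → b < a
contraposition {a} {b} e h d<c = ℕ.≰⇒> λ a≤b → case a≤b (ℕ.m≤n⇒m<n∨m≡n a≤b)
  where
  case : _ → _ → _
  case _ (inj₁ a<b) = ℕ.<-asym (h a<b) d<c
  case _ (inj₂ a≡b) = ℕ.<-irrefl (≡.sym (e a≡b)) d<c

module _ (π : Permutation′ n) where
  private
    -- The position to which the reflection moves the entry at position p; the counts are reindexed
    -- by it.
    σ : Permutation′ n
    σ = π ∘ₚ Perm.reverse

  reflect-σ : ∀ p → reflect π ⟨$⟩ʳ (σ ⟨$⟩ʳ p) ≡ opposite p
  reflect-σ p = ≡.cong opposite (≡.trans (≡.cong (π ⟨$⟩ˡ_) (Fin.opposite-involutive _)) (Perm.inverseˡ π))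

  ∀-σ : ∀ {P : Fin n → Set} → (∀ j → P j) ⇔ (∀ q → P (σ ⟨$⟩ʳ q))
  ∀-σ {P} = mk⇔ (λ h q → h (σ ⟨$⟩ʳ q)) λ h j → ≡.subst P (Perm.inverseʳ σ) (h (σ ⟨$⟩ˡ j))

  injective : ∀ {p q} → toℕ (π ⟨$⟩ʳ p) ≡ toℕ (π ⟨$⟩ʳ q) → toℕ p ≡ toℕ q
  injective e = ≡.cong toℕ (≡.trans (≡.sym (Perm.inverseˡ π))
    (≡.trans (≡.cong (π ⟨$⟩ˡ_) (Fin.toℕ-injective e)) (Perm.inverseˡ π)))

  congruent : ∀ {p q : Fin n} → toℕ p ≡ toℕ q → toℕ (π ⟨$⟩ʳ p) ≡ toℕ (π ⟨$⟩ʳ q)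
  congruent e = ≡.cong (λ p → toℕ (π ⟨$⟩ʳ p)) (Fin.toℕ-injective e)

  reflect-< : ∀ p q → (reflect π ⟨$⟩ʳ (σ ⟨$⟩ʳ p) Fin.< reflect π ⟨$⟩ʳ (σ ⟨$⟩ʳ q)) ⇔ (q Fin.< p)
  reflect-< p q = ≡.subst₂ (λ a b → (a Fin.< b) ⇔ (q Fin.< p)) (≡.sym (reflect-σ p)) (≡.sym (reflect-σ q)) opposite-<⇔

  IsLMax-reflect : ∀ p → IsLMax (reflect π) (σ ⟨$⟩ʳ p) ⇔ IsLMax π p
  IsLMax-reflect p = mk⇔
    (λ h q → contraposition injective λ l → to (reflect-< q p) (h (σ ⟨$⟩ʳ q) (from opposite-<⇔ l)))
    (λ h → from (∀-σ {λ j → j Fin.< σ ⟨$⟩ʳ p → reflect π ⟨$⟩ʳ j Fin.< reflect π ⟨$⟩ʳ (σ ⟨$⟩ʳ p)}) λ q l →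
      from (reflect-< q p) (contraposition (≡.sym ∘ congruent ∘ ≡.sym) (h q) (to opposite-<⇔ l)))

  IsLMin-reflect : ∀ p → IsLMin (reflect π) (σ ⟨$⟩ʳ p) ⇔ IsRMax π p
  IsLMin-reflect p = mk⇔
    (λ h q → contraposition (≡.sym ∘ injective) λ l → to (reflect-< p q) (h (σ ⟨$⟩ʳ q) (from opposite-<⇔ l)))
    (λ h → from (∀-σ {λ j → j Fin.< σ ⟨$⟩ʳ p → reflect π ⟨$⟩ʳ (σ ⟨$⟩ʳ p) Fin.< reflect π ⟨$⟩ʳ j}) λ q l →
      from (reflect-< p q) (contraposition (≡.sym ∘ congruent) (h q) (to opposite-<⇔ l)))

  IsRMax-reflect : ∀ p → IsRMax (reflect π) (σ ⟨$⟩ʳ p) ⇔ IsLMin π p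
  IsRMax-reflect p = mk⇔
    (λ h q → contraposition (≡.sym ∘ injective) λ l → to (reflect-< q p) (h (σ ⟨$⟩ʳ q) (from opposite-<⇔ l)))
    (λ h → from (∀-σ {λ j → σ ⟨$⟩ʳ p Fin.< j → reflect π ⟨$⟩ʳ j Fin.< reflect π ⟨$⟩ʳ (σ ⟨$⟩ʳ p)}) λ q l →
      from (reflect-< q p) (contraposition (≡.sym ∘ congruent) (h q) (to opposite-<⇔ l)))

  count-σ : ∀ {P Q : Fin n → Set} (P? : Decidable P) (Q? : Decidable Q) →
    (∀ p → P (σ ⟨$⟩ʳ p) ⇔ Q p) → count P? ≡ count Q?
  count-σ P? Q? h = ≡.trans (count-sum P?) (≡.trans (sum-permute (λ i → 𝟙 (P? i)) σ)
    (≡.trans (sum-cong-≗ λ p → 𝟙-cong {a? = P? (σ ⟨$⟩ʳ p)} {Q? p} (h p)) (≡.sym (count-sum Q?))))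

  lmax-reflect : lmax (reflect π) ≡ lmax π
  lmax-reflect = count-σ (isLMax? (reflect π)) (isLMax? π) IsLMax-reflect

  lmin-reflect : lmin (reflect π) ≡ rmax π
  lmin-reflect = count-σ (isLMin? (reflect π)) (isRMax? π) IsLMin-reflect

  rmax-reflect : rmax (reflect π) ≡ lmin π
  rmax-reflect = count-σ (isRMax? (reflect π)) (isLMin? π) IsRMax-reflect

opposite-inject₁ : (i : Fin n) → opposite (inject₁ i) ≡ suc (opposite i)
opposite-inject₁ zero    = ≡.refl
opposite-inject₁ (suc i) = ≡.cong inject₁ (opposite-inject₁ i)

-- The reversal of positions and the reversal of values each flip the comparison, so a descent of
-- the inverse remains a descent.
des-reflect : (π : Permutation′ n) → des (reflect π) ≡ ides π
des-reflect {zero}  π = ≡.refl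
des-reflect {suc m} π = ≡.trans (count-sum (isDescent? (reflect π))) (≡.trans
  (sum-permute (λ i → 𝟙 (isDescent? (reflect π) i)) Perm.reverse)
  (≡.trans (sum-cong-≗ λ k → 𝟙-cong {a? = isDescent? (reflect π) (opposite k)} {isDescent? (Perm.flip π) k}
      (≡.subst₂ (λ a b → (reflect π ⟨$⟩ʳ suc (opposite k) Fin.< reflect π ⟨$⟩ʳ inject₁ (opposite k)) ⇔ (π ⟨$⟩ˡ a Fin.< π ⟨$⟩ˡ b))
        (≡.trans (opposite-inject₁ (opposite k)) (≡.cong suc (Fin.opposite-involutive k)))
        (≡.cong inject₁ (Fin.opposite-involutive k))
        opposite-<⇔))
    (≡.sym (count-sum (isDescent? (Perm.flip π))))))

_≟ₚ_ : (π ρ : Permutation′ n) → Dec (π Perm.≈ ρ)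
π ≟ₚ ρ = Fin.all? λ i → π ⟨$⟩ʳ i Fin.≟ ρ ⟨$⟩ʳ i

module ListSums {c ℓ} (R : CommutativeRing c ℓ) where
  open CommutativeRing R hiding (zero)
  open RangeSum R
  open Encoding R
  open SetoidReasoning setoid
  open CommutativeSemigroupProperties +-commutativeSemigroup using (interchange)

  sumL : ∀ {a} {A : Set a} → (A → Carrier) → List A → Carrier
  sumL f xs = foldr _+_ 0# (map f xs)

  sumL-cong : ∀ {a} {A : Set a} {f g : A → Carrier} xs → (∀ x → f x ≈ g x) → sumL f xs ≈ sumL g xs
  sumL-cong []       h = refl
  sumL-cong (x ∷ xs) h = +-cong (h x) (sumL-cong xs h)

  sumL-++ : ∀ {a} {A : Set a} (f : A → Carrier) xs ys → sumL f (xs ++ ys) ≈ sumL f xs + sumL f ys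
  sumL-++ f []       ys = sym (+-identityˡ _)
  sumL-++ f (x ∷ xs) ys = trans (+-congˡ (sumL-++ f xs ys)) (sym (+-assoc _ _ _))

  sumL-map : ∀ {a b} {A : Set a} {B : Set b} (f : B → Carrier) (g : A → B) xs → sumL f (map g xs) ≡ sumL (f ∘ g) xs
  sumL-map f g []       = ≡.refl
  sumL-map f g (x ∷ xs) = ≡.cong (f (g x) +_) (sumL-map f g xs)

  sumL-0 : ∀ {a} {A : Set a} (xs : List A) → sumL (λ _ → 0#) xs ≈ 0#
  sumL-0 []       = refl
  sumL-0 (x ∷ xs) = trans (+-identityˡ _) (sumL-0 xs)

  sumL-+ : ∀ {a} {A : Set a} (f g : A → Carrier) xs → sumL (λ x → f x + g x) xs ≈ sumL f xs + sumL g xs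
  sumL-+ f g []       = sym (+-identityˡ 0#)
  sumL-+ f g (x ∷ xs) = trans (+-congˡ (sumL-+ f g xs)) (interchange _ _ _ _)

  sumL-comm : ∀ {a b} {A : Set a} {B : Set b} (f : A → B → Carrier) xs ys →
    sumL (λ x → sumL (f x) ys) xs ≈ sumL (λ y → sumL (λ x → f x y) xs) ys
  sumL-comm f []       ys = sym (sumL-0 ys)
  sumL-comm f (x ∷ xs) ys = trans (+-congˡ (sumL-comm f xs ys)) (sym (sumL-+ (f x) _ ys))

  sumL-cartesianProductWith : ∀ {a b d} {A : Set a} {B : Set b} {D : Set d} (f : D → Carrier) (g : A → B → D) xs ys →
    sumL f (cartesianProductWith g xs ys) ≈ sumL (λ x → sumL (f ∘ g x) ys) xs
  sumL-cartesianProductWith f g []       ys = refl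
  sumL-cartesianProductWith f g (x ∷ xs) ys = trans (sumL-++ f (map (g x) ys) _)
    (+-cong (reflexive (sumL-map f (g x) ys)) (sumL-cartesianProductWith f g xs ys))

  sumL-tabulate : ∀ {a} {A : Set a} {n} lo (h : A → Carrier) (f : Fin n → A) {k} →
    (∀ i → h (f i) ≈ k (toℕ i ℕ.+ lo)) → sumL h (tabulate f) ≈ ∑ lo n k
  sumL-tabulate {n = zero}  lo h f e = refl
  sumL-tabulate {n = suc n} lo h f {k} e = +-cong (e zero) (sumL-tabulate (suc lo) h (f ∘ suc) λ i →
    trans (e (suc i)) (reflexive (≡.cong k (≡.sym (ℕ.+-suc (toℕ i) lo)))))

  sum-𝔖-codes : ∀ n g → sumL (g ∘ code) (𝔖 n) ≈ sumCodes n g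
  sum-𝔖-codes zero    g = +-identityʳ _
  sum-𝔖-codes (suc n) g = trans (sumL-cartesianProductWith (g ∘ code) (insert zero) (allFin (suc n)) (𝔖 n))
    (sumL-tabulate 0 (λ v → sumL (g ∘ code ∘ insert zero v) (𝔖 n)) (λ i → i) λ v →
      trans (sumL-cong (𝔖 n) λ π → reflexive (≡.cong g (code-insert v π)))
        (trans (sum-𝔖-codes n (g ∘ (toℕ v ∷_)))
          (reflexive (≡.cong (λ k → sumCodes n (g ∘ (k ∷_))) (≡.sym (ℕ.+-identityʳ (toℕ v)))))))

  open Membership using (_∈_)

  private
    select : Permutation′ n → (Permutation′ n → Carrier) → Permutation′ n → Carrier
    select σ g ρ = if does (σ ≟ₚ ρ) then g ρ else 0#

    select-yes : ∀ σ (g : Permutation′ n → Carrier) ρ → σ Perm.≈ ρ → select σ g ρ ≈ g ρ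
    select-yes σ g ρ e rewrite dec-true (σ ≟ₚ ρ) e = refl

    select-no : ∀ σ (g : Permutation′ n → Carrier) ρ → ¬ (σ Perm.≈ ρ) → select σ g ρ ≈ 0#
    select-no σ g ρ e rewrite dec-false (σ ≟ₚ ρ) e = refl

    sum-select-none : ∀ (σ : Permutation′ n) g xs → All (λ ρ → ¬ (σ Perm.≈ ρ)) xs → sumL (select σ g) xs ≈ 0#
    sum-select-none σ g []       []       = refl
    sum-select-none σ g (ρ ∷ xs) (p ∷ ps) = trans (+-cong (select-no σ g ρ p) (sum-select-none σ g xs ps)) (+-identityˡ 0#)

    sum-select : (g : Permutation′ n → Carrier) → (∀ {π ρ} → π Perm.≈ ρ → g π ≈ g ρ) →
      ∀ σ xs → Unique (permutationSetoid n) xs → _∈_ (permutationSetoid n) σ xs → sumL (select σ g) xs ≈ g σ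
    sum-select {n} g g-cong σ (ρ ∷ xs) (u ∷ us) (here e) = trans
      (+-cong (trans (select-yes σ g ρ e) (sym (g-cong e)))
        (sum-select-none σ g xs (All.map (λ ne e′ → ne λ i → ≡.trans (≡.sym (e i)) (e′ i)) u)))
      (+-identityʳ _)
    sum-select {n} g g-cong σ (ρ ∷ xs) (u ∷ us) (there m) = trans
      (+-cong (select-no σ g ρ λ e → absurd e u m) (sum-select g g-cong σ xs us m)) (+-identityˡ _)
      where
      absurd : σ Perm.≈ ρ → ∀ {ys} → All (λ τ → ¬ (ρ Perm.≈ τ)) ys → ¬ (_∈_ (permutationSetoid n) σ ys)
      absurd e (p ∷ _)  (here q)  = p λ i → ≡.trans (≡.sym (e i)) (q i)
      absurd e (_ ∷ ps) (there q) = absurd e ps q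

  -- Both sums equal the sum over all pairs (π, ρ) with `reflect π` ≈ ρ, a relation that is
  -- symmetric because `reflect` is an involution. As `𝔖` lists each permutation once up to
  -- pointwise equality, every inner sum has a single relevant term.
  sum-𝔖-reflect : (g : Permutation′ n → Carrier) → (∀ {π ρ} → π Perm.≈ ρ → g π ≈ g ρ) →
    sumL (g ∘ reflect) (𝔖 n) ≈ sumL g (𝔖 n)
  sum-𝔖-reflect {n} g g-cong = begin
    sumL (g ∘ reflect) (𝔖 n)
      ≈⟨ sumL-cong (𝔖 n) (λ π → sum-select g g-cong (reflect π) (𝔖 n) (𝔖-unique n) (∈-𝔖 (reflect π))) ⟨
    sumL (λ π → sumL (select (reflect π) g) (𝔖 n)) (𝔖 n)
      ≈⟨ sumL-comm (λ π → select (reflect π) g) (𝔖 n) (𝔖 n) ⟩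
    sumL (λ ρ → sumL (λ π → select (reflect π) g ρ) (𝔖 n)) (𝔖 n)
      ≈⟨ sumL-cong (𝔖 n) (λ ρ → sumL-cong (𝔖 n) λ π → reflexive (≡.cong (if_then g ρ else 0#) (does-⇔
           (mk⇔ (adjoint {π} {ρ}) (adjoint {ρ} {π}))
           (reflect π ≟ₚ ρ) (reflect ρ ≟ₚ π)))) ⟩
    sumL (λ ρ → sumL (select (reflect ρ) (λ _ → g ρ)) (𝔖 n)) (𝔖 n)
      ≈⟨ sumL-cong (𝔖 n) (λ ρ → sum-select (λ _ → g ρ) (λ _ → refl) (reflect ρ) (𝔖 n) (𝔖-unique n) (∈-𝔖 (reflect ρ))) ⟩
    sumL g (𝔖 n) ∎
    where
    adjoint : ∀ {π ρ : Permutation′ n} → reflect π Perm.≈ ρ → reflect ρ Perm.≈ π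
    adjoint {π} {ρ} e i = ≡.trans (reflect-cong {π = ρ} {reflect π} (λ i → ≡.sym (e i)) i) (reflect-involutive π i)

des-cong : ∀ {n} {π ρ : Permutation′ n} → π Perm.≈ ρ → des π ≡ des ρ
des-cong {π = π} {ρ} e = ≡.trans (des≡ π) (≡.trans (≡.cong desCode (code-cong {π = π} {ρ} e)) (≡.sym (des≡ ρ)))

lmax-cong : ∀ {n} {π ρ : Permutation′ n} → π Perm.≈ ρ → lmax π ≡ lmax ρ
lmax-cong {π = π} {ρ} e = ≡.trans (lmax≡ π) (≡.trans (≡.cong (lmaxCode 0) (code-cong {π = π} {ρ} e)) (≡.sym (lmax≡ ρ)))

lmin-cong : ∀ {n} {π ρ : Permutation′ n} → π Perm.≈ ρ → lmin π ≡ lmin ρ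
lmin-cong {n} {π} {ρ} e = ≡.trans (lmin≡ π) (≡.trans (≡.cong (lminCode n) (code-cong {π = π} {ρ} e)) (≡.sym (lmin≡ ρ)))

rmax-cong : ∀ {n} {π ρ : Permutation′ n} → π Perm.≈ ρ → rmax π ≡ rmax ρ
rmax-cong {π = π} {ρ} e = ≡.trans (rmax≡ π) (≡.trans (≡.cong rmaxCode (code-cong {π = π} {ρ} e)) (≡.sym (rmax≡ ρ)))

module _ {c ℓ} (S : CommutativeRing c ℓ) where
  open CommutativeRing S hiding (zero)
  open SetoidReasoning setoid

  inverse-of-1- : ∀ a t J → (1# - a * t) * J ≈ 1# → J ≈ 1# + a * (t * J)
  inverse-of-1- a t J e = begin
    J                              ≈⟨ *-identityˡ J ⟨
    1# * J                         ≈⟨ *-congʳ (trans (+-assoc _ _ _) (trans (+-congˡ (-‿inverseˡ _)) (+-identityʳ _))) ⟨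
    (1# - a * t + a * t) * J       ≈⟨ distribʳ J _ _ ⟩
    (1# - a * t) * J + a * t * J   ≈⟨ +-cong e (*-assoc a t J) ⟩
    1# + a * (t * J)               ∎

module Resolvents {c ℓ} (R : CommutativeRing c ℓ) where
  private
    module R = CommutativeRing R
    S = PowerSeries.commutativeRing R
    module S = CommutativeRing S
  open PowerSeries R
  open SeriesCoefficients R
  open Telescoping S (PowerSeries.X R) using (_IsInverseOf1-_)
  open RingProperties R.ring using (-0#≈0#)

  resolventSeries : Series → Series
  resolventSeries a = reciprocal (S.1# S.- a S.* X)

  1-aX≈1 : ∀ a → (S.1# S.- a S.* X) 0 R.≈ R.1#
  1-aX≈1 a = R.trans (R.+-congˡ (R.trans (R.-‿cong (R.trans (S.*-comm a X 0) (X*-zero a))) -0#≈0#)) (R.+-identityʳ _)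

  resolvent-inverse : ∀ a → resolventSeries a IsInverseOf1- a
  resolvent-inverse a = inverse-of-1- S a X (resolventSeries a) (*-reciprocal (S.1# S.- a S.* X) (1-aX≈1 a))

-- Equidistribution as an identity of weighted sums

module _ {c ℓ} (R : CommutativeRing c ℓ) where
  open CommutativeRing R hiding (zero)
  open Encoding R
  open ListSums R
  open RangeSum R
  open Multiplication semiring using (×-homo-+; ×-congʳ) renaming (_×_ to _·_)
  open PowerSeries R using (constant)
  open Resolvents R
  open SetoidReasoning setoid
  open GroupProperties +-group using () renaming (∙-cancelˡ to +-cancelˡ)
  private
    module WA = WordAlgebra (PowerSeries.commutativeRing R) (wordCalculus R)
    module ΣS = RangeSum (PowerSeries.commutativeRing R)
    module S = CommutativeRing (PowerSeries.commutativeRing R)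

  stirling : ∀ (x y w : Carrier) {n} → Permutation′ n → Carrier
  stirling x y w π = monomial R x y w (lmin π) (lmax π) (rmax π)

  D-permutations : ∀ x y w k n → Dₖ R x y w k (suc n) ≈
    sumL (λ π → expansion (des π) (suc n) k · stirling x y w π) (𝔖 (suc n))
  D-permutations x y w k n = begin
    Dₖ R x y w k (suc n)
      ≈⟨ D-codes R x y w k n ⟩
    ∑ 0 (suc n) (λ v → sumCodes n λ p → expansion (desCode (v ∷ p)) (suc (length p)) k · g (v ∷ p))
      -- The value at the empty code is a dummy, since only codes of length n + 1 are summed.
      ≈⟨ sumCodes-cong (suc n) {λ { [] → 0# ; (v ∷ p) → expansion (desCode (v ∷ p)) (suc (length p)) k · g (v ∷ p) }} {f}
           (λ { (v ∷ p) q → reflexive (≡.cong (λ m → expansion (desCode (v ∷ p)) m k · g (v ∷ p)) q) }) ⟩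
    sumCodes (suc n) f
      ≈⟨ sum-𝔖-codes (suc n) f ⟨
    sumL (f ∘ code) (𝔖 (suc n))
      ≈⟨ sumL-cong (𝔖 (suc n)) (λ π → reflexive (≡.cong₂ (λ d m → expansion d (suc n) k · m) (≡.sym (des≡ π))
           (≡.trans (≡.cong₂ (λ i j → monomial R x y w i j (rmaxCode (code π))) (≡.sym (lmin≡ π)) (≡.sym (lmax≡ π)))
             (≡.cong (monomial R x y w (lmin π) (lmax π)) (≡.sym (rmax≡ π)))))) ⟩
    sumL (λ π → expansion (des π) (suc n) k · stirling x y w π) (𝔖 (suc n)) ∎
    where
    g f : List ℕ → Carrier
    g p = monomial R x y w (lminCode (suc n) p) (lmaxCode 0 p) (rmaxCode p)
    f p = expansion (desCode p) (suc n) k · g p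

  Dₖ-sym : ∀ x y w k → Dₖ R x y w k S.≈ Dₖ R x w y k
  Dₖ-sym x y w k = WA.D-sym (λ d → resolventSeries (ΣS.fromℕ d)) (λ N → resolventSeries (ΣS.fromℕ N S.+ constant x))
    (constant x) (λ d → resolvent-inverse (ΣS.fromℕ d)) (λ N → resolvent-inverse (ΣS.fromℕ N S.+ constant x))
    (constant y) (constant w) k

  -- The coefficient of uᵏ in the weighted sum of u^stat/(1 - u)ⁿ over the permutations of size m.
  -- The exponent n is kept apart from m so that it can be lowered to 0.
  expansion-sum : (∀ {n} → Permutation′ n → ℕ) → (x y w : Carrier) → ∀ m n k → Carrier
  expansion-sum stat x y w m n k = sumL (λ π → expansion (stat π) n k · stirling x y w π) (𝔖 m)

  des~ides : ∀ x y w n k → expansion-sum des x y w (suc n) (suc n) k ≈ expansion-sum ides x y w (suc n) (suc n) k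
  des~ides x y w n k = begin
    expansion-sum des x y w (suc n) (suc n) k
      ≈⟨ D-permutations x y w k n ⟨
    Dₖ R x y w k (suc n)
      ≈⟨ Dₖ-sym x y w k (suc n) ⟩
    Dₖ R x w y k (suc n)
      ≈⟨ D-permutations x w y k n ⟩
    expansion-sum des x w y (suc n) (suc n) k
      ≈⟨ sum-𝔖-reflect (λ π → expansion (des π) (suc n) k · stirling x w y π)
           (λ {π} {ρ} → g-cong {π} {ρ}) ⟨
    sumL (λ π → expansion (des (reflect π)) (suc n) k · stirling x w y (reflect π)) (𝔖 (suc n))
      ≈⟨ sumL-cong (𝔖 (suc n)) (λ π → trans
           (reflexive (≡.cong₂ (λ d i → expansion d (suc n) k · i) (des-reflect π)
             (≡.trans (≡.cong₂ (λ i j → monomial R x w y i j (rmax (reflect π))) (lmin-reflect π) (lmax-reflect π))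
               (≡.cong (monomial R x w y (rmax π) (lmax π)) (rmax-reflect π)))))
           (×-congʳ (expansion (ides π) (suc n) k) (rotate _ _ _))) ⟩
    expansion-sum ides x y w (suc n) (suc n) k ∎
    where
    open CommutativeSemigroupProperties *-commutativeSemigroup using (x∙yz≈z∙yx)
    rotate : ∀ a b d → a * (b * d) ≈ d * (b * a)
    rotate = x∙yz≈z∙yx
    g-cong : ∀ {π ρ : Permutation′ (suc n)} → π Perm.≈ ρ →
      expansion (des π) (suc n) k · stirling x w y π ≈ expansion (des ρ) (suc n) k · stirling x w y ρ
    g-cong {π} {ρ} e = reflexive (≡.cong₂ (λ d i → expansion d (suc n) k · i) (des-cong {π = π} {ρ} e)
      (≡.trans (≡.cong₂ (λ i j → monomial R x w y i j (rmax π)) (lmin-cong {π = π} {ρ} e) (lmax-cong {π = π} {ρ} e))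
        (≡.cong (monomial R x w y (lmin ρ) (lmax ρ)) (rmax-cong {π = π} {ρ} e))))

  expansion-sum-suc : ∀ (stat : ∀ {n} → Permutation′ n → ℕ) x y w m n k →
    expansion-sum stat x y w m (suc n) (suc k) ≈
    expansion-sum stat x y w m (suc n) k + expansion-sum stat x y w m n (suc k)
  expansion-sum-suc stat x y w m n k = trans
    (sumL-cong (𝔖 m) λ π → trans (reflexive (≡.cong (_· stirling x y w π) (expansion-suc (stat π) n k)))
      (×-homo-+ (stirling x y w π) (expansion (stat π) (suc n) k) _))
    (sumL-+ _ _ (𝔖 m))

  expansion-sum-0 : ∀ (stat : ∀ {n} → Permutation′ n → ℕ) x y w m n →
    expansion-sum stat x y w m (suc n) 0 ≈ expansion-sum stat x y w m n 0
  expansion-sum-0 stat x y w m n = sumL-cong (𝔖 m) λ π →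
    reflexive (≡.cong (_· stirling x y w π) (expansion-0 (stat π) n))

  -- Each step multiplies by 1 - u, coefficient by coefficient. At exponent 0 the expansion is a
  -- Kronecker delta, so that only permutations with k descents are left.
  des~ides-refined : ∀ x y w m k → expansion-sum des x y w (suc m) 0 k ≈ expansion-sum ides x y w (suc m) 0 k
  des~ides-refined x y w m = descend (suc m) (des~ides x y w m)
    where
    descend : ∀ n → (∀ k → expansion-sum des x y w (suc m) n k ≈ expansion-sum ides x y w (suc m) n k) →
      ∀ k → expansion-sum des x y w (suc m) 0 k ≈ expansion-sum ides x y w (suc m) 0 k
    descend zero    h = h
    descend (suc n) h = descend n λ
      { zero → trans (sym (expansion-sum-0 des x y w (suc m) n)) (trans (h 0) (expansion-sum-0 ides x y w (suc m) n))
      ; (suc k) → +-cancelˡ (expansion-sum ides x y w (suc m) (suc n) k) _ _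
          (trans (+-congʳ (sym (h k))) (trans (sym (expansion-sum-suc des x y w (suc m) n k))
            (trans (h (suc k)) (expansion-sum-suc ides x y w (suc m) n k))))
      }

-- From weighted sums to counts

if-yes : ∀ {a b} {A : Set a} {B : Set b} (a? : Dec A) {s t : B} → A → (if does a? then s else t) ≡ s
if-yes a? {s} {t} p = ≡.cong (if_then s else t) (dec-true a? p)

if-no : ∀ {a b} {A : Set a} {B : Set b} (a? : Dec A) {s t : B} → ¬ A → (if does a? then s else t) ≡ t
if-no a? {s} {t} p = ≡.cong (if_then s else t) (dec-false a? p)

expansion-δ : ∀ d k → expansion d 0 k ≡ (if does (d ≟ k) then 1 else 0)
expansion-δ zero    zero    = ≡.refl
expansion-δ zero    (suc k) = ≡.refl
expansion-δ (suc d) zero    = ≡.refl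
expansion-δ (suc d) (suc k) = expansion-δ d k

module PowersOfX {c ℓ} (R : CommutativeRing c ℓ) where
  private
    module R = CommutativeRing R
    module S = CommutativeRing (PowerSeries.commutativeRing R)
  open PowerSeries R using (X; constant)
  open SeriesCoefficients R
  open Exponentiation S.semiring using (_^_)

  X^-coefficient : ∀ i g n → (X ^ i S.* constant g) n R.≈ (if does (i ≟ n) then g else R.0#)
  X^-coefficient zero    g zero    = S.*-identityˡ (constant g) 0
  X^-coefficient zero    g (suc n) = S.*-identityˡ (constant g) (suc n)
  X^-coefficient (suc i) g n = R.trans (S.*-assoc X (X ^ i) (constant g) n) (shift n)
    where
    shift : ∀ n → (X S.* (X ^ i S.* constant g)) n R.≈ (if does (suc i ≟ n) then g else R.0#)
    shift zero    = X*-zero (X ^ i S.* constant g)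
    shift (suc n) = R.trans (X*-suc (X ^ i S.* constant g) n) (X^-coefficient i g n)

module Extraction {c ℓ} (R₀ : CommutativeRing c ℓ) where
  private
    R₁ = PowerSeries.commutativeRing R₀
    R₂ = PowerSeries.commutativeRing R₁
    R₃ = PowerSeries.commutativeRing R₂
    module R₀ = CommutativeRing R₀
    module R₁ = CommutativeRing R₁
    module R₂ = CommutativeRing R₂
    module R₃ = CommutativeRing R₃
    module P₀ = PowerSeries R₀
    module P₁ = PowerSeries R₁
    module P₂ = PowerSeries R₂
    module E₁ = Exponentiation R₁.semiring
    module E₂ = Exponentiation R₂.semiring
    module E₃ = Exponentiation R₃.semiring
    module C₁ = ConstantSeries R₁
    module C₂ = ConstantSeries R₂
    module L = ListSums R₀
  open Multiplication R₃.semiring using () renaming (_×_ to _·_)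
  open Multiplication R₀.semiring using () renaming (_×_ to _·₀_)
  open ListSums R₃ using (sumL)

  -- Independent variables in nested power series rings, y outermost and w innermost, so that a
  -- coefficient is indexed by the exponents for `lmin`, `lmax`, `rmax` in this order.
  x y w : R₃.Carrier
  x = P₂.constant P₁.X
  y = P₂.X
  w = P₂.constant (P₁.constant P₀.X)

  private
    inner : ℕ → ℕ → R₂.Carrier
    inner j k = P₁.X E₂.^ j R₂.* P₁.constant (P₀.X E₁.^ k)

    x^w^ : ∀ j k → P₂.constant (inner j k) R₃.≈ x E₃.^ j R₃.* w E₃.^ k
    x^w^ j k n = R₂.trans {P₂.constant (inner j k) n} {_} {(x E₃.^ j R₃.* w E₃.^ k) n}
      (C₂.constant-* (P₁.X E₂.^ j) (P₁.constant (P₀.X E₁.^ k)) n)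
      (R₃.*-cong {P₂.constant (P₁.X E₂.^ j)} {x E₃.^ j} {P₂.constant (P₁.constant (P₀.X E₁.^ k))} {w E₃.^ k}
        (C₂.constant-^ P₁.X j) w^ n)
      where
      w^ : P₂.constant (P₁.constant (P₀.X E₁.^ k)) R₃.≈ w E₃.^ k
      w^ n = R₂.trans {P₂.constant (P₁.constant (P₀.X E₁.^ k)) n} {_} {(w E₃.^ k) n}
        (C₂.constant-cong {P₁.constant (P₀.X E₁.^ k)} {P₁.constant P₀.X E₂.^ k} (C₁.constant-^ P₀.X k) n)
        (C₂.constant-^ (P₁.constant P₀.X) k n)

    monomial-constant : ∀ i j k → monomial R₃ x y w i j k R₃.≈ y E₃.^ i R₃.* P₂.constant (inner j k)
    monomial-constant i j k = R₃.*-congˡ {y E₃.^ i} {x E₃.^ j R₃.* w E₃.^ k} {P₂.constant (inner j k)}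
      (λ n → R₂.sym {P₂.constant (inner j k) n} (x^w^ j k n))

    if-R₂ : ∀ β (f : R₂.Carrier) j k → (if β then f else R₂.0#) j k ≡ (if β then f j k else R₀.0#)
    if-R₂ true  f j k = ≡.refl
    if-R₂ false f j k = ≡.refl

    if-R₁ : ∀ β (f : R₁.Carrier) k → (if β then f else R₁.0#) k ≡ (if β then f k else R₀.0#)
    if-R₁ true  f k = ≡.refl
    if-R₁ false f k = ≡.refl

    if-cong : ∀ (b : Bool) {u v} → u R₀.≈ v → (if b then u else R₀.0#) R₀.≈ (if b then v else R₀.0#)
    if-cong true  e = e
    if-cong false e = R₀.refl

    δ : ℕ → ℕ → R₀.Carrier → R₀.Carrier
    δ i n v = if does (i ≟ n) then v else R₀.0#

    coefficient : ∀ i j k i₀ j₀ k₀ → monomial R₃ x y w i j k i₀ j₀ k₀ R₀.≈ δ i i₀ (δ j j₀ (δ k k₀ R₀.1#))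
    coefficient i j k i₀ j₀ k₀ = R₀.trans (monomial-constant i j k i₀ j₀ k₀)
      (R₀.trans (PowersOfX.X^-coefficient R₂ i (inner j k) i₀ j₀ k₀)
        (R₀.trans (R₀.reflexive (if-R₂ (does (i ≟ i₀)) (inner j k) j₀ k₀))
          (if-cong (does (i ≟ i₀))
            (R₀.trans (PowersOfX.X^-coefficient R₁ j (P₀.X E₁.^ k) j₀ k₀)
              (R₀.trans (R₀.reflexive (if-R₁ (does (j ≟ j₀)) (P₀.X E₁.^ k) k₀))
                (if-cong (does (j ≟ j₀))
                  (R₀.trans (R₀.sym (R₁.*-identityʳ (P₀.X E₁.^ k) k₀)) (PowersOfX.X^-coefficient R₀ k R₀.1# k₀))))))))

    sumL-coefficient : ∀ {a} {A : Set a} (f : A → R₃.Carrier) xs i j k →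
      sumL f xs i j k ≡ L.sumL (λ z → f z i j k) xs
    sumL-coefficient f []       i j k = ≡.refl
    sumL-coefficient f (z ∷ xs) i j k = ≡.cong (f z i j k R₀.+_) (sumL-coefficient f xs i j k)

    count-sumL : ∀ {a p} {A : Set a} {P : Pred A p} (P? : Decidable P) xs →
      length (filter P? xs) ·₀ R₀.1# R₀.≈ L.sumL (λ z → if does (P? z) then R₀.1# else R₀.0#) xs
    count-sumL P? [] = R₀.refl
    count-sumL P? (z ∷ xs) with does (P? z)
    ... | true  = R₀.+-congˡ (count-sumL P? xs)
    ... | false = R₀.trans (count-sumL P? xs) (R₀.sym (R₀.+-identityˡ _))

  _≟⁴_ = ≡-dec _≟_ (≡-dec _≟_ (≡-dec _≟_ _≟_))

  private
    ·-coefficient : ∀ n (f : R₃.Carrier) i j k → (n · f) i j k ≡ n ·₀ f i j k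
    ·-coefficient zero    f i j k = ≡.refl
    ·-coefficient (suc n) f i j k = ≡.cong (f i j k R₀.+_) (·-coefficient n f i j k)

    tuple-δ : ∀ s l m r a b c d →
      expansion s 0 a ·₀ δ m c (δ l b (δ r d R₀.1#)) R₀.≈
      (if does ((s , l , m , r) ≟⁴ (a , b , c , d)) then R₀.1# else R₀.0#)
    tuple-δ s l m r a b c d = R₀.trans
      (R₀.reflexive (≡.cong (_·₀ δ m c (δ l b (δ r d R₀.1#))) (expansion-δ s a))) (cases (s ≟ a) (m ≟ c) (l ≟ b) (r ≟ d))
      where
      cases : (s≟a : Dec (s ≡ a)) (m≟c : Dec (m ≡ c)) (l≟b : Dec (l ≡ b)) (r≟d : Dec (r ≡ d)) →
        (if does s≟a then 1 else 0) ·₀ (if does m≟c then if does l≟b then if does r≟d then R₀.1# else R₀.0# else R₀.0# else R₀.0#) R₀.≈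
        (if does ((s , l , m , r) ≟⁴ (a , b , c , d)) then R₀.1# else R₀.0#)
      no-case : ¬ (s , l , m , r) ≡ (a , b , c , d) →
        R₀.0# R₀.≈ (if does ((s , l , m , r) ≟⁴ (a , b , c , d)) then R₀.1# else R₀.0#)
      no-case ¬p = R₀.reflexive (≡.sym (if-no ((s , l , m , r) ≟⁴ (a , b , c , d)) ¬p))
      cases (no ¬p) _ _ _ = no-case λ { ≡.refl → ¬p ≡.refl }
      cases (yes _) (no ¬p) _ _ = R₀.trans (R₀.+-identityʳ _) (no-case λ { ≡.refl → ¬p ≡.refl })
      cases (yes _) (yes _) (no ¬p) _ = R₀.trans (R₀.+-identityʳ _) (no-case λ { ≡.refl → ¬p ≡.refl })
      cases (yes _) (yes _) (yes _) (no ¬p) = R₀.trans (R₀.+-identityʳ _) (no-case λ { ≡.refl → ¬p ≡.refl })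
      cases (yes ≡.refl) (yes ≡.refl) (yes ≡.refl) (yes ≡.refl) = R₀.trans (R₀.+-identityʳ _)
        (R₀.reflexive (≡.sym (if-yes ((s , l , m , r) ≟⁴ (s , l , m , r)) ≡.refl)))

    ·₀-cong : ∀ n {u v} → u R₀.≈ v → n ·₀ u R₀.≈ n ·₀ v
    ·₀-cong zero    e = R₀.refl
    ·₀-cong (suc n) e = R₀.+-cong e (·₀-cong n e)

  attaining : ∀ (stat : ∀ {n} → Permutation′ n → ℕ) n a b c d →
    (# (λ (π : Permutation′ n) → stat π , lmax π , lmin π , rmax π) attaining (a , b , c , d) via _≟⁴_) ·₀ R₀.1# R₀.≈
    expansion-sum R₃ stat x y w n 0 a c b d
  attaining stat n a b c d = R₀.trans (count-sumL (λ π → (stat π , lmax π , lmin π , rmax π) ≟⁴ (a , b , c , d)) (𝔖 n))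
    (R₀.trans (L.sumL-cong (𝔖 n) λ π → R₀.trans (R₀.sym (tuple-δ (stat π) (lmax π) (lmin π) (rmax π) a b c d))
        (R₀.trans (·₀-cong (expansion (stat π) 0 a) (R₀.sym (coefficient (lmin π) (lmax π) (rmax π) c b d)))
          (R₀.reflexive (≡.sym (·-coefficient (expansion (stat π) 0 a) (stirling R₃ x y w π) c b d)))))
      (R₀.reflexive (≡.sym (sumL-coefficient (λ π → expansion (stat π) 0 a · stirling R₃ x y w π) (𝔖 n) c b d))))

  equal-counts : ∀ n a b c d →
    (# (λ (π : Permutation′ (suc n)) → des π , lmax π , lmin π , rmax π) attaining (a , b , c , d) via _≟⁴_) ·₀ R₀.1# R₀.≈
    (# (λ (π : Permutation′ (suc n)) → ides π , lmax π , lmin π , rmax π) attaining (a , b , c , d) via _≟⁴_) ·₀ R₀.1#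
  equal-counts n a b c d = R₀.trans (attaining des (suc n) a b c d)
    (R₀.trans (des~ides-refined R₃ x y w n a c b d) (R₀.sym (attaining ides (suc n) a b c d)))

-- Over ℤ a natural number is determined by the corresponding multiple of 1, so equal coefficients
-- give equal counts.
equidistributed : ∀ n → n ≥ 1 → SameDistribution (≡-dec _≟_ (≡-dec _≟_ (≡-dec _≟_ _≟_)))
  (λ (π : Permutation′ n) → des π , lmax π , lmin π , rmax π)
  (λ π → ides π , lmax π , lmin π , rmax π)
equidistributed (suc n) _ (a , b , c , d) = cancel (Extraction.equal-counts ℤ.+-*-commutativeRing n a b c d)
  where
  open Multiplication (CommutativeRing.semiring ℤ.+-*-commutativeRing) using () renaming (_×_ to _·_)
  ·1 : ∀ n → n · ℤ.1ℤ ≡ ℤ.+ n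
  ·1 zero    = ≡.refl
  ·1 (suc n) = ≡.trans (≡.cong (ℤ._+_ ℤ.1ℤ) (·1 n)) (≡.sym (ℤ.pos-+ 1 n))
  cancel : ∀ {m n} → m · ℤ.1ℤ ≡ n · ℤ.1ℤ → m ≡ n
  cancel {m} {n} e = ℤ.+-injective (≡.trans (≡.sym (·1 m)) (≡.trans e (·1 n)))

-- The generating function

module _ {c ℓ} (S : CommutativeRing c ℓ) where
  open CommutativeRing S hiding (zero)
  open SetoidReasoning setoid
  open RangeSum S using (fromℕ)
  open RawSemiringDefinitions (Semiring.rawSemiring semiring) using (product)
  open MonoidSum *-monoid using () renaming (sum-init-last to product-init-last; sum-cong-≗ to product-cong-≗)
  open SemiringSolver commutativeSemiring using (solve; _:=_; _:+_; _:*_; con)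
  open GroupProperties +-group using () renaming (∙-cancelʳ to +-cancelʳ)

  product-last : ∀ n (f : ℕ → Carrier) → product {suc n} (f ∘ toℕ) ≈ product {n} (f ∘ toℕ) * f n
  product-last n f = trans (product-init-last {n} (f ∘ toℕ)) (*-cong
    (reflexive (product-cong-≗ {n} λ i → ≡.cong f (Fin.toℕ-inject₁ i)))
    (reflexive (≡.cong f (Fin.toℕ-fromℕ n))))

  -- Since 1 - (n + 1 + x) t + (w + x) t = a n, the factor of X at index n + 1 is a n times J (n +
  -- 1): numerators lag one index behind denominators. Completing the product to equal indices costs
  -- the factor a n, which is the denominator in front of the product in the theorem.
  X-product : ∀ t x w (J : ℕ → Carrier) → let open Telescoping S t in
    (∀ N → J N IsInverseOf1- (fromℕ N + x)) → let a = λ n → 1# - (fromℕ n - w + 1#) * t in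
    ∀ n → X x w J n * a n ≈ w * x * t * product {suc n} ((λ i → a i * J i) ∘ toℕ)
  X-product t x w J invJ zero = solve 5 (λ x w t J a → x :* (w :* (t :* J)) :* a :=
    w :* x :* t :* ((a :* J) :* con 1)) refl x w t (J 0) (1# - (0# - w + 1#) * t)
  X-product t x w J invJ (suc n) = begin
    (1# + (w + x) * (t * J′)) * X x w J n * a (suc n)
      ≈⟨ *-congʳ (*-congʳ J′a) ⟨
    J′ * a n * X x w J n * a (suc n)
      ≈⟨ solve 4 (λ J a X b → J :* a :* X :* b := X :* a :* (b :* J)) refl J′ (a n) (X x w J n) (a (suc n)) ⟩
    X x w J n * a n * (a (suc n) * J′)
      ≈⟨ *-congʳ (X-product t x w J invJ n) ⟩
    w * x * t * product {suc n} ((λ i → a i * J i) ∘ toℕ) * (a (suc n) * J′)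
      ≈⟨ *-assoc _ _ _ ⟩
    w * x * t * (product {suc n} ((λ i → a i * J i) ∘ toℕ) * (a (suc n) * J′))
      ≈⟨ *-congˡ (product-last (suc n) (λ i → a i * J i)) ⟨
    w * x * t * product {suc (suc n)} ((λ i → a i * J i) ∘ toℕ) ∎
    where
    open Telescoping S t
    a b : ℕ → Carrier
    b n = fromℕ n - w + 1#
    a n = 1# - b n * t
    J′ = J (suc n)
    a+bt : a n + b n * t ≈ 1#
    a+bt = trans (+-assoc _ _ _) (trans (+-congˡ (-‿inverseˡ _)) (+-identityʳ _))
    b+w : fromℕ (suc n) ≈ b n + w
    b+w = begin
      1# + fromℕ n                ≈⟨ +-identityʳ _ ⟨
      1# + fromℕ n + 0#           ≈⟨ +-congˡ (-‿inverseʳ w) ⟨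
      1# + fromℕ n + (w - w)      ≈⟨ solve 4 (λ o f w v → o :+ f :+ (w :+ v) := f :+ v :+ o :+ w) refl 1# (fromℕ n) w (- w) ⟩
      fromℕ n - w + 1# + w        ∎
    J′a : J′ * a n ≈ 1# + (w + x) * (t * J′)
    J′a = +-cancelʳ (b n * t * J′) _ _ (begin
      J′ * a n + b n * t * J′
        ≈⟨ solve 3 (λ J a bt → J :* a :+ bt :* J := (a :+ bt) :* J) refl J′ (a n) (b n * t) ⟩
      (a n + b n * t) * J′
        ≈⟨ trans (*-congʳ a+bt) (*-identityˡ J′) ⟩
      J′
        ≈⟨ trans (invJ (suc n)) (+-congˡ (*-congʳ (+-congʳ b+w))) ⟩
      1# + (b n + w + x) * (t * J′)
        ≈⟨ solve 5 (λ b w x t J → con 1 :+ (b :+ w :+ x) :* (t :* J) :=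
             con 1 :+ (w :+ x) :* (t :* J) :+ b :* t :* J) refl (b n) w x t J′ ⟩
      1# + (w + x) * (t * J′) + b n * t * J′ ∎)

  divide : ∀ {X a r k p} → a * r ≈ 1# → X * a ≈ k * p → X ≈ (k * r) * p
  divide {X} {a} {r} {k} {p} inv e = begin
    X             ≈⟨ *-identityʳ X ⟨
    X * 1#        ≈⟨ *-congˡ inv ⟨
    X * (a * r)   ≈⟨ *-assoc X a r ⟨
    X * a * r     ≈⟨ *-congʳ e ⟩
    k * p * r     ≈⟨ solve 3 (λ k p r → k :* p :* r := (k :* r) :* p) refl k p r ⟩
    (k * r) * p   ∎

  ∑-select : ∀ lo n j (g : ℕ → Carrier) → let open RangeSum S in
    (j ℕ.< lo → ∑ lo n (λ i → if does (i ≟ j) then g i else 0#) ≈ 0#) ×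
    (lo ≤ j → j ℕ.< n ℕ.+ lo → ∑ lo n (λ i → if does (i ≟ j) then g i else 0#) ≈ g j)
  ∑-select lo zero    j g = (λ _ → refl) , λ l u → contradiction u (ℕ.≤⇒≯ l)
  ∑-select lo (suc n) j g = (λ l → trans (+-cong (reflexive (if-no (lo ≟ j) λ { ≡.refl → ℕ.<-irrefl ≡.refl l }))
      (proj₁ (∑-select (suc lo) n j g) (ℕ.m<n⇒m<1+n l))) (+-identityˡ 0#))
    , in-range
    where
    open RangeSum S
    in-range : lo ≤ j → j ℕ.< suc n ℕ.+ lo → ∑ lo (suc n) (λ i → if does (i ≟ j) then g i else 0#) ≈ g j
    in-range l u with ℕ.m≤n⇒m<n∨m≡n l
    ... | inj₁ l< = trans (+-cong (reflexive (if-no (lo ≟ j) λ { ≡.refl → ℕ.<-irrefl ≡.refl l< }))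
      (proj₂ (∑-select (suc lo) n j g) l< (≡.subst (j ℕ.<_) (≡.sym (ℕ.+-suc n lo)) u))) (+-identityˡ _)
    ... | inj₂ ≡.refl = trans (+-cong (reflexive (if-yes (lo ≟ lo) ≡.refl))
      (proj₁ (∑-select (suc lo) n lo g) ℕ.≤-refl)) (+-identityʳ _)

module _ {c ℓ} (V : CommutativeRing c ℓ) where
  open CommutativeRing V hiding (zero)
  open RingProperties ring using (-‿distribˡ-*; -‿distribʳ-*)

  1-x*f : ∀ x f → (1# - x) * f ≈ f + x * (- f)
  1-x*f x f = trans (distribʳ f 1# _) (+-cong (*-identityˡ f)
    (trans (sym (-‿distribˡ-* x f)) (-‿distribʳ-* x f)))

  *-absorb : ∀ a p e e′ → a * e ≈ e′ → (a * p) * e ≈ p * e′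
  *-absorb a p e e′ h = trans (*-congʳ (*-comm a p)) (trans (*-assoc p a e) (*-congˡ h))

  transpose-* : ∀ p e x r → p * e ≈ x → p * r ≈ 1# → x * r ≈ e
  transpose-* p e x r h inv = trans (*-congʳ (trans (sym h) (*-comm p e)))
    (trans (*-assoc e p r) (trans (*-congˡ inv) (*-identityʳ e)))

-- The expansion of uˢ/(1 - u)ⁿ

module GeometricSeries {c ℓ} (T : CommutativeRing c ℓ) where
  private
    module T = CommutativeRing T
    U = PowerSeries.commutativeRing T
    module U = CommutativeRing U
  open PowerSeries T using (Series; X; reciprocal; *-reciprocal; _≋_)
  open SeriesCoefficients T
  open Exponentiation U.semiring using (_^_)
  open Multiplication T.semiring using (×-homo-+) renaming (_×_ to _·_)
  open RingProperties T.ring using (-0#≈0#)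

  expansionSeries : ℕ → ℕ → Series
  expansionSeries s n k = expansion s n k · T.1#

  1-X : Series
  1-X = U.1# U.- X

  1-X-suc : ∀ s n → 1-X U.* expansionSeries s (suc n) ≋ expansionSeries s n
  1-X-suc s n k = T.trans (expand k) (coefficient k)
    where
    f = expansionSeries s (suc n)
    expand : 1-X U.* f ≋ f U.+ X U.* (U.- f)
    expand = 1-x*f U X f
    coefficient : ∀ k → (f U.+ X U.* (U.- f)) k T.≈ expansionSeries s n k
    coefficient zero    = T.trans (+X*-zero f (U.- f)) (T.reflexive (≡.cong (_· T.1#) (expansion-0 s n)))
    coefficient (suc k) = T.trans (+X*-suc f (U.- f) k) (T.trans
      (T.+-congʳ (T.trans (T.reflexive (≡.cong (_· T.1#) (expansion-suc s n k))) (×-homo-+ T.1# (expansion s (suc n) k) _)))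
      (T.trans (T.+-congʳ (T.+-comm _ _)) (T.trans (T.+-assoc _ _ _)
        (T.trans (T.+-congˡ (T.-‿inverseʳ _)) (T.+-identityʳ _)))))

  1-X^ : ∀ s n → (1-X ^ n) U.* expansionSeries s n ≋ X ^ s
  1-X^ s zero k = T.trans (U.*-identityˡ (expansionSeries s 0) k) (T.trans
    (T.trans (T.reflexive (≡.cong (_· T.1#) (expansion-δ s k))) (indicator (s ≟ k)))
    (T.trans (T.sym (PowersOfX.X^-coefficient T s T.1# k)) (U.*-identityʳ (X ^ s) k)))
    where
    indicator : ∀ {a} {A : Set a} (d : Dec A) → (if does d then 1 else 0) · T.1# T.≈ (if does d then T.1# else T.0#)
    indicator (yes _) = T.+-identityʳ _
    indicator (no  _) = T.refl
  1-X^ s (suc n) k = T.trans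
    (*-absorb U 1-X (1-X ^ n) (expansionSeries s (suc n)) (expansionSeries s n) (1-X-suc s n) k) (1-X^ s n k)

  1-X^-constant : ∀ n → (1-X ^ n) 0 T.≈ T.1#
  1-X^-constant zero    = T.refl
  1-X^-constant (suc n) = T.trans (T.+-identityʳ _) (T.trans
    (T.*-cong (T.trans (T.+-congˡ -0#≈0#) (T.+-identityʳ _)) (1-X^-constant n)) (T.*-identityˡ _))

  X^/1-X^ : ∀ s n → (X ^ s) U.* reciprocal (1-X ^ n) ≋ expansionSeries s n
  X^/1-X^ s n = transpose-* U (1-X ^ n) (expansionSeries s n) (X ^ s) (reciprocal (1-X ^ n)) (1-X^ s n)
    (*-reciprocal (1-X ^ n) (1-X^-constant n))

module _ {c ℓ} (V : CommutativeRing c ℓ) where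
  open CommutativeRing V hiding (zero)
  open SemiringSolver commutativeSemiring using (solve; _:=_; _:*_)

  collect : ∀ u z q t r {e z′ q′ s} → u * r ≈ e → z ≈ z′ → q ≈ q′ → z′ * q′ * t ≈ s →
    u * z * q * t * r ≈ e * s
  collect u z q t r h hz hq hs = trans (*-congʳ (*-congʳ (*-cong (*-congˡ hz) hq)))
    (trans (solve 5 (λ u z q t r → u :* z :* q :* t :* r := (u :* r) :* (z :* q :* t)) refl u _ _ t r)
      (*-cong h hs))

-- Comparison of the coefficients of both sides

module Coefficients {c ℓ} (R : CommutativeRing c ℓ) (z q : CommutativeRing.Carrier R) where
  open GeneratingFunction R z q
  private
    T = R⟦t⟧.commutativeRing
    U = R⟦t⟧⟦u⟧.commutativeRing
    module T = CommutativeRing T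
    module U = CommutativeRing U
    module EU = Exponentiation U.semiring
    module ET = Exponentiation T.semiring
    module ER = Exponentiation R.semiring
    module CT = ConstantSeries T
    module CR = ConstantSeries R
    module MT = Multiplication T.semiring
    module MR = Multiplication R.semiring
    module LU = ListSums U
    module LR = ListSums R
    module ΣR = RangeSum R
    module ΣT = RangeSum T
    module G = GeometricSeries T
    module WA = WordAlgebra T (wordCalculus R)
    module SU = SemiringSum U.semiring
  open SetoidReasoning R.setoid

  vector-sum : ∀ lo n (F : Fin n → R⟦t⟧⟦u⟧.Series) k m {g} → (∀ i → F i k m R.≈ g (toℕ i ℕ.+ lo)) →
    SU.sum F k m R.≈ ΣR.∑ lo n g
  vector-sum lo zero    F k m h = R.refl
  vector-sum lo (suc n) F k m {g} h = R.+-cong (h zero) (vector-sum (suc lo) n (F ∘ suc) k m λ i →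
    R.trans (h (suc i)) (R.reflexive (≡.cong g (≡.sym (ℕ.+-suc (toℕ i) lo)))))

  private
    t^n : ℕ → ℕ → ℕ → R⟦t⟧.Series
    t^n l i n = R⟦t⟧.constant (z ER.^ l R.* q ER.^ i) T.* R⟦t⟧.X ET.^ n

    constants : ∀ l i n →
      R⟦t⟧⟦u⟧.constant (R⟦t⟧.constant (z ER.^ l)) U.* R⟦t⟧⟦u⟧.constant (R⟦t⟧.constant (q ER.^ i))
        U.* R⟦t⟧⟦u⟧.constant R⟦t⟧.X EU.^ n U.≈ R⟦t⟧⟦u⟧.constant (t^n l i n)
    constants l i n k = T.trans
      (U.*-cong {Z U.* Q} {R⟦t⟧⟦u⟧.constant (R⟦t⟧.constant (z ER.^ l R.* q ER.^ i))} {R⟦t⟧⟦u⟧.constant R⟦t⟧.X EU.^ n} {R⟦t⟧⟦u⟧.constant (R⟦t⟧.X ET.^ n)}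
        (λ k → T.sym {R⟦t⟧⟦u⟧.constant (R⟦t⟧.constant (z ER.^ l R.* q ER.^ i)) k} {(Z U.* Q) k}
          (T.trans {R⟦t⟧⟦u⟧.constant (R⟦t⟧.constant (z ER.^ l R.* q ER.^ i)) k} {_} {(Z U.* Q) k}
          (CT.constant-cong {R⟦t⟧.constant (z ER.^ l R.* q ER.^ i)} {R⟦t⟧.constant (z ER.^ l) T.* R⟦t⟧.constant (q ER.^ i)}
            (CR.constant-* (z ER.^ l) (q ER.^ i)) k)
          (CT.constant-* (R⟦t⟧.constant (z ER.^ l)) (R⟦t⟧.constant (q ER.^ i)) k)))
        (λ k → T.sym {R⟦t⟧⟦u⟧.constant (R⟦t⟧.X ET.^ n) k} {(R⟦t⟧⟦u⟧.constant R⟦t⟧.X EU.^ n) k} (CT.constant-^ R⟦t⟧.X n k)) k)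
      (T.sym {R⟦t⟧⟦u⟧.constant (t^n l i n) k} (CT.constant-* (R⟦t⟧.constant (z ER.^ l R.* q ER.^ i)) (R⟦t⟧.X ET.^ n) k))
      where
      Z = R⟦t⟧⟦u⟧.constant (R⟦t⟧.constant (z ER.^ l))
      Q = R⟦t⟧⟦u⟧.constant (R⟦t⟧.constant (q ER.^ i))

    constant-power : ∀ x l → R⟦t⟧⟦u⟧.constant (R⟦t⟧.constant x) EU.^ l U.≈ R⟦t⟧⟦u⟧.constant (R⟦t⟧.constant (x ER.^ l))
    constant-power x l k = T.sym {R⟦t⟧⟦u⟧.constant (R⟦t⟧.constant (x ER.^ l)) k} {(R⟦t⟧⟦u⟧.constant (R⟦t⟧.constant x) EU.^ l) k}
      (T.trans {R⟦t⟧⟦u⟧.constant (R⟦t⟧.constant (x ER.^ l)) k} {_} {(R⟦t⟧⟦u⟧.constant (R⟦t⟧.constant x) EU.^ l) k}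
        (CT.constant-cong {R⟦t⟧.constant (x ER.^ l)} {R⟦t⟧.constant x ET.^ l} (CR.constant-^ x l) k)
        (CT.constant-^ (R⟦t⟧.constant x) l k))

    ·-coefficient : ∀ n (f : R⟦t⟧.Series) m → (n MT.× f) m ≡ n MR.× f m
    ·-coefficient zero    f m = ≡.refl
    ·-coefficient (suc n) f m = ≡.cong (f m R.+_) (·-coefficient n f m)

    ·-if : ∀ n (β : Bool) {x y} → x R.≈ y → n MR.× (if β then x else R.0#) R.≈ (if β then n MR.× y else R.0#)
    ·-if n true  e = MR.×-congʳ n e
    ·-if zero    false e = R.refl
    ·-if (suc n) false {x} e = R.trans (R.+-identityˡ _) (·-if n false {x} e)

    1^ : ∀ n → R.1# ER.^ n R.≈ R.1#
    1^ zero    = R.refl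
    1^ (suc n) = R.trans (R.*-identityˡ _) (1^ n)

  lhsSummand : (stat : ∀ {n} → Permutation′ n → ℕ) → ∀ n → Permutation′ n → R⟦t⟧⟦u⟧.Series
  lhsSummand stat n π = R⟦t⟧⟦u⟧.X EU.^ stat π U.* R⟦t⟧⟦u⟧.constant (R⟦t⟧.constant z) EU.^ lmax π
    U.* R⟦t⟧⟦u⟧.constant (R⟦t⟧.constant q) EU.^ lmin π U.* R⟦t⟧⟦u⟧.constant R⟦t⟧.X EU.^ n
    U.* R⟦t⟧⟦u⟧.reciprocal ((U.1# U.- R⟦t⟧⟦u⟧.X) EU.^ n)

  lhsSummand-coefficient : ∀ (stat : ∀ {n} → Permutation′ n → ℕ) n π k m → lhsSummand stat n π k m R.≈
    (if does (n ≟ m) then expansion (stat π) n k MR.× stirling R z q R.1# π else R.0#)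
  lhsSummand-coefficient stat n π k m = begin
    lhsSummand stat n π k m
      ≈⟨ collect U (R⟦t⟧⟦u⟧.X EU.^ stat π) (R⟦t⟧⟦u⟧.constant (R⟦t⟧.constant z) EU.^ lmax π)
           (R⟦t⟧⟦u⟧.constant (R⟦t⟧.constant q) EU.^ lmin π) (R⟦t⟧⟦u⟧.constant R⟦t⟧.X EU.^ n)
           (R⟦t⟧⟦u⟧.reciprocal ((U.1# U.- R⟦t⟧⟦u⟧.X) EU.^ n))
           {G.expansionSeries (stat π) n} {R⟦t⟧⟦u⟧.constant (R⟦t⟧.constant (z ER.^ lmax π))}
           {R⟦t⟧⟦u⟧.constant (R⟦t⟧.constant (q ER.^ lmin π))} {R⟦t⟧⟦u⟧.constant s}
           (G.X^/1-X^ (stat π) n) (constant-power z (lmax π)) (constant-power q (lmin π))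
           (constants (lmax π) (lmin π) n) k m ⟩
    (G.expansionSeries (stat π) n U.* R⟦t⟧⟦u⟧.constant s) k m
      ≈⟨ U.*-comm (G.expansionSeries (stat π) n) (R⟦t⟧⟦u⟧.constant s) k m ⟩
    (R⟦t⟧⟦u⟧.constant s U.* G.expansionSeries (stat π) n) k m
      ≈⟨ SeriesCoefficients.constant-*-coefficient T s (G.expansionSeries (stat π) n) k m ⟩
    (s T.* (N MT.× T.1#)) m
      ≈⟨ MT.×-comm-* N s T.1# m ⟩
    (N MT.× (s T.* T.1#)) m
      ≡⟨ ·-coefficient N (s T.* T.1#) m ⟩
    N MR.× (s T.* T.1#) m
      ≈⟨ MR.×-congʳ N (R.trans (T.*-identityʳ s m) (R.trans
           (T.*-comm (R⟦t⟧.constant (z ER.^ lmax π R.* q ER.^ lmin π)) (R⟦t⟧.X ET.^ n) m)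
           (PowersOfX.X^-coefficient R n (z ER.^ lmax π R.* q ER.^ lmin π) m))) ⟩
    N MR.× (if does (n ≟ m) then z ER.^ lmax π R.* q ER.^ lmin π else R.0#)
      ≈⟨ ·-if N (does (n ≟ m)) (R.trans (R.*-comm _ _) (R.*-congˡ
           (R.trans (R.sym (R.*-identityʳ _)) (R.*-congˡ (R.sym (1^ (rmax π))))))) ⟩
    (if does (n ≟ m) then N MR.× stirling R z q R.1# π else R.0#) ∎
    where
    N = expansion (stat π) n k
    s = t^n (lmax π) (lmin π) n

  lhsTerm-coefficient : ∀ (stat : ∀ {n} → Permutation′ n → ℕ) n k m → lhsTerm stat n k m R.≈
    (if does (n ≟ m) then expansion-sum R stat z q R.1# n n k else R.0#)
  lhsTerm-coefficient stat n k m = R.trans (R.reflexive (sumL-coefficient (𝔖 n)))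
    (R.trans (LR.sumL-cong (𝔖 n) λ π → lhsSummand-coefficient stat n π k m) (sumL-if (does (n ≟ m))))
    where
    sumL-coefficient : ∀ xs → LU.sumL (lhsSummand stat n) xs k m ≡ LR.sumL (λ π → lhsSummand stat n π k m) xs
    sumL-coefficient []       = ≡.refl
    sumL-coefficient (π ∷ xs) = ≡.cong (lhsSummand stat n π k m R.+_) (sumL-coefficient xs)
    sumL-if : ∀ β → LR.sumL (λ π → if β then expansion (stat π) n k MR.× stirling R z q R.1# π else R.0#) (𝔖 n) R.≈
      (if β then expansion-sum R stat z q R.1# n n k else R.0#)
    sumL-if true  = R.refl
    sumL-if false = LR.sumL-0 (𝔖 n)

  rhsTerm-coefficient : ∀ n k m → rhsTerm n k m R.≈ (if does (n ≟ k) then rhsCoefficient n m else R.0#)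
  rhsTerm-coefficient n k m = R.trans
    (U.*-comm (R⟦t⟧⟦u⟧.constant (rhsCoefficient n)) (R⟦t⟧⟦u⟧.X EU.^ n) k m)
    (R.trans (PowersOfX.X^-coefficient T n (rhsCoefficient n) k m) (if-app (does (n ≟ k))))
    where
    if-app : ∀ β → (if β then rhsCoefficient n else T.0#) m R.≈ (if β then rhsCoefficient n m else R.0#)
    if-app true  = R.refl
    if-app false = R.refl

  private
    q′ z′ : R⟦t⟧.Series
    q′ = R⟦t⟧.constant q
    z′ = R⟦t⟧.constant z

    J : ℕ → R⟦t⟧.Series
    J N = Resolvents.resolventSeries R (ΣT.fromℕ N T.+ z′)

    numerator : R⟦t⟧.Series → R⟦t⟧.Series
    numerator f = T.1# T.- (f T.- q′ T.+ T.1#) T.* R⟦t⟧.X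

    open RawSemiringDefinitions (Semiring.rawSemiring T.semiring) using (product)

    fromℕ≡ : ∀ n → n MT.× T.1# ≡ ΣT.fromℕ n
    fromℕ≡ zero    = ≡.refl
    fromℕ≡ (suc n) = ≡.cong (T.1# T.+_) (fromℕ≡ n)

    rhsCoefficient≡ : ∀ n → rhsCoefficient n ≡
      (q′ T.* z′ T.* R⟦t⟧.X T.* R⟦t⟧.reciprocal (numerator (ΣT.fromℕ n)))
        T.* product {suc n} ((λ i → numerator (ΣT.fromℕ i) T.* J i) ∘ toℕ)
    rhsCoefficient≡ n = ≡.cong₂ (λ f p → (q′ T.* z′ T.* R⟦t⟧.X T.* R⟦t⟧.reciprocal (numerator f)) T.* p)
      (fromℕ≡ n)
      (MonoidSum.sum-cong-≗ T.*-monoid {suc n} λ i → ≡.cong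
        (λ f → numerator f T.* Resolvents.resolventSeries R (f T.+ z′)) (fromℕ≡ (toℕ i)))

  D-rhs : ∀ k → Dₖ R z q R.1# k T.≈ rhsCoefficient k
  -- q marks `lmin` and so stands at y, whereas the product formula needs y = 1; the symmetry moves
  -- q to w.
  D-rhs k m = R.trans (Dₖ-sym R z q R.1# k m) (R.trans
    (WA.D-product (λ d → Resolvents.resolventSeries R (ΣT.fromℕ d)) J z′
      (λ d → Resolvents.resolvent-inverse R (ΣT.fromℕ d)) invJ q′ k m)
    (R.trans (divide T {X} {a} {r} {q′ T.* z′ T.* R⟦t⟧.X} {p}
        (R⟦t⟧.*-reciprocal a (Resolvents.1-aX≈1 R (ΣT.fromℕ k T.- q′ T.+ T.1#)))
        (X-product T R⟦t⟧.X z′ q′ J invJ k) m)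
      (R.reflexive (≡.cong (λ f → f m) (≡.sym (rhsCoefficient≡ k))))))
    where
    X = Telescoping.X T R⟦t⟧.X z′ q′ J k
    a = numerator (ΣT.fromℕ k)
    r = R⟦t⟧.reciprocal a
    p = product {suc k} ((λ i → numerator (ΣT.fromℕ i) T.* J i) ∘ toℕ)
    invJ : ∀ N → Telescoping._IsInverseOf1-_ T R⟦t⟧.X (J N) (ΣT.fromℕ N T.+ z′)
    invJ N = Resolvents.resolvent-inverse R (ΣT.fromℕ N T.+ z′)

  private
    series : R⟦t⟧⟦u⟧.Series
    series k m = rhsCoefficient k m

  rhs-sums : rhsTerm SumsTo series
  rhs-sums k m = suc k , λ n k<n → R.trans
    (vector-sum 0 n (λ i → rhsTerm (toℕ i)) k m λ i → R.reflexive (≡.cong (λ j → rhsTerm j k m) (≡.sym (ℕ.+-identityʳ (toℕ i)))))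
    (R.trans (ΣR.∑-cong 0 n λ i → rhsTerm-coefficient i k m)
      (proj₂ (∑-select R 0 n k (λ i → rhsCoefficient i m)) z≤n (≡.subst (k ℕ.<_) (≡.sym (ℕ.+-identityʳ n)) k<n)))

  -- Permutations of size n contribute to tⁿ only, so the coefficient of tᵐ is final as soon as size
  -- m is included.
  lhs-sums : (stat : ∀ {n} → Permutation′ n → ℕ) →
    (∀ n k → expansion-sum R stat z q R.1# (suc n) (suc n) k R.≈ Dₖ R z q R.1# k (suc n)) →
    (λ n → lhsTerm stat (suc n)) SumsTo series
  lhs-sums stat h k m = m , λ n m≤n → R.trans
    (vector-sum 1 n (λ i → lhsTerm stat (suc (toℕ i))) k m {λ i → lhsTerm stat i k m} λ i →
      R.reflexive (≡.cong (λ j → lhsTerm stat j k m) (ℕ.+-comm 1 (toℕ i))))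
    (R.trans (ΣR.∑-cong 1 n λ i → lhsTerm-coefficient stat i k m) (limit n m m≤n))
    where
    limit : ∀ n m → m ≤ n →
      ΣR.∑ 1 n (λ i → if does (i ≟ m) then expansion-sum R stat z q R.1# i i k else R.0#) R.≈ rhsCoefficient k m
    -- The sum starts at size 1; this agrees with the right hand side because Dₖ has no constant
    -- term in t.
    limit n zero    _   = R.trans (proj₁ (∑-select R 1 n 0 (λ i → expansion-sum R stat z q R.1# i i k)) (s≤s z≤n))
      (R.trans (R.sym (Dₖ-zero R z q R.1# k)) (D-rhs k 0))
    limit n (suc m) m≤n = R.trans
      (proj₂ (∑-select R 1 n (suc m) (λ i → expansion-sum R stat z q R.1# i i k)) (s≤s z≤n)
        (≡.subst (suc m ℕ.<_) (ℕ.+-comm 1 n) (s≤s m≤n)))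
      (R.trans (h m k) (D-rhs k (suc m)))

  generating-function : ∃[ s ] ((λ n → lhsTerm des (suc n)) SumsTo s)
    × ((λ n → lhsTerm ides (suc n)) SumsTo s)
    × (rhsTerm SumsTo s)
  generating-function = series
    , lhs-sums des (λ n k → R.sym (D-permutations R z q R.1# k n))
    , lhs-sums ides (λ n k → R.trans (R.sym (des~ides R z q R.1# n k)) (R.sym (D-permutations R z q R.1# k n)))
    , rhs-sums

theorem5 : ∀ {c ℓ : Level} (R : CommutativeRing c ℓ) (z q : CommutativeRing.Carrier R) →
    let open GeneratingFunction R z q in
    (∃[ s ] ((λ n → lhsTerm des (suc n)) SumsTo s)
    × ((λ n → lhsTerm ides (suc n)) SumsTo s)
    × (rhsTerm SumsTo s))
    ×
    (∀ n → n ≥ 1 →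
    SameDistribution (≡-dec _≟_ (≡-dec _≟_ (≡-dec _≟_ _≟_)))
    (λ (π : Permutation′ n) → des π , lmax π , lmin π , rmax π)
    (λ π → ides π , lmax π , lmin π , rmax π))
theorem5 R z q = Coefficients.generating-function R z q , equidistributed
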